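{- There exists an absolute constant $c_1>0$ with the following property. Let $3=p_1<p_2<\cdots$ be the increasing sequence of odd primes, and let $(\varepsilon_i)_{i\ge1}$ be any sequence with $\varepsilon_i\in\{0,1\}$. Then for every sufficiently large real $x$ there exists a positive integer $n<x$ such that $$e_{p_i}(n)\equiv\varepsilon_i\pmod 2\quad\text{for all } i=1,\dots,k(x),\qquad\text{where } k(x):=\Bigl\lfloor c_1\Bigl(\frac{\log x}{(\log\log x)^6}\Bigr)^{1/9}\Bigr\rfloor .$$
   Context: For a prime $p$ and a non-negative integer $n$, $e_p(n)$ denotes the exponent of $p$ in the prime factorization of $n!$. -}

module Defs where

open import Data.Bool.Base using (if_then_else_)
open import Data.Integer.Base as ℤ using (+_)
import Data.Integer.Properties as ℤ
open import Data.List.Base using (length; filter)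
open import Data.Nat.Base as ℕ using (ℕ; zero; suc; _!)
open import Data.Nat.Divisibility using (_∣_)
open import Data.Nat.Primality using (Prime)
open import Data.Nat.Primality.Factorisation using (factorise; factors)
import Data.Nat.Properties as ℕ
open import Data.Product.Base using (∃-syntax; _×_; _,_)
open import Data.Rational.Base
open import Data.Rational.Properties
import Data.Rational.Unnormalised.Base as ℚᵘ
import Data.Rational.Unnormalised.Properties as ℚᵘ
open import Data.Rational.Solver
open import Data.Sum.Base using (_⊎_; inj₁; inj₂)
open import Algebra.Definitions.RawSemiring +-*-rawSemiring using (_^_)
open import Relation.Binary.PropositionalEquality
open import Relation.Nullary using (¬_; Dec; does; yes; no; contradiction)

open +-*-Solver using (solve; _:+_; _:*_; _:-_; :-_; con; _:=_)

e : ℕ → ℕ → ℕ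
e p n = length (filter (p ℕ.≟_) (factors (factorise (n !) {{n ℕ.!≢0}})))

OddPrime : ℕ → Set
OddPrime q = Prime q × ¬ (2 ∣ q)

-- Indices are shifted by one: p i is the odd prime p_{i+1}.
record IsOddPrimeSequence (p : ℕ → ℕ) : Set where
  field
    increasing : ∀ i → p i ℕ.< p (suc i)
    oddPrime   : ∀ i → OddPrime (p i)
    exhaustive : ∀ q → OddPrime q → ∃[ i ] p i ≡ q

ι : ℕ → ℚ
ι n = + n / 1

toℚᵘ-ι : ∀ n → toℚᵘ (ι n) ℚᵘ.≃ ℚᵘ.mkℚᵘ (+ n) 0
toℚᵘ-ι n = toℚᵘ-fromℚᵘ (ℚᵘ.mkℚᵘ (+ n) 0)

ι-+ : ∀ m n → ι (m ℕ.+ n) ≡ ι m + ι n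
ι-+ m n = toℚᵘ-injective (begin
  toℚᵘ (ι (m ℕ.+ n))                     ≈⟨ toℚᵘ-ι (m ℕ.+ n) ⟩
  ℚᵘ.mkℚᵘ (+ (m ℕ.+ n)) 0                ≈⟨ ℚᵘ.*≡* (cong (ℤ._* + 1) (sym (cong₂ ℤ._+_ (ℤ.*-identityʳ (+ m)) (ℤ.*-identityʳ (+ n))))) ⟩
  ℚᵘ.mkℚᵘ (+ m) 0 ℚᵘ.+ ℚᵘ.mkℚᵘ (+ n) 0   ≈⟨ ℚᵘ.+-cong (ℚᵘ.≃-sym (toℚᵘ-ι m)) (ℚᵘ.≃-sym (toℚᵘ-ι n)) ⟩
  toℚᵘ (ι m) ℚᵘ.+ toℚᵘ (ι n)             ≈⟨ ℚᵘ.≃-sym (toℚᵘ-homo-+ (ι m) (ι n)) ⟩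
  toℚᵘ (ι m + ι n)                       ∎)
  where open ℚᵘ.≃-Reasoning

ι-suc : ∀ n → ι (suc n) ≡ 1ℚ + ι n
ι-suc = ι-+ 1

0≤1 : 0ℚ ≤ 1ℚ
0≤1 = nonNegative⁻¹ 1ℚ

0<½ : 0ℚ < ½
0<½ = positive⁻¹ ½

0≤+ : ∀ {a b} → 0ℚ ≤ a → 0ℚ ≤ b → 0ℚ ≤ a + b
0≤+ p q = +-mono-≤ p q

*-mono : ∀ {a b c d} → 0ℚ ≤ a → a ≤ b → 0ℚ ≤ c → c ≤ d → a * c ≤ b * d
*-mono {a} {b} {c} {d} 0≤a a≤b 0≤c c≤d = ≤-trans
  (*-monoʳ-≤-nonNeg c {{nonNegative 0≤c}} a≤b)
  (*-monoˡ-≤-nonNeg b {{nonNegative (≤-trans 0≤a a≤b)}} c≤d)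

0≤* : ∀ {a b} → 0ℚ ≤ a → 0ℚ ≤ b → 0ℚ ≤ a * b
0≤* {a} {b} p q = subst (_≤ a * b) (*-zeroˡ 0ℚ) (*-mono ≤-refl p ≤-refl q)

0<* : ∀ {a b} → 0ℚ < a → 0ℚ < b → 0ℚ < a * b
0<* {a} {b} p q = positive⁻¹ (a * b) {{pos*pos⇒pos a {{positive p}} b {{positive q}}}}

0≤ι : ∀ n → 0ℚ ≤ ι n
0≤ι zero    = ≤-refl
0≤ι (suc n) = subst (0ℚ ≤_) (sym (ι-suc n)) (0≤+ 0≤1 (0≤ι n))

0<ιsuc : ∀ n → 0ℚ < ι (suc n)
0<ιsuc n = subst (0ℚ <_) (sym (ι-suc n)) (+-mono-<-≤ (positive⁻¹ 1ℚ) (0≤ι n))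

ι-mono : ∀ {m n} → m ℕ.≤ n → ι m ≤ ι n
ι-mono {m} {n} m≤n = subst₂ _≤_ (+-identityʳ (ι m))
  (trans (sym (ι-+ m (n ℕ.∸ m))) (cong ι (ℕ.m+[n∸m]≡n m≤n)))
  (+-monoʳ-≤ (ι m) (0≤ι (n ℕ.∸ m)))

archimedean : ∀ q → ∃[ n ] q ≤ ι n
archimedean q@(mkℚ n d-1 _) = ℤ.∣ n ∣ , toℚᵘ-cancel-≤
  (ℚᵘ.≤-respʳ-≃ (ℚᵘ.≃-sym (toℚᵘ-ι ℤ.∣ n ∣)) (ℚᵘ.*≤* (bound n)))
  where
  bound : ∀ n → n ℤ.* + 1 ℤ.≤ + ℤ.∣ n ∣ ℤ.* + suc d-1
  bound (+ n) = subst₂ ℤ._≤_ (ℤ.pos-* n 1) (ℤ.pos-* n (suc d-1))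
                  (ℤ.+≤+ (ℕ.*-monoʳ-≤ n (ℕ.s≤s ℕ.z≤n)))
  bound ℤ.-[1+ n ] = ℤ.≤-trans ℤ.-≤+ (subst (+ 0 ℤ.≤_) (ℤ.pos-* (suc n) (suc d-1)) (ℤ.+≤+ ℕ.z≤n))

-- Reciprocal, with the conventional value 0 at 0.
recip : ℚ → ℚ
recip q with q ≟ 0ℚ
... | yes _   = 0ℚ
... | no  q≢0 = 1/_ q {{≢-nonZero q≢0}}

*-recip : ∀ {q} → 0ℚ < q → q * recip q ≡ 1ℚ
*-recip {q} 0<q with q ≟ 0ℚ
... | yes q≡0 = contradiction (sym q≡0) (<⇒≢ 0<q)
... | no  q≢0 = *-inverseʳ q {{≢-nonZero q≢0}}

recip-pos : ∀ {q} → 0ℚ < q → 0ℚ < recip q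
recip-pos {q} 0<q with recip q ≤? 0ℚ
... | no  ¬p = ≰⇒> ¬p
... | yes p  = contradiction
  (subst₂ _≤_ (*-recip 0<q) (*-zeroʳ q) (*-monoˡ-≤-nonNeg q {{nonNegative (<⇒≤ 0<q)}} p))
  (λ 1≤0 → <-irrefl refl (<-≤-trans (positive⁻¹ 1ℚ) 1≤0))

recip-antitone : ∀ {a b} → 0ℚ < a → a ≤ b → recip b ≤ recip a
recip-antitone {a} {b} 0<a a≤b = subst₂ _≤_ l r
  (*-mono (0≤* 0≤rb (<⇒≤ 0<a)) (*-mono 0≤rb ≤-refl (<⇒≤ 0<a) a≤b) 0≤ra ≤-refl)
  where
  0<b = <-≤-trans 0<a a≤b
  0≤ra = <⇒≤ (recip-pos 0<a)
  0≤rb = <⇒≤ (recip-pos 0<b)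
  l : recip b * a * recip a ≡ recip b
  l = trans (*-assoc (recip b) a (recip a)) (trans (cong (recip b *_) (*-recip 0<a)) (*-identityʳ (recip b)))
  r : recip b * b * recip a ≡ recip a
  r = trans (cong (_* recip a) (trans (*-comm (recip b) b) (*-recip 0<b))) (*-identityˡ (recip a))

∣∣≤ : ∀ {a c} → a ≤ c → - a ≤ c → ∣ a ∣ ≤ c
∣∣≤ {a} {c} p q with ∣p∣≡p∨∣p∣≡-p a
... | inj₁ eq = subst (_≤ c) (sym eq) p
... | inj₂ eq = subst (_≤ c) (sym eq) q

≤∣∣ : ∀ a → a ≤ ∣ a ∣
≤∣∣ a with ≤-total 0ℚ a
... | inj₁ 0≤a = ≤-reflexive (sym (0≤p⇒∣p∣≡p 0≤a))
... | inj₂ a≤0 = ≤-trans a≤0 (0≤∣p∣ a)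

∣-∣-sym : ∀ a b → ∣ a - b ∣ ≡ ∣ b - a ∣
∣-∣-sym a b = trans (sym (∣-p∣≡∣p∣ (a - b)))
  (cong ∣_∣ (solve 2 (λ a b → :- (a :- b) := b :- a) refl a b))

triangle : ∀ a b c → ∣ a - c ∣ ≤ ∣ a - b ∣ + ∣ b - c ∣
triangle a b c = subst (λ z → ∣ z ∣ ≤ ∣ a - b ∣ + ∣ b - c ∣)
  (solve 3 (λ a b c → (a :- b) :+ (b :- c) := a :- c) refl a b c)
  (∣p+q∣≤∣p∣+∣q∣ (a - b) (b - c))

∣*∣≤ : ∀ {a b A B} → ∣ a ∣ ≤ A → ∣ b ∣ ≤ B → ∣ a * b ∣ ≤ A * B
∣*∣≤ {a} {b} p q = subst (_≤ _) (sym (∣p*q∣≡∣p∣*∣q∣ a b)) (*-mono (0≤∣p∣ a) p (0≤∣p∣ b) q)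

∣-∣≤⇒≤ : ∀ {a b c} → ∣ a - b ∣ ≤ c → a ≤ b + c
∣-∣≤⇒≤ {a} {b} {c} p = subst (_≤ b + c)
  (solve 2 (λ a b → b :+ (a :- b) := a) refl a b)
  (+-monoʳ-≤ b (≤-trans (≤∣∣ (a - b)) p))

≤⇒∣-∣≤ : ∀ {a b c} → a ≤ b + c → b ≤ a + c → ∣ a - b ∣ ≤ c
≤⇒∣-∣≤ {a} {b} {c} p q = ∣∣≤
  (subst (a - b ≤_) (solve 2 (λ b c → b :+ c :- b := c) refl b c) (+-monoˡ-≤ (- b) p))
  (subst₂ _≤_ (solve 2 (λ a b → b :- a := :- (a :- b)) refl a b)
              (solve 2 (λ a c → a :+ c :- a := c) refl a c) (+-monoˡ-≤ (- a) q))

shrink : ∀ B ε → 0ℚ ≤ B → 0ℚ < ε → ∃[ η ] 0ℚ < η × B * η ≤ ε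
shrink B ε 0≤B 0<ε = η , 0<η , ≤-trans (*-mono 0≤B B≤ (<⇒≤ 0<η) ≤-refl) (≤-reflexive eq)
  where
  0<B+1 : 0ℚ < B + 1ℚ
  0<B+1 = +-mono-≤-< 0≤B (positive⁻¹ 1ℚ)
  B≤ : B ≤ B + 1ℚ
  B≤ = subst (_≤ B + 1ℚ) (+-identityʳ B) (+-monoʳ-≤ B 0≤1)
  η = ε * recip (B + 1ℚ)
  0<η = 0<* 0<ε (recip-pos 0<B+1)
  eq : (B + 1ℚ) * η ≡ ε
  eq = trans (solve 3 (λ b e r → b :* (e :* r) := e :* (b :* r)) refl (B + 1ℚ) ε (recip (B + 1ℚ)))
       (trans (cong (ε *_) (*-recip 0<B+1)) (*-identityʳ ε))

halves : ∀ ε → ε * ½ + ε * ½ ≡ ε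
halves = solve 1 (λ e → e :* con ½ :+ e :* con ½ := e) refl

-- w n = 1/(n+1)
w : ℕ → ℚ
w n = recip (ι (suc n))

0<w : ∀ n → 0ℚ < w n
0<w n = recip-pos (0<ιsuc n)

w-small : ∀ ε → 0ℚ < ε → ∃[ N ] ∀ n → N ℕ.≤ n → w n ≤ ε
w-small ε 0<ε with archimedean (recip ε)
... | N , r≤N = N , λ n N≤n → subst (w n ≤_) (r n)
  (*-mono-l (≤-trans r≤N (ι-mono (ℕ.≤-trans N≤n (ℕ.n≤1+n n)))) n)
  where
  r : ∀ n → (ε * ι (suc n)) * w n ≡ ε
  r n = trans (*-assoc ε (ι (suc n)) (w n))
        (trans (cong (ε *_) (*-recip (0<ιsuc n))) (*-identityʳ ε))
  *-mono-l : ∀ {s} → recip ε ≤ s → ∀ n → w n ≤ ε * s * w n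
  *-mono-l {s} p n = subst (_≤ ε * s * w n)
    (trans (cong (_* w n) (*-recip 0<ε)) (*-identityˡ (w n)))
    (*-monoʳ-≤-nonNeg (w n) {{nonNegative (<⇒≤ (0<w n))}}
      (*-monoˡ-≤-nonNeg ε {{nonNegative (<⇒≤ 0<ε)}} p))

0<^ : ∀ {a} n → 0ℚ < a → 0ℚ < a ^ n
0<^ zero    p = positive⁻¹ 1ℚ
0<^ (suc n) p = 0<* p (0<^ n p)

0≤^ : ∀ {a} n → 0ℚ ≤ a → 0ℚ ≤ a ^ n
0≤^ zero    p = 0≤1
0≤^ (suc n) p = 0≤* p (0≤^ n p)

^-mono : ∀ {a b} n → 0ℚ ≤ a → a ≤ b → a ^ n ≤ b ^ n
^-mono zero    0≤a a≤b = ≤-refl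
^-mono (suc n) 0≤a a≤b = *-mono 0≤a a≤b (0≤^ n 0≤a) (^-mono n 0≤a a≤b)

½^≤w : ∀ n → ½ ^ n ≤ w n
½^≤w n = subst₂ _≤_
  (trans (*-assoc (½ ^ n) (ι (suc n)) (w n))
    (trans (cong (½ ^ n *_) (*-recip (0<ιsuc n))) (*-identityʳ (½ ^ n))))
  (*-identityˡ (w n))
  (*-monoʳ-≤-nonNeg (w n) {{nonNegative (<⇒≤ (0<w n))}} (key n))
  where
  key : ∀ n → ½ ^ n * ι (suc n) ≤ 1ℚ
  key zero    = ≤-refl
  key (suc n) = ≤-trans
    (*-monoˡ-≤-nonNeg (½ * ½ ^ n) {{nonNegative (<⇒≤ (0<^ (suc n) 0<½))}} ιstep)
    (subst (_≤ 1ℚ) (solve 2 (λ h i → h :* i := (con ½ :* h) :* (i :+ i)) refl (½ ^ n) (ι (suc n))) (key n))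
    where
    ιstep : ι (suc (suc n)) ≤ ι (suc n) + ι (suc n)
    ιstep = subst (_≤ ι (suc n) + ι (suc n)) (sym (ι-suc (suc n)))
      (+-monoˡ-≤ (ι (suc n)) (ι-mono {1} {suc n} (ℕ.s≤s ℕ.z≤n)))

∑ : ℕ → (ℕ → ℚ) → ℚ
∑ zero    f = 0ℚ
∑ (suc n) f = ∑ n f + f n

∑-diff : ∀ n f g {C} → (∀ j → j ℕ.< n → ∣ f j - g j ∣ ≤ C) → ∣ ∑ n f - ∑ n g ∣ ≤ ι n * C
∑-diff zero    f g {C} h = ≤-reflexive (sym (*-zeroˡ C))
∑-diff (suc n) f g {C} h = begin
  ∣ (∑ n f + f n) - (∑ n g + g n) ∣       ≡⟨ cong ∣_∣ (solve 4 (λ a b c d → (a :+ b) :- (c :+ d) := (a :- c) :+ (b :- d)) refl (∑ n f) (f n) (∑ n g) (g n)) ⟩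
  ∣ (∑ n f - ∑ n g) + (f n - g n) ∣       ≤⟨ ∣p+q∣≤∣p∣+∣q∣ (∑ n f - ∑ n g) (f n - g n) ⟩
  ∣ ∑ n f - ∑ n g ∣ + ∣ f n - g n ∣       ≤⟨ +-mono-≤ (∑-diff n f g (λ j j<n → h j (ℕ.m<n⇒m<1+n j<n))) (h n ℕ.≤-refl) ⟩
  ι n * C + C                             ≡⟨ solve 2 (λ i c → i :* c :+ c := (con 1ℚ :+ i) :* c) refl (ι n) C ⟩
  (1ℚ + ι n) * C                          ≡⟨ cong (_* C) (sym (ι-suc n)) ⟩
  ι (suc n) * C                           ∎
  where open ≤-Reasoning

∑-pair : ∀ n f → ∑ (n ℕ.+ n) f ≡ ∑ n (λ j → f (j ℕ.+ j) + f (suc (j ℕ.+ j)))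
∑-pair zero    f = refl
∑-pair (suc n) f = trans (cong (λ m → ∑ (suc m) f) (ℕ.+-suc n n))
  (trans (+-assoc (∑ (n ℕ.+ n) f) (f (n ℕ.+ n)) (f (suc (n ℕ.+ n))))
         (cong (_+ (f (n ℕ.+ n) + f (suc (n ℕ.+ n)))) (∑-pair n f)))

record ℝ : Set where
  constructor mkℝ
  field
    seq    : ℕ → ℚ
    cauchy : ∀ ε → 0ℚ < ε → ∃[ N ] ∀ m n → N ℕ.≤ m → N ℕ.≤ n → ∣ seq m - seq n ∣ ≤ ε

open ℝ

infix 4 _<ℝ_ _≤ℝ_

_<ℝ_ : ℝ → ℝ → Set
x <ℝ y = ∃[ δ ] 0ℚ < δ × ∃[ N ] (∀ n → N ℕ.≤ n → seq x n + δ ≤ seq y n)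

_≤ℝ_ : ℝ → ℝ → Set
x ≤ℝ y = ∀ ε → 0ℚ < ε → ∃[ N ] ∀ n → N ℕ.≤ n → seq x n ≤ seq y n + ε

fromℚ : ℚ → ℝ
fromℚ q = mkℝ (λ _ → q) λ ε 0<ε → 0 , λ _ _ _ _ →
  subst (λ z → ∣ z ∣ ≤ ε) (sym (+-inverseʳ q)) (<⇒≤ 0<ε)

fromℕ : ℕ → ℝ
fromℕ n = fromℚ (ι n)

0ℝ 1ℝ : ℝ
0ℝ = fromℕ 0
1ℝ = fromℕ 1

bounded : ∀ x → ∃[ B ] 0ℚ ≤ B × ∃[ N ] (∀ n → N ℕ.≤ n → ∣ seq x n ∣ ≤ B)
bounded x with cauchy x 1ℚ (positive⁻¹ 1ℚ)
... | N , h = ∣ seq x N ∣ + 1ℚ , 0≤+ (0≤∣p∣ (seq x N)) 0≤1 , N , λ n N≤n →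
  subst (λ z → ∣ z ∣ ≤ ∣ seq x N ∣ + 1ℚ)
    (solve 2 (λ a b → a :+ (b :- a) := b) refl (seq x N) (seq x n))
    (≤-trans (∣p+q∣≤∣p∣+∣q∣ (seq x N) (seq x n - seq x N))
             (+-monoʳ-≤ ∣ seq x N ∣ (h n N N≤n ℕ.≤-refl)))

max₁ : ∀ {a b n} → a ℕ.⊔ b ℕ.≤ n → a ℕ.≤ n
max₁ {a} {b} p = ℕ.≤-trans (ℕ.m≤m⊔n a b) p

max₂ : ∀ {a b n} → a ℕ.⊔ b ℕ.≤ n → b ℕ.≤ n
max₂ {a} {b} p = ℕ.≤-trans (ℕ.m≤n⊔m a b) p

infixl 7 _*ℝ_
infixr 8 _^ℝ_

product-diff : ∀ a b c d {A B η} → ∣ a ∣ ≤ A → ∣ d ∣ ≤ B → ∣ a - c ∣ ≤ η → ∣ b - d ∣ ≤ η →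
               ∣ a * b - c * d ∣ ≤ (A + B) * η
product-diff a b c d {A} {B} {η} a≤A d≤B ac bd = begin
  ∣ a * b - c * d ∣                     ≡⟨ cong ∣_∣ (solve 4 (λ a b c d → a :* b :- c :* d := a :* (b :- d) :+ (a :- c) :* d) refl a b c d) ⟩
  ∣ a * (b - d) + (a - c) * d ∣         ≤⟨ ∣p+q∣≤∣p∣+∣q∣ (a * (b - d)) ((a - c) * d) ⟩
  ∣ a * (b - d) ∣ + ∣ (a - c) * d ∣     ≤⟨ +-mono-≤ (∣*∣≤ {a} {b - d} a≤A bd) (∣*∣≤ {a - c} {d} ac d≤B) ⟩
  A * η + η * B                         ≡⟨ solve 3 (λ a b e → a :* e :+ e :* b := (a :+ b) :* e) refl A B η ⟩
  (A + B) * η                           ∎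
  where open ≤-Reasoning

_*ℝ_ : ℝ → ℝ → ℝ
x *ℝ y = mkℝ (λ n → seq x n * seq y n) λ ε 0<ε →
  let A , 0≤A , N₁ , hA = bounded x
      B , 0≤B , N₂ , hB = bounded y
      η , 0<η , ABη≤ε   = shrink (A + B) ε (0≤+ 0≤A 0≤B) 0<ε
      N₃ , hx           = cauchy x η 0<η
      N₄ , hy           = cauchy y η 0<η
  in (N₁ ℕ.⊔ N₂) ℕ.⊔ (N₃ ℕ.⊔ N₄) , λ m n pm pn → ≤-trans
    (product-diff (seq x m) (seq y m) (seq x n) (seq y n)
      (hA m (max₁ {N₁} {N₂} (max₁ {N₁ ℕ.⊔ N₂} pm)))
      (hB n (max₂ {N₁} {N₂} (max₁ {N₁ ℕ.⊔ N₂} pn)))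
      (hx m n (max₁ {N₃} {N₄} (max₂ {N₁ ℕ.⊔ N₂} pm)) (max₁ {N₃} {N₄} (max₂ {N₁ ℕ.⊔ N₂} pn)))
      (hy m n (max₂ {N₃} {N₄} (max₂ {N₁ ℕ.⊔ N₂} pm)) (max₂ {N₃} {N₄} (max₂ {N₁ ℕ.⊔ N₂} pn))))
    ABη≤ε

_^ℝ_ : ℝ → ℕ → ℝ
x ^ℝ zero  = 1ℝ
x ^ℝ suc n = x *ℝ (x ^ℝ n)

lower : ∀ {x} → 0ℝ <ℝ x → ∃[ δ ] 0ℚ < δ × ∃[ N ] (∀ n → N ℕ.≤ n → δ ≤ seq x n)
lower {x} (δ , 0<δ , N , h) = δ , 0<δ , N , λ n N≤n →
  subst (_≤ seq x n) (+-identityˡ δ) (h n N≤n)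

*ℝ-pos : ∀ {x y} → 0ℝ <ℝ x → 0ℝ <ℝ y → 0ℝ <ℝ x *ℝ y
*ℝ-pos {x} {y} p q with lower {x} p | lower {y} q
... | δ , 0<δ , N₁ , h₁ | γ , 0<γ , N₂ , h₂ = δ * γ , 0<* 0<δ 0<γ , N₁ ℕ.⊔ N₂ , λ n N≤n →
  subst (_≤ seq x n * seq y n) (sym (+-identityˡ (δ * γ)))
    (*-mono (<⇒≤ 0<δ) (h₁ n (max₁ {N₁} {N₂} N≤n)) (<⇒≤ 0<γ) (h₂ n (max₂ {N₁} {N₂} N≤n)))

^ℝ-pos : ∀ {x} n → 0ℝ <ℝ x → 0ℝ <ℝ x ^ℝ n
^ℝ-pos {x} zero    p = 1ℚ , positive⁻¹ 1ℚ , 0 , λ _ _ → ≤-refl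
^ℝ-pos {x} (suc n) p = *ℝ-pos {x} {x ^ℝ n} p (^ℝ-pos {x} n p)

recip-diff : ∀ {δ a b} → 0ℚ < δ → δ ≤ a → δ ≤ b →
             ∣ recip a - recip b ∣ ≤ (recip δ * recip δ) * ∣ a - b ∣
recip-diff {δ} {a} {b} 0<δ δ≤a δ≤b = begin
  ∣ recip a - recip b ∣                   ≡⟨ cong ∣_∣ eq ⟩
  ∣ (recip a * recip b) * (b - a) ∣       ≤⟨ ∣*∣≤ {recip a * recip b} {b - a} bnd (≤-reflexive (∣-∣-sym b a)) ⟩
  (recip δ * recip δ) * ∣ a - b ∣         ∎
  where
  open ≤-Reasoning
  0<a = <-≤-trans 0<δ δ≤a
  0<b = <-≤-trans 0<δ δ≤b
  bnd : ∣ recip a * recip b ∣ ≤ recip δ * recip δ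
  bnd = subst (_≤ recip δ * recip δ)
    (sym (0≤p⇒∣p∣≡p (0≤* (<⇒≤ (recip-pos 0<a)) (<⇒≤ (recip-pos 0<b)))))
    (*-mono (<⇒≤ (recip-pos 0<a)) (recip-antitone 0<δ δ≤a) (<⇒≤ (recip-pos 0<b)) (recip-antitone 0<δ δ≤b))
  eq : recip a - recip b ≡ (recip a * recip b) * (b - a)
  eq = begin-equality
    recip a - recip b                              ≡⟨ sym (cong₂ _-_ (*-identityʳ (recip a)) (*-identityʳ (recip b))) ⟩
    recip a * 1ℚ - recip b * 1ℚ                    ≡⟨ sym (cong₂ (λ u v → recip a * u - recip b * v) (*-recip 0<b) (*-recip 0<a)) ⟩
    recip a * (b * recip b) - recip b * (a * recip a)
      ≡⟨ solve 4 (λ a b p q → p :* (b :* q) :- q :* (a :* p) := (p :* q) :* (b :- a)) refl a b (recip a) (recip b) ⟩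
    (recip a * recip b) * (b - a)                  ∎

recipℝ : (x : ℝ) → 0ℝ <ℝ x → ℝ
recipℝ x 0<x = mkℝ (λ n → recip (seq x n)) λ ε 0<ε →
  let δ , 0<δ , N₁ , hδ = lower {x} 0<x
      0≤C               = <⇒≤ (0<* (recip-pos 0<δ) (recip-pos 0<δ))
      η , 0<η , Cη≤ε    = shrink (recip δ * recip δ) ε 0≤C 0<ε
      N₂ , hx           = cauchy x η 0<η
  in N₁ ℕ.⊔ N₂ , λ m n pm pn → ≤-trans
    (recip-diff 0<δ (hδ m (max₁ {N₁} {N₂} pm)) (hδ n (max₁ {N₁} {N₂} pn)))
    (≤-trans (*-monoˡ-≤-nonNeg (recip δ * recip δ) {{nonNegative 0≤C}}
               (hx m n (max₂ {N₁} {N₂} pm) (max₂ {N₁} {N₂} pn)))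
             Cη≤ε)

divide : (x y : ℝ) → 0ℝ <ℝ y → ℝ
divide x y 0<y = x *ℝ recipℝ y 0<y

leftTerm : ℚ → ℕ → ℚ
leftTerm h j = h * recip (1ℚ + ι j * h)

-- Left Riemann sum of 1/t from 1 to a on 2ⁿ subintervals of equal (signed) length.
riemann : ℕ → ℚ → ℚ
riemann n a = ∑ (2 ℕ.^ n) (leftTerm ((a - 1ℚ) * ½ ^ n))

ι2^*½^ : ∀ n → ι (2 ℕ.^ n) * ½ ^ n ≡ 1ℚ
ι2^*½^ zero    = refl
ι2^*½^ (suc n) = begin
  ι (2 ℕ.^ n ℕ.+ (2 ℕ.^ n ℕ.+ 0)) * (½ * ½ ^ n) ≡⟨ cong (λ m → ι (2 ℕ.^ n ℕ.+ m) * (½ * ½ ^ n)) (ℕ.+-identityʳ (2 ℕ.^ n)) ⟩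
  ι (2 ℕ.^ n ℕ.+ 2 ℕ.^ n) * (½ * ½ ^ n)         ≡⟨ cong (_* (½ * ½ ^ n)) (ι-+ (2 ℕ.^ n) (2 ℕ.^ n)) ⟩
  (ι (2 ℕ.^ n) + ι (2 ℕ.^ n)) * (½ * ½ ^ n)     ≡⟨ solve 2 (λ i h → (i :+ i) :* (con ½ :* h) := i :* h) refl (ι (2 ℕ.^ n)) (½ ^ n) ⟩
  ι (2 ℕ.^ n) * ½ ^ n                           ≡⟨ ι2^*½^ n ⟩
  1ℚ                                            ∎
  where open ≡-Reasoning

node-lower : ∀ {δ a} n j → δ ≤ 1ℚ → δ ≤ a → j ℕ.≤ 2 ℕ.^ n → δ ≤ 1ℚ + ι j * ((a - 1ℚ) * ½ ^ n)
node-lower {δ} {a} n j δ≤1 δ≤a j≤ = subst₂ _≤_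
  (solve 2 (λ s d → (con 1ℚ :- s) :* d :+ s :* d := d) refl s δ)
  (solve 3 (λ i h a → (con 1ℚ :- i :* h) :* con 1ℚ :+ (i :* h) :* a := con 1ℚ :+ i :* ((a :- con 1ℚ) :* h)) refl (ι j) (½ ^ n) a)
  (+-mono-≤ (*-monoˡ-≤-nonNeg (1ℚ - s) {{nonNegative 0≤1-s}} δ≤1)
            (*-monoˡ-≤-nonNeg s {{nonNegative 0≤s}} δ≤a))
  where
  s = ι j * ½ ^ n
  0≤½^n = <⇒≤ (0<^ n 0<½)
  0≤s : 0ℚ ≤ s
  0≤s = 0≤* (0≤ι j) 0≤½^n
  s≤1 : s ≤ 1ℚ
  s≤1 = subst (s ≤_) (ι2^*½^ n) (*-monoʳ-≤-nonNeg (½ ^ n) {{nonNegative 0≤½^n}} (ι-mono j≤))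
  0≤1-s : 0ℚ ≤ 1ℚ - s
  0≤1-s = subst (_≤ 1ℚ - s) (+-inverseʳ s) (+-monoˡ-≤ (- s) s≤1)

recip²-bound : ∀ {δ D E} → 0ℚ < δ → δ ≤ D → δ ≤ E → ∣ recip D * recip E ∣ ≤ recip δ * recip δ
recip²-bound {δ} {D} {E} 0<δ δ≤D δ≤E = subst (_≤ recip δ * recip δ)
  (sym (0≤p⇒∣p∣≡p (0≤* 0≤rD 0≤rE)))
  (*-mono 0≤rD (recip-antitone 0<δ δ≤D) 0≤rE (recip-antitone 0<δ δ≤E))
  where
  0≤rD = <⇒≤ (recip-pos (<-≤-trans 0<δ δ≤D))
  0≤rE = <⇒≤ (recip-pos (<-≤-trans 0<δ δ≤E))

quotient-diff : ∀ u v {D E} → 0ℚ < D → 0ℚ < E →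
                u * recip D - v * recip E ≡ (u * E - v * D) * (recip D * recip E)
quotient-diff u v {D} {E} 0<D 0<E = begin
  u * recip D - v * recip E
    ≡⟨ sym (cong₂ _-_ (*-identityʳ (u * recip D)) (*-identityʳ (v * recip E))) ⟩
  u * recip D * 1ℚ - v * recip E * 1ℚ
    ≡⟨ sym (cong₂ (λ p q → u * recip D * p - v * recip E * q) (*-recip 0<E) (*-recip 0<D)) ⟩
  u * recip D * (E * recip E) - v * recip E * (D * recip D)
    ≡⟨ solve 6 (λ u v D E p q → u :* p :* (E :* q) :- v :* q :* (D :* p) := (u :* E :- v :* D) :* (p :* q)) refl u v D E (recip D) (recip E) ⟩
  (u * E - v * D) * (recip D * recip E) ∎
  where open ≡-Reasoning

term-lipschitz : ∀ {δ} u v i → 0ℚ < δ → δ ≤ 1ℚ + i * u → δ ≤ 1ℚ + i * v →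
                 ∣ u * recip (1ℚ + i * u) - v * recip (1ℚ + i * v) ∣ ≤ ∣ u - v ∣ * (recip δ * recip δ)
term-lipschitz {δ} u v i 0<δ hu hv = subst (λ z → ∣ z ∣ ≤ ∣ u - v ∣ * (recip δ * recip δ))
  (sym (trans (quotient-diff u v (<-≤-trans 0<δ hu) (<-≤-trans 0<δ hv))
    (cong (_* (recip (1ℚ + i * u) * recip (1ℚ + i * v)))
      (solve 3 (λ u v i → u :* (con 1ℚ :+ i :* v) :- v :* (con 1ℚ :+ i :* u) := u :- v) refl u v i))))
  (∣*∣≤ {u - v} {recip (1ℚ + i * u) * recip (1ℚ + i * v)} ≤-refl (recip²-bound 0<δ hu hv))

riemann-lipschitz : ∀ {δ} n a b → 0ℚ < δ → δ ≤ 1ℚ → δ ≤ a → δ ≤ b →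
                    ∣ riemann n a - riemann n b ∣ ≤ (recip δ * recip δ) * ∣ a - b ∣
riemann-lipschitz {δ} n a b 0<δ δ≤1 δ≤a δ≤b = ≤-trans
  (∑-diff (2 ℕ.^ n) (leftTerm u) (leftTerm v) λ j j< →
    term-lipschitz u v (ι j) 0<δ (node-lower n j δ≤1 δ≤a (ℕ.<⇒≤ j<)) (node-lower n j δ≤1 δ≤b (ℕ.<⇒≤ j<)))
  (≤-reflexive (begin
    ι (2 ℕ.^ n) * (∣ u - v ∣ * C)
      ≡⟨ cong (λ z → ι (2 ℕ.^ n) * (∣ z ∣ * C)) (solve 3 (λ a b h → (a :- con 1ℚ) :* h :- (b :- con 1ℚ) :* h := (a :- b) :* h) refl a b (½ ^ n)) ⟩
    ι (2 ℕ.^ n) * (∣ (a - b) * ½ ^ n ∣ * C)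
      ≡⟨ cong (λ z → ι (2 ℕ.^ n) * (z * C)) (trans (∣p*q∣≡∣p∣*∣q∣ (a - b) (½ ^ n)) (cong (∣ a - b ∣ *_) (0≤p⇒∣p∣≡p (<⇒≤ (0<^ n 0<½))))) ⟩
    ι (2 ℕ.^ n) * (∣ a - b ∣ * ½ ^ n * C)
      ≡⟨ solve 4 (λ i d h c → i :* (d :* h :* c) := (i :* h) :* (c :* d)) refl (ι (2 ℕ.^ n)) ∣ a - b ∣ (½ ^ n) C ⟩
    (ι (2 ℕ.^ n) * ½ ^ n) * (C * ∣ a - b ∣)
      ≡⟨ trans (cong (_* (C * ∣ a - b ∣)) (ι2^*½^ n)) (*-identityˡ (C * ∣ a - b ∣)) ⟩
    C * ∣ a - b ∣ ∎))
  where
  open ≡-Reasoning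
  C = recip δ * recip δ
  u = (a - 1ℚ) * ½ ^ n
  v = (b - 1ℚ) * ½ ^ n

-- Halving a subinterval of length 2u starting at D changes its contribution by u²/(D(D+u)).
split-diff : ∀ {δ} u D → 0ℚ < δ → δ ≤ D → δ ≤ D + u →
             ∣ (u * recip D + u * recip (D + u)) - (u + u) * recip D ∣ ≤ (∣ u ∣ * ∣ u ∣) * (recip δ * recip δ)
split-diff {δ} u D 0<δ hD hE = subst (λ z → ∣ z ∣ ≤ (∣ u ∣ * ∣ u ∣) * (recip δ * recip δ))
  (sym eq)
  (∣*∣≤ {u * D - u * (D + u)} {recip (D + u) * recip D}
    (subst (_≤ ∣ u ∣ * ∣ u ∣)
      (trans (sym (∣-p∣≡∣p∣ (u * u))) (cong ∣_∣ (solve 2 (λ u D → :- (u :* u) := u :* D :- u :* (D :+ u)) refl u D)))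
      (∣*∣≤ {u} {u} ≤-refl ≤-refl))
    (recip²-bound 0<δ hE hD))
  where
  eq : (u * recip D + u * recip (D + u)) - (u + u) * recip D ≡ (u * D - u * (D + u)) * (recip (D + u) * recip D)
  eq = trans (solve 3 (λ u p q → (u :* p :+ u :* q) :- (u :+ u) :* p := u :* q :- u :* p) refl u (recip D) (recip (D + u)))
             (quotient-diff u u (<-≤-trans 0<δ hE) (<-≤-trans 0<δ hD))

riemann-step : ∀ {δ A} n a → 0ℚ < δ → δ ≤ 1ℚ → δ ≤ a → ∣ a - 1ℚ ∣ ≤ A →
               ∣ riemann (suc n) a - riemann n a ∣ ≤ (A * A) * (recip δ * recip δ) * (½ * ½ ^ n)
riemann-step {δ} {A} n a 0<δ δ≤1 δ≤a a≤A = ≤-trans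
  (subst (λ z → ∣ z - riemann n a ∣ ≤ ι M * B) (sym refine)
    (∑-diff M (λ j → leftTerm u (j ℕ.+ j) + leftTerm u (suc (j ℕ.+ j))) (leftTerm v) pairs))
  (begin
    ι M * ((∣ u ∣ * ∣ u ∣) * C)
      ≤⟨ *-monoˡ-≤-nonNeg (ι M) {{nonNegative (0≤ι M)}} (*-monoʳ-≤-nonNeg C {{nonNegative 0≤C}} (*-mono (0≤∣p∣ u) u≤ (0≤∣p∣ u) u≤)) ⟩
    ι M * ((A * (½ * H) * (A * (½ * H))) * C)
      ≡⟨ solve 4 (λ i A H C → i :* ((A :* (con ½ :* H) :* (A :* (con ½ :* H))) :* C) := (i :* H) :* (((A :* A) :* C :* (con ½ :* H)) :* con ½)) refl (ι M) A H C ⟩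
    (ι M * H) * (K * ½)
      ≡⟨ trans (cong (_* (K * ½)) (ι2^*½^ n)) (*-identityˡ (K * ½)) ⟩
    K * ½
      ≤⟨ *-monoˡ-≤-nonNeg K {{nonNegative 0≤K}} ½≤1 ⟩
    K * 1ℚ
      ≡⟨ *-identityʳ K ⟩
    K ∎)
  where
  open ≤-Reasoning
  M = 2 ℕ.^ n
  H = ½ ^ n
  C = recip δ * recip δ
  u = (a - 1ℚ) * (½ * H)
  v = (a - 1ℚ) * H
  B = (∣ u ∣ * ∣ u ∣) * C
  K = (A * A) * C * (½ * H)
  ½≤1 : ½ ≤ 1ℚ
  ½≤1 = ≤ᵇ⇒≤ _
  0≤A : 0ℚ ≤ A
  0≤A = ≤-trans (0≤∣p∣ (a - 1ℚ)) a≤A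
  0≤C : 0ℚ ≤ C
  0≤C = <⇒≤ (0<* (recip-pos 0<δ) (recip-pos 0<δ))
  0≤½H : 0ℚ ≤ ½ * H
  0≤½H = <⇒≤ (0<^ (suc n) 0<½)
  0≤K : 0ℚ ≤ K
  0≤K = 0≤* (0≤* (0≤* 0≤A 0≤A) 0≤C) 0≤½H
  u≤ : ∣ u ∣ ≤ A * (½ * H)
  u≤ = ∣*∣≤ {a - 1ℚ} {½ * H} a≤A (≤-reflexive (0≤p⇒∣p∣≡p 0≤½H))
  u+u : u + u ≡ v
  u+u = solve 2 (λ b H → b :* (con ½ :* H) :+ b :* (con ½ :* H) := b :* H) refl (a - 1ℚ) H
  refine : riemann (suc n) a ≡ ∑ M (λ j → leftTerm u (j ℕ.+ j) + leftTerm u (suc (j ℕ.+ j)))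
  refine = trans (cong (λ m → ∑ (M ℕ.+ m) (leftTerm u)) (ℕ.+-identityʳ M)) (∑-pair M (leftTerm u))
  even : ∀ j → 1ℚ + ι (j ℕ.+ j) * u ≡ 1ℚ + ι j * v
  even j = trans (cong (λ z → 1ℚ + z * u) (ι-+ j j))
    (trans (solve 2 (λ i u → con 1ℚ :+ (i :+ i) :* u := con 1ℚ :+ i :* (u :+ u)) refl (ι j) u)
           (cong (λ z → 1ℚ + ι j * z) u+u))
  odd : ∀ j → 1ℚ + ι (suc (j ℕ.+ j)) * u ≡ (1ℚ + ι j * v) + u
  odd j = trans (cong (λ z → 1ℚ + z * u) (ι-suc (j ℕ.+ j)))
    (trans (solve 2 (λ i u → con 1ℚ :+ (con 1ℚ :+ i) :* u := (con 1ℚ :+ i :* u) :+ u) refl (ι (j ℕ.+ j)) u)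
           (cong (_+ u) (even j)))
  pairs : ∀ j → j ℕ.< M → ∣ (leftTerm u (j ℕ.+ j) + leftTerm u (suc (j ℕ.+ j))) - leftTerm v j ∣ ≤ B
  pairs j j<M = subst (λ z → ∣ z ∣ ≤ B)
    (cong₂ _-_ (cong₂ (λ D E → u * recip D + u * recip E) (sym (even j)) (sym (odd j)))
               (cong (_* recip (1ℚ + ι j * v)) u+u))
    (split-diff u (1ℚ + ι j * v) 0<δ
      (node-lower n j δ≤1 δ≤a (ℕ.<⇒≤ j<M))
      (subst (δ ≤_) (odd j) (node-lower (suc n) (suc (j ℕ.+ j)) δ≤1 δ≤a
        (subst (suc (j ℕ.+ j) ℕ.≤_) (cong (M ℕ.+_) (sym (ℕ.+-identityʳ M)))
          (ℕ.+-mono-≤ j<M (ℕ.<⇒≤ j<M))))))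

riemann-tail : ∀ {δ A} n k a → 0ℚ < δ → δ ≤ 1ℚ → δ ≤ a → ∣ a - 1ℚ ∣ ≤ A →
               ∣ riemann (k ℕ.+ n) a - riemann n a ∣ ≤ (A * A) * (recip δ * recip δ) * (½ ^ n - ½ ^ (k ℕ.+ n))
riemann-tail {δ} {A} n zero a 0<δ δ≤1 δ≤a a≤A = ≤-reflexive
  (trans (cong ∣_∣ (+-inverseʳ (riemann n a)))
    (sym (trans (cong ((A * A) * (recip δ * recip δ) *_) (+-inverseʳ (½ ^ n))) (*-zeroʳ ((A * A) * (recip δ * recip δ))))))
riemann-tail {δ} {A} n (suc k) a 0<δ δ≤1 δ≤a a≤A = begin
  ∣ riemann (suc k ℕ.+ n) a - riemann n a ∣
    ≤⟨ triangle (riemann (suc k ℕ.+ n) a) (riemann (k ℕ.+ n) a) (riemann n a) ⟩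
  ∣ riemann (suc k ℕ.+ n) a - riemann (k ℕ.+ n) a ∣ + ∣ riemann (k ℕ.+ n) a - riemann n a ∣
    ≤⟨ +-mono-≤ (riemann-step (k ℕ.+ n) a 0<δ δ≤1 δ≤a a≤A) (riemann-tail n k a 0<δ δ≤1 δ≤a a≤A) ⟩
  K * (½ * ½ ^ (k ℕ.+ n)) + K * (½ ^ n - ½ ^ (k ℕ.+ n))
    ≡⟨ solve 3 (λ K h g → K :* (con ½ :* h) :+ K :* (g :- h) := K :* (g :- con ½ :* h)) refl K (½ ^ (k ℕ.+ n)) (½ ^ n) ⟩
  K * (½ ^ n - ½ * ½ ^ (k ℕ.+ n)) ∎
  where
  open ≤-Reasoning
  K = (A * A) * (recip δ * recip δ)

riemann-cauchy : ∀ {δ A} N n a → N ℕ.≤ n → 0ℚ < δ → δ ≤ 1ℚ → δ ≤ a → ∣ a - 1ℚ ∣ ≤ A →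
                 ∣ riemann n a - riemann N a ∣ ≤ (A * A) * (recip δ * recip δ) * w N
riemann-cauchy {δ} {A} N n a N≤n 0<δ δ≤1 δ≤a a≤A = ≤-trans
  (subst (λ m → ∣ riemann m a - riemann N a ∣ ≤ K * (½ ^ N - ½ ^ m)) (ℕ.m∸n+n≡m N≤n)
    (riemann-tail N (n ℕ.∸ N) a 0<δ δ≤1 δ≤a a≤A))
  (*-monoˡ-≤-nonNeg K {{nonNegative 0≤K}} (≤-trans drop (½^≤w N)))
  where
  K = (A * A) * (recip δ * recip δ)
  0≤A : 0ℚ ≤ A
  0≤A = ≤-trans (0≤∣p∣ (a - 1ℚ)) a≤A
  0≤K : 0ℚ ≤ K
  0≤K = 0≤* (0≤* 0≤A 0≤A) (<⇒≤ (0<* (recip-pos 0<δ) (recip-pos 0<δ)))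
  drop : ½ ^ N - ½ ^ n ≤ ½ ^ N
  drop = subst (½ ^ N - ½ ^ n ≤_) (+-identityʳ (½ ^ N))
    (+-monoʳ-≤ (½ ^ N) (neg-antimono-≤ (<⇒≤ (0<^ n 0<½))))

-- The natural logarithm as log x = ∫₁ˣ dt/t: the diagonal sequence of Riemann sums.
log : (x : ℝ) → 0ℝ <ℝ x → ℝ
log x 0<x = mkℝ (λ n → riemann n (seq x n)) λ ε 0<ε →
  let δ₀ , 0<δ₀ , N₁ , hδ = lower {x} 0<x
      B , 0≤B , N₂ , hB   = bounded x
      δ     = δ₀ ⊓ 1ℚ
      0<δ   = ⊓-pos 0<δ₀
      A     = B + 1ℚ
      C     = recip δ * recip δ
      0≤C   = <⇒≤ (0<* (recip-pos 0<δ) (recip-pos 0<δ))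
      K     = (A * A) * C
      0≤A   = 0≤+ 0≤B 0≤1
      0≤K   = 0≤* (0≤* 0≤A 0≤A) 0≤C
      0<ε/2 = 0<* 0<ε 0<½
      0<ε/4 = 0<* 0<ε/2 0<½
      η , 0<η , Cη≤ = shrink C (ε * ½) 0≤C 0<ε/2
      θ , 0<θ , Kθ≤ = shrink K (ε * ½ * ½) 0≤K 0<ε/4
      N₃ , hx = cauchy x η 0<η
      N₄ , hw = w-small θ 0<θ
      N = (N₁ ℕ.⊔ N₂) ℕ.⊔ (N₃ ℕ.⊔ N₄)
      l : ∀ n → N ℕ.≤ n → δ ≤ seq x n
      l n p = ≤-trans (p⊓q≤p δ₀ 1ℚ) (hδ n (max₁ {N₁} {N₂} (max₁ {N₁ ℕ.⊔ N₂} p)))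
      b : ∀ n → N ℕ.≤ n → ∣ seq x n - 1ℚ ∣ ≤ A
      b n p = ≤-trans (∣p-q∣≤∣p∣+∣q∣ (seq x n) 1ℚ) (+-monoˡ-≤ 1ℚ (hB n (max₂ {N₁} {N₂} (max₁ {N₁ ℕ.⊔ N₂} p))))
      tail : ∀ n → N ℕ.≤ n → ∣ riemann n (seq x n) - riemann N (seq x n) ∣ ≤ ε * ½ * ½
      tail n p = ≤-trans
        (riemann-cauchy N n (seq x n) p 0<δ (p⊓q≤q δ₀ 1ℚ) (l n p) (b n p))
        (≤-trans (*-monoˡ-≤-nonNeg K {{nonNegative 0≤K}} (hw N (max₂ {N₃} {N₄} (max₂ {N₁ ℕ.⊔ N₂} ℕ.≤-refl)))) Kθ≤)
      mid : ∀ m n → N ℕ.≤ m → N ℕ.≤ n → ∣ riemann N (seq x m) - riemann N (seq x n) ∣ ≤ ε * ½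
      mid m n p q = ≤-trans
        (riemann-lipschitz N (seq x m) (seq x n) 0<δ (p⊓q≤q δ₀ 1ℚ) (l m p) (l n q))
        (≤-trans (*-monoˡ-≤-nonNeg C {{nonNegative 0≤C}}
          (hx m n (max₁ {N₃} {N₄} (max₂ {N₁ ℕ.⊔ N₂} p)) (max₁ {N₃} {N₄} (max₂ {N₁ ℕ.⊔ N₂} q)))) Cη≤)
  in N , λ m n p q → four (riemann m (seq x m)) (riemann N (seq x m)) (riemann N (seq x n)) (riemann n (seq x n)) ε
      (tail m p) (mid m n p q) (tail n q)
  where
  ⊓-pos : ∀ {δ} → 0ℚ < δ → 0ℚ < δ ⊓ 1ℚ
  ⊓-pos {δ} 0<δ with ≤-total δ 1ℚ
  ... | inj₁ p = subst (0ℚ <_) (sym (p≤q⇒p⊓q≡p p)) 0<δ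
  ... | inj₂ p = subst (0ℚ <_) (sym (p≥q⇒p⊓q≡q p)) (positive⁻¹ 1ℚ)
  four : ∀ a b c d ε → ∣ a - b ∣ ≤ ε * ½ * ½ → ∣ b - c ∣ ≤ ε * ½ → ∣ d - c ∣ ≤ ε * ½ * ½ → ∣ a - d ∣ ≤ ε
  four a b c d ε p q r = subst (∣ a - d ∣ ≤_)
    (solve 1 (λ e → (e :* con ½ :* con ½ :+ e :* con ½) :+ e :* con ½ :* con ½ := e) refl ε)
    (≤-trans (triangle a c d) (+-mono-≤
      (≤-trans (triangle a b c) (+-mono-≤ p q))
      (subst (_≤ ε * ½ * ½) (∣-∣-sym d c) r)))

-- Largest j ≤ b with (j · h)ᵈ ≤ a, or 0 if there is none.
search : (d : ℕ) (h a : ℚ) (b : ℕ) → ℕ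
search d h a zero    = 0
search d h a (suc b) = if does ((ι (suc b) * h) ^ d ≤? a) then suc b else search d h a b

-- Largest multiple of 1/(n+1) in [0, n+1] whose d-th power is at most a (0 if there is none);
-- the cap n+1 is inactive for large n along a bounded sequence of arguments.
rootApprox : (d n : ℕ) → ℚ → ℚ
rootApprox d n a = ι (search d (w n) a (suc n ℕ.* suc n)) * w n

search-lower : ∀ d h a b → search d h a b ≡ 0 ⊎ (ι (search d h a b) * h) ^ d ≤ a
search-lower d h a zero    = inj₁ refl
search-lower d h a (suc b) = go ((ι (suc b) * h) ^ d ≤? a)
  where
  go : (p? : Dec ((ι (suc b) * h) ^ d ≤ a)) →
       let j = if does p? then suc b else search d h a b in j ≡ 0 ⊎ (ι j * h) ^ d ≤ a
  go (yes p) = inj₂ p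
  go (no  _) = search-lower d h a b

search-upper : ∀ d h a b → a < (ι (suc b) * h) ^ d → a < (ι (suc (search d h a b)) * h) ^ d
search-upper d h a zero    p = p
search-upper d h a (suc b) p = go ((ι (suc b) * h) ^ d ≤? a)
  where
  go : (q? : Dec ((ι (suc b) * h) ^ d ≤ a)) →
       a < (ι (suc (if does q? then suc b else search d h a b)) * h) ^ d
  go (yes _) = p
  go (no  q) = search-upper d h a b (≰⇒> q)

^-superadd : ∀ {a b} e → 0ℚ ≤ a → 0ℚ ≤ b → a ^ suc e + b ^ suc e ≤ (a + b) ^ suc e
^-superadd {a} {b} zero    0≤a 0≤b = ≤-reflexive (solve 2 (λ a b → a :* con 1ℚ :+ b :* con 1ℚ := (a :+ b) :* con 1ℚ) refl a b)
^-superadd {a} {b} (suc e) 0≤a 0≤b = ≤-trans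
  (subst (a * A + b * B ≤_) (solve 4 (λ a b A B → (a :* A :+ b :* B) :+ (a :* B :+ b :* A) := (a :+ b) :* (A :+ B)) refl a b A B)
    (subst (_≤ (a * A + b * B) + (a * B + b * A)) (+-identityʳ (a * A + b * B))
      (+-monoʳ-≤ (a * A + b * B) (0≤+ (0≤* 0≤a 0≤B) (0≤* 0≤b 0≤A)))))
  (*-monoˡ-≤-nonNeg (a + b) {{nonNegative (0≤+ 0≤a 0≤b)}} (^-superadd e 0≤a 0≤b))
  where
  A = a ^ suc e
  B = b ^ suc e
  0≤A = 0≤^ (suc e) 0≤a
  0≤B = 0≤^ (suc e) 0≤b

≤^ : ∀ {y} e → 1ℚ ≤ y → y ≤ y ^ suc e
≤^ {y} e 1≤y = subst (_≤ y * y ^ e) (*-identityʳ y)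
  (*-monoˡ-≤-nonNeg y {{nonNegative (≤-trans 0≤1 1≤y)}} (1≤^ e))
  where
  1≤^ : ∀ e → 1ℚ ≤ y ^ e
  1≤^ zero    = ≤-refl
  1≤^ (suc e) = *-mono 0≤1 1≤y 0≤1 (1≤^ e)

ιsuc*w : ∀ j n → ι (suc j) * w n ≡ ι j * w n + w n
ιsuc*w j n = trans (cong (_* w n) (ι-suc j))
  (solve 2 (λ i h → (con 1ℚ :+ i) :* h := i :* h :+ h) refl (ι j) (w n))

ι-* : ∀ m n → ι (m ℕ.* n) ≡ ι m * ι n
ι-* zero    n = sym (*-zeroˡ (ι n))
ι-* (suc m) n = trans (ι-+ n (m ℕ.* n)) (trans (cong (λ z → ι n + z) (ι-* m n))
  (trans (solve 2 (λ i j → j :+ i :* j := (con 1ℚ :+ i) :* j) refl (ι m) (ι n)) (cong (_* ι n) (sym (ι-suc m)))))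

0≤rootApprox : ∀ d n a → 0ℚ ≤ rootApprox d n a
0≤rootApprox d n a = 0≤* (0≤ι (search d (w n) a (suc n ℕ.* suc n))) (<⇒≤ (0<w n))

rootApprox-upper : ∀ e n a → a ≤ ι (suc n) → a < (rootApprox (suc e) n a + w n) ^ suc e
rootApprox-upper e n a a≤ = subst (λ z → a < z ^ suc e)
  (ιsuc*w (search (suc e) (w n) a (suc n ℕ.* suc n)) n)
  (search-upper (suc e) (w n) a (suc n ℕ.* suc n)
    (≤-<-trans a≤ (<-≤-trans (subst (ι (suc n) <_) (sym top)
        (subst (_< ι (suc n) + w n) (+-identityʳ (ι (suc n))) (+-monoʳ-< (ι (suc n)) (0<w n))))
      (≤^ e (subst (1ℚ ≤_) (sym top) (+-mono-≤ (ι-mono {1} {suc n} (ℕ.s≤s ℕ.z≤n)) (<⇒≤ (0<w n))))))))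
  where
  top : ι (suc (suc n ℕ.* suc n)) * w n ≡ ι (suc n) + w n
  top = trans (ιsuc*w (suc n ℕ.* suc n) n) (cong (_+ w n)
    (trans (cong (_* w n) (ι-* (suc n) (suc n)))
      (trans (*-assoc (ι (suc n)) (ι (suc n)) (w n))
        (trans (cong (ι (suc n) *_) (*-recip (0<ιsuc n))) (*-identityʳ (ι (suc n)))))))

rootApprox-≤ : ∀ e m n a b η → b ≤ ι (suc n) → 0ℚ < η → a ≤ b + η ^ suc e →
               rootApprox (suc e) m a ≤ rootApprox (suc e) n b + (w n + η)
rootApprox-≤ e m n a b η b≤ 0<η a≤ = go (search-lower (suc e) (w m) a (suc m ℕ.* suc m))
  where
  s = rootApprox (suc e) m a
  t = rootApprox (suc e) n b
  0≤t+w : 0ℚ ≤ t + w n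
  0≤t+w = 0≤+ (0≤rootApprox (suc e) n b) (<⇒≤ (0<w n))
  0≤rhs : 0ℚ ≤ t + (w n + η)
  0≤rhs = 0≤+ (0≤rootApprox (suc e) n b) (0≤+ (<⇒≤ (0<w n)) (<⇒≤ 0<η))
  go : search (suc e) (w m) a (suc m ℕ.* suc m) ≡ 0 ⊎ s ^ suc e ≤ a → s ≤ t + (w n + η)
  go (inj₁ eq) = subst (_≤ t + (w n + η)) (sym (trans (cong (λ j → ι j * w m) eq) (*-zeroˡ (w m)))) 0≤rhs
  go (inj₂ p) = ≮⇒≥ λ q → <-irrefl refl
    (<-≤-trans (+-monoˡ-< (η ^ suc e) (rootApprox-upper e n b b≤))
      (≤-trans (^-superadd e 0≤t+w (<⇒≤ 0<η))
        (≤-trans (^-mono (suc e) (0≤+ 0≤t+w (<⇒≤ 0<η))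
                   (subst (_≤ s) (sym (+-assoc t (w n) η)) (<⇒≤ q)))
          (≤-trans p a≤))))

-- The non-negative d-th root, taken to be 0 on negative reals.
root : (d : ℕ) .{{_ : ℕ.NonZero d}} → ℝ → ℝ
root (suc e) x = mkℝ (λ n → rootApprox (suc e) n (seq x n)) λ ε 0<ε →
  let B , 0≤B , N₁ , hB = bounded x
      N₂ , hN = archimedean B
      η   = ε * ½
      0<η = 0<* 0<ε 0<½
      N₃ , hw = w-small η 0<η
      N₄ , hx = cauchy x (η ^ suc e) (0<^ (suc e) 0<η)
      N = (N₁ ℕ.⊔ N₂) ℕ.⊔ (N₃ ℕ.⊔ N₄)
      top : ∀ n → N ℕ.≤ n → seq x n ≤ ι (suc n)
      top n p = ≤-trans (≤∣∣ (seq x n)) (≤-trans (hB n (max₁ {N₁} {N₂} (max₁ {N₁ ℕ.⊔ N₂} p)))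
        (≤-trans hN (ι-mono (ℕ.≤-trans (max₂ {N₁} {N₂} (max₁ {N₁ ℕ.⊔ N₂} p)) (ℕ.n≤1+n n)))))
      half : ∀ m n → N ℕ.≤ m → N ℕ.≤ n →
             rootApprox (suc e) m (seq x m) ≤ rootApprox (suc e) n (seq x n) + ε
      half m n p q = ≤-trans
        (rootApprox-≤ e m n (seq x m) (seq x n) η (top n q) 0<η
          (∣-∣≤⇒≤ (hx m n (max₂ {N₃} {N₄} (max₂ {N₁ ℕ.⊔ N₂} p)) (max₂ {N₃} {N₄} (max₂ {N₁ ℕ.⊔ N₂} q)))))
        (+-monoʳ-≤ (rootApprox (suc e) n (seq x n))
          (subst (w n + η ≤_) (halves ε)
            (+-monoˡ-≤ η (hw n (max₁ {N₃} {N₄} (max₂ {N₁ ℕ.⊔ N₂} q))))))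
  in N , λ m n p q → ≤⇒∣-∣≤ (half m n p q) (half n m q p)

-- k = ⌊ x ⌋.  A relation, since ⌊_⌋ is not computable on Cauchy reals.
IsFloor : ℝ → ℕ → Set
IsFloor x k = fromℕ k ≤ℝ x × x <ℝ fromℕ (suc k)

{-# OPTIONS --safe #-}
module Submission where

-- For an odd prime p, Legendre's formula makes ψ(n) = (-1)^e_p(n) equal to (-1)^(sum of the digits of n
-- in odd positions to base p).  Its truncation χ to the lowest 2T digits has period Q = p^(2T), and the
-- mean over d of |Σ_r χ(r) χ(r + d)| / Q decays like (7/9)^T.
--
-- Fix a window 0 ≤ h < H.  The decay lets one choose residues r_1, r_2, ... one prime after the other so
-- that every class of shifts h with prescribed signs χ_j(r_j + h) for the primes treated so far is split
-- almost evenly by the next prime; in the end every sign pattern occurs in the window.  Take N congruent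
-- to r_j modulo p_j Q_j for all j.  Then ψ_j(N + h) = κ_j χ_j(r_j + h) with κ_j independent of h, and some
-- n = N + h has the required parities.  With Erdős' bound p_k < 4^(k+2), coming from the representation of
-- every integer as a square times a squarefree number, this gives log n = O(k³).

open import Defs
open import Data.Fin.Base using (Fin; toℕ)
open import Data.Nat.Base as ℕ using (ℕ)
open import Data.Nat.DivMod using (_%_)
open import Data.Product.Base using (Σ-syntax; ∃-syntax; _×_; _,_)
open import Relation.Binary.PropositionalEquality using (_≡_)

-- Origin of 7/9: in a pair of digits the odd-position one gives neighbouring shifts nearly opposite
-- correlations, and the even-position one below it averages neighbouring shifts. The proportion of
-- the mass that survives is at most 1/2 + 1/p - 1/(2p²), which is largest at p = 3. Origin of the
-- cube: with every prime both the number of classes and the largest weight double, so K primes cost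
-- a factor 8^K in a second-moment bound, and primes up to 4^(K+1) cost further fixed powers of
-- 2^(K+1). Paying for this takes O(K) digit pairs even at the largest prime, where a pair is worth
-- O(K) bits. Hence a window of length 2^(O(K²)), and K moduli of comparable size. On the analytic
-- side comparison of Cauchy reals is not decidable, so x enters only through an integer m near log₂
-- x that is read off from one rational approximation, and n is fixed before k is known.

module Arithmetic where

  open import Algebra.Structures using (IsCommutativeSemiring)
  open import Data.Fin.Base as Fin using (fromℕ<; combine)
  open import Data.Fin.Properties using (toℕ<n; toℕ-injective; toℕ-fromℕ<; combine-injective; injective⇒≤)
  open import Data.Integer.Base as ℤ using (ℤ; +_; 1ℤ; -1ℤ; ∣_∣)
  import Data.Integer.Properties as ℤ
  open import Data.Integer.Solver using () renaming (module +-*-Solver to ℤ-Solver)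
  open import Data.List.Base using (List; []; _∷_; _++_; map; length; filter; lookup; applyUpTo)
  open import Data.List.Membership.Propositional using (_∈_)
  open import Data.List.Membership.Propositional.Properties using (∈-map⁺; ∈-map⁻; ∈-++⁺ˡ; ∈-++⁺ʳ; ∈-++⁻; ∈-applyUpTo⁺)
  open import Data.List.Properties using (length-++; length-map; length-applyUpTo; filter-++; filter-accept; filter-none)
  open import Data.List.Relation.Binary.Permutation.Propositional.Properties using (filter-↭; ↭-length)
  open import Data.List.Relation.Unary.All as All using (All; []; _∷_)
  import Data.List.Relation.Unary.All.Properties as All
  open import Data.List.Relation.Unary.Any using (here; there; index)
  open import Data.List.Relation.Unary.Any.Properties using (lookup-index)
  open import Data.Nat.Base
  open import Data.Nat.Coprimality using (Coprime; coprime-divisor; coprime-Bézout; prime⇒coprime; 1-coprimeTo)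
  open import Data.Nat.Divisibility
  open import Data.Nat.DivMod
  open import Data.Nat.GCD using (module Bézout)
  open import Data.Nat.ListAction using (product)
  open import Data.Nat.ListAction.Properties using (product-++; ∈⇒∣product)
  open import Data.Nat.Primality using (Prime; prime⇒irreducible; ¬prime[1])
  open import Data.Nat.Primality.Factorisation
  open import Data.Nat.Properties
  open import Data.Nat.Solver using () renaming (module +-*-Solver to ℕ-Solver)
  open import Data.Product.Base using (proj₁; proj₂)
  open import Data.Sum.Base using (_⊎_; inj₁; inj₂)
  open import Relation.Binary.PropositionalEquality
  open import Relation.Nullary using (¬_; yes; no; contradiction)

  -- Finite sums over a commutative semiring, and signs

  module Summation {A : Set} {_⊕_ _⊗_ : A → A → A} {0# 1# : A}
    (isCommutativeSemiring : IsCommutativeSemiring _≡_ _⊕_ _⊗_ 0# 1#) where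

    open IsCommutativeSemiring isCommutativeSemiring
      using (zeroʳ; distribˡ)
      renaming (+-assoc to ⊕-assoc; +-comm to ⊕-comm; +-identityˡ to ⊕-identityˡ; +-identityʳ to ⊕-identityʳ)

    sum : ℕ → (ℕ → A) → A
    sum zero    f = 0#
    sum (suc n) f = sum n f ⊕ f n

    sum-cong : ∀ n {f g} → (∀ i → i < n → f i ≡ g i) → sum n f ≡ sum n g
    sum-cong zero    h = refl
    sum-cong (suc n) h = cong₂ _⊕_ (sum-cong n λ i i<n → h i (m<n⇒m<1+n i<n)) (h n ≤-refl)

    ⊕-interchange : ∀ a b c d → (a ⊕ b) ⊕ (c ⊕ d) ≡ (a ⊕ c) ⊕ (b ⊕ d)
    ⊕-interchange a b c d = begin
      (a ⊕ b) ⊕ (c ⊕ d) ≡⟨ ⊕-assoc a b (c ⊕ d) ⟩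
      a ⊕ (b ⊕ (c ⊕ d)) ≡⟨ cong (a ⊕_) (⊕-assoc b c d) ⟨
      a ⊕ ((b ⊕ c) ⊕ d) ≡⟨ cong (λ x → a ⊕ (x ⊕ d)) (⊕-comm b c) ⟩
      a ⊕ ((c ⊕ b) ⊕ d) ≡⟨ cong (a ⊕_) (⊕-assoc c b d) ⟩
      a ⊕ (c ⊕ (b ⊕ d)) ≡⟨ ⊕-assoc a c (b ⊕ d) ⟨
      (a ⊕ c) ⊕ (b ⊕ d) ∎
      where open ≡-Reasoning

    sum-⊕ : ∀ n f g → sum n (λ i → f i ⊕ g i) ≡ sum n f ⊕ sum n g
    sum-⊕ zero    f g = sym (⊕-identityˡ 0#)
    sum-⊕ (suc n) f g = trans (cong (_⊕ (f n ⊕ g n)) (sum-⊕ n f g))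
      (⊕-interchange (sum n f) (sum n g) (f n) (g n))

    sum-⊗ˡ : ∀ n c f → sum n (λ i → c ⊗ f i) ≡ c ⊗ sum n f
    sum-⊗ˡ zero    c f = sym (zeroʳ c)
    sum-⊗ˡ (suc n) c f = trans (cong (_⊕ (c ⊗ f n)) (sum-⊗ˡ n c f)) (sym (distribˡ c (sum n f) (f n)))

    sum-0 : ∀ n → sum n (λ _ → 0#) ≡ 0#
    sum-0 zero    = refl
    sum-0 (suc n) = trans (⊕-identityʳ (sum n (λ _ → 0#))) (sum-0 n)

    sum-swap : ∀ m n (f : ℕ → ℕ → A) → sum m (λ i → sum n (f i)) ≡ sum n (λ j → sum m (λ i → f i j))
    sum-swap zero    n f = sym (sum-0 n)
    sum-swap (suc m) n f = trans (cong (_⊕ sum n (f m)) (sum-swap m n f))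
      (sym (sum-⊕ n (λ j → sum m (λ i → f i j)) (f m)))

    sum-split : ∀ m n f → sum (m + n) f ≡ sum m f ⊕ sum n (λ i → f (m + i))
    sum-split m zero    f = trans (cong (λ x → sum x f) (+-identityʳ m))
      (sym (⊕-identityʳ (sum m f)))
    sum-split m (suc n) f = trans (cong (λ x → sum x f) (+-suc m n))
      (trans (cong (_⊕ f (m + n)) (sum-split m n f))
             (⊕-assoc (sum m f) (sum n (λ i → f (m + i))) (f (m + n))))

    sum-digits : ∀ p N f → sum (p * N) f ≡ sum N (λ m → sum p (λ a → f (a + p * m)))
    sum-digits p zero    f = cong (λ x → sum x f) (*-zeroʳ p)
    sum-digits p (suc N) f = begin
      sum (p * suc N) f
        ≡⟨ cong (λ x → sum x f) (trans (*-suc p N) (+-comm p (p * N))) ⟩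
      sum (p * N + p) f
        ≡⟨ sum-split (p * N) p f ⟩
      sum (p * N) f ⊕ sum p (λ a → f (p * N + a))
        ≡⟨ cong₂ _⊕_ (sum-digits p N f) (sum-cong p λ a _ → cong f (+-comm (p * N) a)) ⟩
      sum (suc N) (λ m → sum p (λ a → f (a + p * m))) ∎
      where open ≡-Reasoning

    sum-suc : ∀ n f → f 0 ⊕ sum n (λ i → f (suc i)) ≡ sum (suc n) f
    sum-suc n f = trans (cong (_⊕ sum n (λ i → f (suc i))) (sym (⊕-identityˡ (f 0)))) (sym (sum-split 1 n f))

    sum-shift : ∀ N f → (∀ i → f (N + i) ≡ f i) → ∀ h → sum N (λ i → f (h + i)) ≡ sum N f
    sum-shift zero    f periodic h = refl
    sum-shift (suc N) f periodic zero    = refl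
    sum-shift (suc N) f periodic (suc h) = begin
      sum (suc N) (λ i → f (suc h + i))
        ≡⟨ cong (sum N (λ i → f (suc h + i)) ⊕_) (trans (cong f wrap) (periodic h)) ⟩
      sum N (λ i → f (suc h + i)) ⊕ f h
        ≡⟨ ⊕-comm (sum N (λ i → f (suc h + i))) (f h) ⟩
      f h ⊕ sum N (λ i → f (suc h + i))
        ≡⟨ cong₂ _⊕_ (cong f (sym (+-identityʳ h))) (sum-cong N λ i _ → cong f (sym (+-suc h i))) ⟩
      f (h + 0) ⊕ sum N (λ i → f (h + suc i))
        ≡⟨ sum-suc N (λ i → f (h + i)) ⟩
      sum (suc N) (λ i → f (h + i))
        ≡⟨ sum-shift (suc N) f periodic h ⟩
      sum (suc N) f ∎
      where
      open ≡-Reasoning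
      wrap : suc h + N ≡ suc N + h
      wrap = cong suc (+-comm h N)

  open Summation +-*-isCommutativeSemiring using (sum; sum-cong; sum-digits; sum-shift; sum-suc)
    renaming (sum-⊕ to sum-+; sum-⊗ˡ to sum-*ˡ)
  open Summation ℤ.+-*-isCommutativeSemiring using () renaming
    ( sum to sumℤ; sum-cong to sumℤ-cong; sum-⊕ to sumℤ-+; sum-⊗ˡ to sumℤ-*ˡ; sum-swap to sumℤ-swap
    ; sum-split to sumℤ-split; sum-digits to sumℤ-digits; sum-shift to sumℤ-shift )

  sum-mono : ∀ n {f g} → (∀ i → i < n → f i ≤ g i) → sum n f ≤ sum n g
  sum-mono zero    h = z≤n
  sum-mono (suc n) h = +-mono-≤ (sum-mono n λ i i<n → h i (m<n⇒m<1+n i<n)) (h n ≤-refl)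

  sum-const : ∀ n c → sum n (λ _ → c) ≡ n * c
  sum-const zero    c = refl
  sum-const (suc n) c = trans (cong (_+ c) (sum-const n c)) (+-comm (n * c) c)

  sumℤ-const : ∀ n c → sumℤ n (λ _ → c) ≡ + n ℤ.* c
  sumℤ-const zero    c = sym (ℤ.*-zeroˡ c)
  sumℤ-const (suc n) c = trans (cong (ℤ._+ c) (sumℤ-const n c))
    (trans (ℤ.+-comm (+ n ℤ.* c) c) (sym (ℤ.suc-* (+ n) c)))

  sum-*ʳ : ∀ n f c → sum n (λ i → f i * c) ≡ sum n f * c
  sum-*ʳ n f c = trans (sum-cong n λ i _ → *-comm (f i) c) (trans (sum-*ˡ n c f) (*-comm c (sum n f)))

  sum-prefix : ∀ {m n} f → m ≤ n → sum m f ≤ sum n f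
  sum-prefix {m} f m≤n with ≤⇒≤′ m≤n
  ... | ≤′-refl              = ≤-refl
  ... | ≤′-step {n} m≤′n = ≤-trans (sum-prefix f (≤′⇒≤ m≤′n)) (m≤m+n (sum n f) (f n))

  ∣sumℤ∣≤ : ∀ n f → ∣ sumℤ n f ∣ ≤ sum n (λ i → ∣ f i ∣)
  ∣sumℤ∣≤ zero    f = z≤n
  ∣sumℤ∣≤ (suc n) f = ≤-trans (ℤ.∣i+j∣≤∣i∣+∣j∣ (sumℤ n f) (f n)) (+-monoˡ-≤ ∣ f n ∣ (∣sumℤ∣≤ n f))

  sgn : ℕ → ℤ
  sgn zero    = 1ℤ
  sgn (suc n) = ℤ.- sgn n

  sgn-+ : ∀ m n → sgn (m + n) ≡ sgn m ℤ.* sgn n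
  sgn-+ zero    n = sym (ℤ.*-identityˡ (sgn n))
  sgn-+ (suc m) n = trans (cong ℤ.-_ (sgn-+ m n)) (ℤ.neg-distribˡ-* (sgn m) (sgn n))

  sgn-square : ∀ n → sgn n ℤ.* sgn n ≡ 1ℤ
  sgn-square zero    = refl
  sgn-square (suc n) = trans (ℤ-Solver.solve 1 (λ x → :- x :* :- x := x :* x) refl (sgn n)) (sgn-square n)
    where open ℤ-Solver

  ∣sgn∣ : ∀ n → ∣ sgn n ∣ ≡ 1
  ∣sgn∣ zero    = refl
  ∣sgn∣ (suc n) = trans (ℤ.∣-i∣≡∣i∣ (sgn n)) (∣sgn∣ n)

  sgn-double : ∀ n → sgn (n + n) ≡ 1ℤ
  sgn-double n = trans (sgn-+ n n) (sgn-square n)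

  -- Correlations of digit functions

  Periodic : ℕ → (ℕ → ℤ) → Set
  Periodic N g = ∀ n → g (N + n) ≡ g n

  correlation : ℕ → (ℕ → ℤ) → ℕ → ℤ
  correlation N g d = sumℤ N (λ r → g r ℤ.* g (r + d))

  correlation-periodic : ∀ N g → Periodic N g → Periodic N (correlation N g)
  correlation-periodic N g periodic d = sumℤ-cong N λ r _ → cong (g r ℤ.*_)
    (trans (cong g (solve 3 (λ r N d → r :+ (N :+ d) := N :+ (r :+ d)) refl r N d)) (periodic (r + d)))
    where open ℕ-Solver

  module Digits (p : ℕ) .{{_ : NonZero p}} where

    lift : (ℕ → ℤ) → (ℕ → ℤ) → ℕ → ℤ
    lift u g n = u (n % p) ℤ.* g (n / p)

    digit% : ∀ {a} m → a < p → (a + p * m) % p ≡ a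
    digit% {a} m a<p = trans (cong (λ x → (a + x) % p) (*-comm p m)) (trans ([m+kn]%n≡m%n a m p) (m<n⇒m%n≡m a<p))

    digit/ : ∀ {a} m → a < p → (a + p * m) / p ≡ m
    digit/ {a} m a<p = *-cancelˡ-≡ ((a + p * m) / p) m p
      (trans (*-comm p _) (+-cancelˡ-≡ a _ _ (begin
        a + (a + p * m) / p * p                 ≡⟨ cong (_+ (a + p * m) / p * p) (digit% m a<p) ⟨
        (a + p * m) % p + (a + p * m) / p * p   ≡⟨ m≡m%n+[m/n]*n (a + p * m) p ⟨
        a + p * m                               ∎)))
      where open ≡-Reasoning

    digits : ∀ n → n ≡ n % p + p * (n / p)
    digits n = trans (m≡m%n+[m/n]*n n p) (cong (λ x → n % p + x) (*-comm (n / p) p))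

    lift-digit : ∀ u g {a} m → a < p → lift u g (a + p * m) ≡ u a ℤ.* g m
    lift-digit u g m a<p = cong₂ (λ x y → u x ℤ.* g y) (digit% m a<p) (digit/ m a<p)

    lift-periodic : ∀ u N g → Periodic N g → Periodic (p * N) (lift u g)
    lift-periodic u N g periodic n = begin
      lift u g (p * N + n)                     ≡⟨ cong (lift u g) regroup ⟩
      lift u g (n % p + p * (N + n / p))       ≡⟨ lift-digit u g (N + n / p) (m%n<n n p) ⟩
      u (n % p) ℤ.* g (N + n / p)              ≡⟨ cong (u (n % p) ℤ.*_) (periodic (n / p)) ⟩
      lift u g n                               ∎
      where
      open ≡-Reasoning
      open ℕ-Solver
      regroup : p * N + n ≡ n % p + p * (N + n / p)
      regroup = trans (cong (λ x → p * N + x) (digits n))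
        (solve 4 (λ p N a m → p :* N :+ (a :+ p :* m) := a :+ p :* (N :+ m)) refl p N (n % p) (n / p))

    -- In the r-th term, adding the digit c to a lowest digit a carries exactly when a ≥ c′ = p − c.
    correlation-lift : ∀ u g N {κ κ′} c′ c d → c′ + c ≡ p →
      (∀ a → u a ℤ.* u (a + c) ≡ κ) → (∀ a → u (c′ + a) ℤ.* u a ≡ κ′) →
      correlation (p * N) (lift u g) (c + p * d) ≡
        + c′ ℤ.* κ ℤ.* correlation N g d ℤ.+ + c ℤ.* κ′ ℤ.* correlation N g (suc d)
    correlation-lift u g N {κ} {κ′} c′ c d c′+c≡p uncarried carried = begin
      correlation (p * N) (lift u g) (c + p * d)
        ≡⟨ sumℤ-digits p N _ ⟩
      sumℤ N (λ m → sumℤ p (λ a → term m a))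
        ≡⟨ sumℤ-cong N (λ m _ → inner m) ⟩
      sumℤ N (λ m → + c′ ℤ.* κ ℤ.* (g m ℤ.* g (m + d)) ℤ.+ + c ℤ.* κ′ ℤ.* (g m ℤ.* g (m + suc d)))
        ≡⟨ sumℤ-+ N _ _ ⟩
      sumℤ N (λ m → + c′ ℤ.* κ ℤ.* (g m ℤ.* g (m + d))) ℤ.+ sumℤ N (λ m → + c ℤ.* κ′ ℤ.* (g m ℤ.* g (m + suc d)))
        ≡⟨ cong₂ ℤ._+_ (sumℤ-*ˡ N (+ c′ ℤ.* κ) _) (sumℤ-*ˡ N (+ c ℤ.* κ′) _) ⟩
      + c′ ℤ.* κ ℤ.* correlation N g d ℤ.+ + c ℤ.* κ′ ℤ.* correlation N g (suc d) ∎
      where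
      open ≡-Reasoning
      term : ℕ → ℕ → ℤ
      term m a = lift u g (a + p * m) ℤ.* lift u g (a + p * m + (c + p * d))
      c≤p : c ≤ p
      c≤p = subst (c ≤_) c′+c≡p (m≤n+m c c′)
      interchange : ∀ a b x y → a ℤ.* b ℤ.* (x ℤ.* y) ≡ a ℤ.* x ℤ.* (b ℤ.* y)
      interchange = ℤ-Solver.solve 4 (λ a b x y → a :* b :* (x :* y) := a :* x :* (b :* y)) refl
        where open ℤ-Solver
      low : ∀ m a → a < c′ → term m a ≡ κ ℤ.* (g m ℤ.* g (m + d))
      low m a a<c′ = begin
        lift u g (a + p * m) ℤ.* lift u g (a + p * m + (c + p * d))
          ≡⟨ cong (λ x → lift u g (a + p * m) ℤ.* lift u g x) regroup ⟩
        lift u g (a + p * m) ℤ.* lift u g (a + c + p * (m + d))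
          ≡⟨ cong₂ ℤ._*_ (lift-digit u g m (≤-trans a<c′ (subst (c′ ≤_) c′+c≡p (m≤m+n c′ c))))
                         (lift-digit u g (m + d) (subst (a + c <_) c′+c≡p (+-monoˡ-< c a<c′))) ⟩
        (u a ℤ.* g m) ℤ.* (u (a + c) ℤ.* g (m + d))
          ≡⟨ interchange (u a) (g m) (u (a + c)) (g (m + d)) ⟩
        u a ℤ.* u (a + c) ℤ.* (g m ℤ.* g (m + d))
          ≡⟨ cong (ℤ._* (g m ℤ.* g (m + d))) (uncarried a) ⟩
        κ ℤ.* (g m ℤ.* g (m + d)) ∎
        where
        open ℕ-Solver
        regroup : a + p * m + (c + p * d) ≡ a + c + p * (m + d)
        regroup = solve 5 (λ a p m c d → a :+ p :* m :+ (c :+ p :* d) := a :+ c :+ p :* (m :+ d)) refl a p m c d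
      high : ∀ m a → a < c → term m (c′ + a) ≡ κ′ ℤ.* (g m ℤ.* g (m + suc d))
      high m a a<c = begin
        lift u g (c′ + a + p * m) ℤ.* lift u g (c′ + a + p * m + (c + p * d))
          ≡⟨ cong (λ x → lift u g (c′ + a + p * m) ℤ.* lift u g x) regroup ⟩
        lift u g (c′ + a + p * m) ℤ.* lift u g (a + p * (m + suc d))
          ≡⟨ cong₂ ℤ._*_ (lift-digit u g m (subst (c′ + a <_) c′+c≡p (+-monoʳ-< c′ a<c)))
                         (lift-digit u g (m + suc d) (≤-trans a<c c≤p)) ⟩
        (u (c′ + a) ℤ.* g m) ℤ.* (u a ℤ.* g (m + suc d))
          ≡⟨ interchange (u (c′ + a)) (g m) (u a) (g (m + suc d)) ⟩
        u (c′ + a) ℤ.* u a ℤ.* (g m ℤ.* g (m + suc d))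
          ≡⟨ cong (ℤ._* (g m ℤ.* g (m + suc d))) (carried a) ⟩
        κ′ ℤ.* (g m ℤ.* g (m + suc d)) ∎
        where
        open ℕ-Solver
        regroup : c′ + a + p * m + (c + p * d) ≡ a + p * (m + suc d)
        regroup = trans
          (solve 6 (λ c′ a p m c d → c′ :+ a :+ p :* m :+ (c :+ p :* d) := a :+ ((c′ :+ c) :+ p :* (m :+ d))) refl c′ a p m c d)
          (trans (cong (λ x → a + (x + p * (m + d))) c′+c≡p)
                 (solve 4 (λ a p m d → a :+ (p :+ p :* (m :+ d)) := a :+ p :* (m :+ (con 1 :+ d))) refl a p m d))
      inner : ∀ m → sumℤ p (term m) ≡
        + c′ ℤ.* κ ℤ.* (g m ℤ.* g (m + d)) ℤ.+ + c ℤ.* κ′ ℤ.* (g m ℤ.* g (m + suc d))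
      inner m = begin
        sumℤ p (term m)
          ≡⟨ cong (λ x → sumℤ x (term m)) c′+c≡p ⟨
        sumℤ (c′ + c) (term m)
          ≡⟨ sumℤ-split c′ c (term m) ⟩
        sumℤ c′ (term m) ℤ.+ sumℤ c (λ a → term m (c′ + a))
          ≡⟨ cong₂ ℤ._+_ (trans (sumℤ-cong c′ (low m)) (sumℤ-const c′ _)) (trans (sumℤ-cong c (high m)) (sumℤ-const c _)) ⟩
        + c′ ℤ.* (κ ℤ.* (g m ℤ.* g (m + d))) ℤ.+ + c ℤ.* (κ′ ℤ.* (g m ℤ.* g (m + suc d)))
          ≡⟨ cong₂ ℤ._+_ (ℤ.*-assoc (+ c′) κ _) (ℤ.*-assoc (+ c) κ′ _) ⟨
        + c′ ℤ.* κ ℤ.* (g m ℤ.* g (m + d)) ℤ.+ + c ℤ.* κ′ ℤ.* (g m ℤ.* g (m + suc d)) ∎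

    -- The carry formulas bound a correlation at `c + p * d` by its values at `d` and `d + 1`, with
    -- coefficients that depend on `c` alone. Summed over both variables such a bound factorises,
    -- which yields a recursion for `mass`.
    sum-digit-bound : ∀ N {F a b f g} → (∀ c d → c < p → F (c + p * d) ≤ a c * f d + b c * g d) →
      sum (p * N) F ≤ sum p a * sum N f + sum p b * sum N g
    sum-digit-bound N {F} {a} {b} {f} {g} bound = begin
      sum (p * N) F
        ≡⟨ sum-digits p N F ⟩
      sum N (λ d → sum p (λ c → F (c + p * d)))
        ≤⟨ sum-mono N (λ d _ → sum-mono p (λ c c<p → bound c d c<p)) ⟩
      sum N (λ d → sum p (λ c → a c * f d + b c * g d))
        ≡⟨ sum-cong N (λ d _ → trans (sum-+ p _ _) (cong₂ _+_ (sum-*ʳ p a (f d)) (sum-*ʳ p b (g d)))) ⟩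
      sum N (λ d → sum p a * f d + sum p b * g d)
        ≡⟨ sum-+ N _ _ ⟩
      sum N (λ d → sum p a * f d) + sum N (λ d → sum p b * g d)
        ≡⟨ cong₂ _+_ (sum-*ˡ N (sum p a) f) (sum-*ˡ N (sum p b) g) ⟩
      sum p a * sum N f + sum p b * sum N g ∎
      where open ≤-Reasoning

  -- Unnormalised: the mean absolute correlation is `mass N g` divided by `N * N`, which is also the
  -- trivial bound for functions with values ±1.
  mass : ℕ → (ℕ → ℤ) → ℕ
  mass N g = sum N (λ d → ∣ correlation N g d ∣)

  mass-suc : ∀ N g → Periodic N g → sum N (λ d → ∣ correlation N g (suc d) ∣) ≡ mass N g
  mass-suc N g periodic =
    sum-shift N (λ d → ∣ correlation N g d ∣) (λ d → cong ∣_∣ (correlation-periodic N g periodic d)) 1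

  unit : ℕ → ℤ
  unit _ = 1ℤ

  sum-id : ∀ n → sum (suc n) (λ c → c) + sum (suc n) (λ c → c) ≡ n * suc n
  sum-id zero    = refl
  sum-id (suc n) = begin
    (S + suc n) + (S + suc n)   ≡⟨ solve 2 (λ S m → (S :+ m) :+ (S :+ m) := (S :+ S) :+ (m :+ m)) refl S (suc n) ⟩
    (S + S) + (suc n + suc n)   ≡⟨ cong (_+ (suc n + suc n)) (sum-id n) ⟩
    n * suc n + (suc n + suc n) ≡⟨ solve 1 (λ n → n :* (con 1 :+ n) :+ ((con 1 :+ n) :+ (con 1 :+ n)) := (con 1 :+ n) :* (con 2 :+ n)) refl n ⟩
    suc n * suc (suc n)         ∎
    where
    open ≡-Reasoning
    open ℕ-Solver
    S = sum (suc n) (λ c → c)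

  -- The value is `(p² + 1) / 2` for `p = 2s + 1`. When `p` grows by 2, the substitution of `c + 1`
  -- for `c` reproduces the old terms, flanked by new outer terms `p + 2` and `p`.
  sum-∣p-2c∣ : ∀ s → sum (suc (s + s)) (λ c → ∣ suc (s + s) ℤ.⊖ (c + c) ∣) ≡ suc (2 * (s * suc s))
  sum-∣p-2c∣ zero    = refl
  sum-∣p-2c∣ (suc s) = begin
    sum (suc (suc s + suc s)) (λ c → ∣ suc (suc s + suc s) ℤ.⊖ (c + c) ∣)
      ≡⟨ cong (λ n → sum n (λ c → ∣ n ℤ.⊖ (c + c) ∣)) (cong (λ n → suc (suc n)) (+-suc s s)) ⟩
    sum (2 + p) (λ c → ∣ (2 + p) ℤ.⊖ (c + c) ∣)
      ≡⟨ sum-suc (suc p) (λ c → ∣ (2 + p) ℤ.⊖ (c + c) ∣) ⟨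
    (2 + p) + sum (suc p) (λ c → ∣ (2 + p) ℤ.⊖ (suc c + suc c) ∣)
      ≡⟨ cong (λ x → (2 + p) + x) (sum-cong (suc p) λ c _ → cong ∣_∣ (lower-both c)) ⟩
    (2 + p) + (sum p (λ c → ∣ p ℤ.⊖ (c + c) ∣) + ∣ p ℤ.⊖ (p + p) ∣)
      ≡⟨ cong₂ (λ x y → (2 + p) + (x + y)) (sum-∣p-2c∣ s) last ⟩
    (2 + p) + (suc (2 * (s * suc s)) + p)
      ≡⟨ solve 1 (λ s → (con 3 :+ (s :+ s)) :+ ((con 1 :+ con 2 :* (s :* (con 1 :+ s))) :+ (con 1 :+ (s :+ s)))
          := con 1 :+ con 2 :* ((con 1 :+ s) :* (con 2 :+ s))) refl s ⟩
    suc (2 * (suc s * suc (suc s))) ∎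
    where
    open ≡-Reasoning
    open ℕ-Solver
    p = suc (s + s)
    lower-both : ∀ c → (2 + p) ℤ.⊖ (suc c + suc c) ≡ p ℤ.⊖ (c + c)
    lower-both c = trans (cong ((2 + p) ℤ.⊖_) (cong suc (+-suc c c)))
      (trans (ℤ.[1+m]⊖[1+n]≡m⊖n (suc p) (suc (c + c))) (ℤ.[1+m]⊖[1+n]≡m⊖n p (c + c)))
    last : ∣ p ℤ.⊖ (p + p) ∣ ≡ p
    last = trans (ℤ.∣m⊖n∣≡∣n⊖m∣ p (p + p)) (trans (cong ∣_∣ (ℤ.⊖-≥ (m≤m+n p p))) (m+n∸m≡n p p))

  module OddDigits (t : ℕ) where

    p : ℕ
    p = suc (suc t + suc t)

    open Digits p public

    sgn-p : sgn p ≡ -1ℤ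
    sgn-p = cong ℤ.-_ (sgn-double (suc t))

    sgn-odd-* : ∀ m → sgn (p * m) ≡ sgn m
    sgn-odd-* m = begin
      sgn (m + (suc t + suc t) * m)         ≡⟨ sgn-+ m _ ⟩
      sgn m ℤ.* sgn ((suc t + suc t) * m)   ≡⟨ cong (λ x → sgn m ℤ.* sgn x) (*-distribʳ-+ m (suc t) (suc t)) ⟩
      sgn m ℤ.* sgn (suc t * m + suc t * m) ≡⟨ cong (sgn m ℤ.*_) (sgn-double (suc t * m)) ⟩
      sgn m ℤ.* 1ℤ                          ≡⟨ ℤ.*-identityʳ (sgn m) ⟩
      sgn m                                 ∎
      where open ≡-Reasoning

    -- As `p` is odd, `c` and `c′` have opposite parity: a carry subtracts an odd number from the
    -- digit and so flips its sign. This is the source of the minus sign between the two terms.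
    correlation-sgn : ∀ g N c′ c d → c′ + c ≡ p →
      correlation (p * N) (lift sgn g) (c + p * d) ≡
        sgn c ℤ.* (+ c′ ℤ.* correlation N g d ℤ.- + c ℤ.* correlation N g (suc d))
    correlation-sgn g N c′ c d c′+c≡p = trans
      (correlation-lift sgn g N c′ c d c′+c≡p uncarried carried)
      (solve 5 (λ x y σ γ δ → x :* σ :* γ :+ y :* (:- σ) :* δ := σ :* (x :* γ :- y :* δ)) refl
        (+ c′) (+ c) (sgn c) (correlation N g d) (correlation N g (suc d)))
      where
      open ℤ-Solver
      uncarried : ∀ a → sgn a ℤ.* sgn (a + c) ≡ sgn c
      uncarried a = trans (cong (sgn a ℤ.*_) (sgn-+ a c))
        (trans (sym (ℤ.*-assoc (sgn a) (sgn a) (sgn c)))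
          (trans (cong (ℤ._* sgn c) (sgn-square a)) (ℤ.*-identityˡ (sgn c))))
      opposite : sgn c′ ≡ ℤ.- sgn c
      opposite = begin
        sgn c′                      ≡⟨ ℤ.*-identityʳ (sgn c′) ⟨
        sgn c′ ℤ.* 1ℤ               ≡⟨ cong (sgn c′ ℤ.*_) (sgn-square c) ⟨
        sgn c′ ℤ.* (sgn c ℤ.* sgn c) ≡⟨ ℤ.*-assoc (sgn c′) (sgn c) (sgn c) ⟨
        sgn c′ ℤ.* sgn c ℤ.* sgn c  ≡⟨ cong (ℤ._* sgn c) (trans (sym (sgn-+ c′ c)) (trans (cong sgn c′+c≡p) sgn-p)) ⟩
        -1ℤ ℤ.* sgn c               ≡⟨ ℤ.-1*i≡-i (sgn c) ⟩
        ℤ.- sgn c                   ∎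
        where open ≡-Reasoning
      carried : ∀ a → sgn (c′ + a) ℤ.* sgn a ≡ ℤ.- sgn c
      carried a = trans (cong (ℤ._* sgn a) (sgn-+ c′ a))
        (trans (ℤ.*-assoc (sgn c′) (sgn a) (sgn a))
          (trans (cong (sgn c′ ℤ.*_) (sgn-square a)) (trans (ℤ.*-identityʳ (sgn c′)) opposite)))

    -- Here a carry flips nothing, so neighbouring correlations are averaged with nonnegative
    -- weights; values that nearly cancel are then lost.
    correlation-unit : ∀ g N c′ c d → c′ + c ≡ p →
      correlation (p * N) (lift unit g) (c + p * d) ≡
        + c′ ℤ.* correlation N g d ℤ.+ + c ℤ.* correlation N g (suc d)
    correlation-unit g N c′ c d c′+c≡p = trans
      (correlation-lift unit g N c′ c d c′+c≡p (λ _ → refl) (λ _ → refl))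
      (cong₂ (λ x y → x ℤ.* correlation N g d ℤ.+ y ℤ.* correlation N g (suc d))
        (ℤ.*-identityʳ (+ c′)) (ℤ.*-identityʳ (+ c)))

    -- Consecutive values nearly cancel, for the last digit c = p − 1 as well as for the others.
    correlation-sgn-consecutive : ∀ g N c d → c < p →
      correlation (p * N) (lift sgn g) (c + p * d) ℤ.+ correlation (p * N) (lift sgn g) (suc c + p * d) ≡
        sgn c ℤ.* (correlation N g d ℤ.+ correlation N g (suc d))
    correlation-sgn-consecutive g N c d c<p = trans
      (cong₂ ℤ._+_ (correlation-sgn g N (suc c′) c d (trans (sym (+-suc c′ c)) c′+1+c≡p))
                   (correlation-sgn g N c′ (suc c) d c′+1+c≡p))
      (solve 5 (λ x y σ γ δ → σ :* ((con 1ℤ :+ x) :* γ :- y :* δ) :+ (:- σ) :* (x :* γ :- (con 1ℤ :+ y) :* δ)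
          := σ :* (γ :+ δ)) refl
        (+ c′) (+ c) (sgn c) (correlation N g d) (correlation N g (suc d)))
      where
      open ℤ-Solver
      c′ = p ∸ suc c
      c′+1+c≡p : c′ + suc c ≡ p
      c′+1+c≡p = m∸n+n≡m c<p

    -- The weights `p - c` and `c` of the two neighbours add up to `p` for each of the `p` digits.
    -- This is the trivial growth by `p²`; the saving only appears together with the digit below.
    mass-sgn : ∀ N g → Periodic N g → mass (p * N) (lift sgn g) ≤ p * (p * mass N g)
    mass-sgn N g periodic = begin
      mass (p * N) (lift sgn g)
        ≤⟨ sum-digit-bound N bound ⟩
      sum p (λ c → p ∸ c) * mass N g + sum p (λ c → c) * sum N (λ d → ∣ correlation N g (suc d) ∣)
        ≡⟨ cong (λ x → sum p (λ c → p ∸ c) * mass N g + sum p (λ c → c) * x) (mass-suc N g periodic) ⟩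
      sum p (λ c → p ∸ c) * mass N g + sum p (λ c → c) * mass N g
        ≡⟨ *-distribʳ-+ (mass N g) (sum p (λ c → p ∸ c)) (sum p (λ c → c)) ⟨
      (sum p (λ c → p ∸ c) + sum p (λ c → c)) * mass N g
        ≡⟨ cong (_* mass N g) (trans (sym (sum-+ p _ _)) (trans (sum-cong p λ c c<p → m∸n+n≡m (<⇒≤ c<p)) (sum-const p p))) ⟩
      p * p * mass N g
        ≡⟨ *-assoc p p (mass N g) ⟩
      p * (p * mass N g) ∎
      where
      open ≤-Reasoning
      bound : ∀ c d → c < p → ∣ correlation (p * N) (lift sgn g) (c + p * d) ∣ ≤
        (p ∸ c) * ∣ correlation N g d ∣ + c * ∣ correlation N g (suc d) ∣
      bound c d c<p = begin
        ∣ correlation (p * N) (lift sgn g) (c + p * d) ∣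
          ≡⟨ cong ∣_∣ (correlation-sgn g N (p ∸ c) c d (m∸n+n≡m (<⇒≤ c<p))) ⟩
        ∣ sgn c ℤ.* (x ℤ.- y) ∣
          ≡⟨ trans (ℤ.abs-* (sgn c) (x ℤ.- y)) (trans (cong (_* ∣ x ℤ.- y ∣) (∣sgn∣ c)) (*-identityˡ _)) ⟩
        ∣ x ℤ.- y ∣
          ≤⟨ ℤ.∣i-j∣≤∣i∣+∣j∣ x y ⟩
        ∣ x ∣ + ∣ y ∣
          ≡⟨ cong₂ _+_ (ℤ.abs-* (+ (p ∸ c)) (correlation N g d)) (ℤ.abs-* (+ c) (correlation N g (suc d))) ⟩
        (p ∸ c) * ∣ correlation N g d ∣ + c * ∣ correlation N g (suc d) ∣ ∎
        where
        x = + (p ∸ c) ℤ.* correlation N g d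
        y = + c ℤ.* correlation N g (suc d)

    -- After the alternation of signs the coefficients of neighbouring shifts differ by one, so `2p`
    -- replaces the `2p²` that `mass-sgn` gives for the two summands separately.
    mass-sgn-consecutive : ∀ N g → Periodic N g →
      sum (p * N) (λ d → ∣ correlation (p * N) (lift sgn g) d ℤ.+ correlation (p * N) (lift sgn g) (suc d) ∣) ≤
        p * mass N g + p * mass N g
    mass-sgn-consecutive N g periodic = begin
      sum (p * N) (λ d → ∣ γ d ℤ.+ γ (suc d) ∣)
        ≤⟨ sum-digit-bound N bound ⟩
      sum p (λ _ → 1) * mass N g + sum p (λ _ → 1) * sum N (λ d → ∣ correlation N g (suc d) ∣)
        ≡⟨ cong₂ (λ x y → x * mass N g + x * y) (trans (sum-const p 1) (*-identityʳ p)) (mass-suc N g periodic) ⟩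
      p * mass N g + p * mass N g ∎
      where
      open ≤-Reasoning
      γ = correlation (p * N) (lift sgn g)
      bound : ∀ c d → c < p → ∣ γ (c + p * d) ℤ.+ γ (suc c + p * d) ∣ ≤
        1 * ∣ correlation N g d ∣ + 1 * ∣ correlation N g (suc d) ∣
      bound c d c<p = begin
        ∣ γ (c + p * d) ℤ.+ γ (suc c + p * d) ∣
          ≡⟨ cong ∣_∣ (correlation-sgn-consecutive g N c d c<p) ⟩
        ∣ sgn c ℤ.* (x ℤ.+ y) ∣
          ≡⟨ trans (ℤ.abs-* (sgn c) (x ℤ.+ y)) (trans (cong (_* ∣ x ℤ.+ y ∣) (∣sgn∣ c)) (*-identityˡ _)) ⟩
        ∣ x ℤ.+ y ∣
          ≤⟨ ℤ.∣i+j∣≤∣i∣+∣j∣ x y ⟩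
        ∣ x ∣ + ∣ y ∣
          ≡⟨ cong₂ _+_ (*-identityˡ ∣ x ∣) (*-identityˡ ∣ y ∣) ⟨
        1 * ∣ x ∣ + 1 * ∣ y ∣ ∎
        where
        x = correlation N g d
        y = correlation N g (suc d)

    -- |(p − c) u + c v| ≤ c |u + v| + |p − 2c| |u|, where |p − 2c| is about p / 2 on average.
    mass-unit : ∀ M g → mass (p * M) (lift unit g) ≤
      sum p (λ c → c) * sum M (λ d → ∣ correlation M g d ℤ.+ correlation M g (suc d) ∣)
        + sum p (λ c → ∣ p ℤ.⊖ (c + c) ∣) * mass M g
    mass-unit M g = sum-digit-bound M bound
      where
      open ≤-Reasoning
      γ = correlation M g
      bound : ∀ c d → c < p → ∣ correlation (p * M) (lift unit g) (c + p * d) ∣ ≤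
        c * ∣ γ d ℤ.+ γ (suc d) ∣ + ∣ p ℤ.⊖ (c + c) ∣ * ∣ γ d ∣
      bound c d c<p = begin
        ∣ correlation (p * M) (lift unit g) (c + p * d) ∣
          ≡⟨ cong ∣_∣ (correlation-unit g M (p ∸ c) c d (m∸n+n≡m (<⇒≤ c<p))) ⟩
        ∣ + (p ∸ c) ℤ.* γ d ℤ.+ + c ℤ.* γ (suc d) ∣
          ≡⟨ cong ∣_∣ regroup ⟩
        ∣ + c ℤ.* (γ d ℤ.+ γ (suc d)) ℤ.+ (p ℤ.⊖ (c + c)) ℤ.* γ d ∣
          ≤⟨ ℤ.∣i+j∣≤∣i∣+∣j∣ (+ c ℤ.* (γ d ℤ.+ γ (suc d))) ((p ℤ.⊖ (c + c)) ℤ.* γ d) ⟩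
        ∣ + c ℤ.* (γ d ℤ.+ γ (suc d)) ∣ + ∣ (p ℤ.⊖ (c + c)) ℤ.* γ d ∣
          ≡⟨ cong₂ _+_ (ℤ.abs-* (+ c) (γ d ℤ.+ γ (suc d))) (ℤ.abs-* (p ℤ.⊖ (c + c)) (γ d)) ⟩
        c * ∣ γ d ℤ.+ γ (suc d) ∣ + ∣ p ℤ.⊖ (c + c) ∣ * ∣ γ d ∣ ∎
        where
        regroup : + (p ∸ c) ℤ.* γ d ℤ.+ + c ℤ.* γ (suc d) ≡
                  + c ℤ.* (γ d ℤ.+ γ (suc d)) ℤ.+ (p ℤ.⊖ (c + c)) ℤ.* γ d
        regroup = trans
          (cong (λ x → x ℤ.* γ d ℤ.+ + c ℤ.* γ (suc d)) (trans (sym (ℤ.⊖-≥ (<⇒≤ c<p))) (sym (ℤ.m-n≡m⊖n p c))))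
          (trans
            (solve 4 (λ p c γ δ → (p :- c) :* γ :+ c :* δ := c :* (γ :+ δ) :+ (p :- (c :+ c)) :* γ) refl
              (+ p) (+ c) (γ d) (γ (suc d)))
            (cong (λ x → + c ℤ.* (γ d ℤ.+ γ (suc d)) ℤ.+ x ℤ.* γ d)
              (trans (cong (λ x → + p ℤ.- x) (sym (ℤ.pos-+ c c))) (ℤ.m-n≡m⊖n p (c + c)))))
          where open ℤ-Solver

    -- The two preceding bounds give growth by at most `p²(p² + 2p - 1)/2`, against `p⁴` without
    -- cancellation. The ratio decreases in `p` and equals 7/9 at `p = 3`, so one constant serves
    -- all odd `p`.
    mass-contraction : ∀ N g → Periodic N g →
      9 * mass (p * (p * N)) (lift unit (lift sgn g)) ≤ 7 * (p * (p * (p * (p * mass N g))))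
    mass-contraction N g periodic = begin
      9 * mass (p * (p * N)) (lift unit (lift sgn g))
        ≤⟨ *-monoʳ-≤ 9 (≤-trans (mass-unit (p * N) (lift sgn g))
            (+-mono-≤ (*-monoʳ-≤ (sum p (λ c → c)) (mass-sgn-consecutive N g periodic))
                      (*-monoʳ-≤ (sum p (λ c → ∣ p ℤ.⊖ (c + c) ∣)) (mass-sgn N g periodic)))) ⟩
      9 * (S * (p * L + p * L) + sum p (λ c → ∣ p ℤ.⊖ (c + c) ∣) * (p * (p * L)))
        ≡⟨ cong (λ x → 9 * (S * (p * L + p * L) + x * (p * (p * L)))) (sum-∣p-2c∣ (suc t)) ⟩
      9 * (S * (p * L + p * L) + D * (p * (p * L)))
        ≡⟨ cong (9 *_) (solve 4 (λ S D P L → S :* (P :* L :+ P :* L) :+ D :* (P :* (P :* L)) :=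
             ((S :+ S) :* P :+ D :* (P :* P)) :* L) refl S D p L) ⟩
      9 * (((S + S) * p + D * (p * p)) * L)
        ≡⟨ cong (λ x → 9 * ((x * p + D * (p * p)) * L)) (sum-id (suc t + suc t)) ⟩
      9 * (((suc t + suc t) * p * p + D * (p * p)) * L)
        -- With `p = 2t + 3` the slack is `7p² - 9(p² + 2p - 1)/2 = 10t² + 12t`, which vanishes
        -- exactly for `p = 3`.
        ≤⟨ m≤m+n _ ((10 * (t * t) + 12 * t) * (p * p * L)) ⟩
      9 * (((suc t + suc t) * p * p + D * (p * p)) * L) + (10 * (t * t) + 12 * t) * (p * p * L)
        ≡⟨ solve 2 (λ t L → let s = con 1 :+ t; P = con 1 :+ (s :+ s); D = con 1 :+ con 2 :* (s :* (con 1 :+ s)) in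
             con 9 :* (((s :+ s) :* P :* P :+ D :* (P :* P)) :* L) :+ (con 10 :* (t :* t) :+ con 12 :* t) :* (P :* P :* L)
             := con 7 :* (P :* (P :* (P :* (P :* L))))) refl t L ⟩
      7 * (p * (p * (p * (p * L)))) ∎
      where
      open ≤-Reasoning
      open ℕ-Solver
      L = mass N g
      S = sum p (λ c → c)
      D = suc (2 * (suc t * suc (suc t)))

    Q : ℕ → ℕ
    Q zero    = 1
    Q (suc T) = p * (p * Q T)

    χ : ℕ → ℕ → ℤ
    χ zero    = unit
    χ (suc T) = lift unit (lift sgn (χ T))

    χ-periodic : ∀ T → Periodic (Q T) (χ T)
    χ-periodic zero    n = refl
    χ-periodic (suc T)   = lift-periodic unit (p * Q T) (lift sgn (χ T)) (lift-periodic sgn (Q T) (χ T) (χ-periodic T))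

    mass-χ : ∀ T → 9 ^ T * mass (Q T) (χ T) ≤ 7 ^ T * (Q T * Q T)
    mass-χ zero    = ≤-refl
    mass-χ (suc T) = begin
      9 ^ suc T * mass (Q (suc T)) (χ (suc T))
        ≡⟨ solve 2 (λ x y → con 9 :* x :* y := x :* (con 9 :* y)) refl (9 ^ T) _ ⟩
      9 ^ T * (9 * mass (Q (suc T)) (χ (suc T)))
        ≤⟨ *-monoʳ-≤ (9 ^ T) (mass-contraction (Q T) (χ T) (χ-periodic T)) ⟩
      9 ^ T * (7 * (p * (p * (p * (p * mass (Q T) (χ T))))))
        ≡⟨ solve 3 (λ x P y → x :* (con 7 :* (P :* (P :* (P :* (P :* y))))) := con 7 :* (P :* (P :* (P :* P))) :* (x :* y)) refl
            (9 ^ T) p (mass (Q T) (χ T)) ⟩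
      7 * (p * (p * (p * p))) * (9 ^ T * mass (Q T) (χ T))
        ≤⟨ *-monoʳ-≤ (7 * (p * (p * (p * p)))) (mass-χ T) ⟩
      7 * (p * (p * (p * p))) * (7 ^ T * (Q T * Q T))
        ≡⟨ solve 3 (λ x P q → con 7 :* (P :* (P :* (P :* P))) :* (x :* (q :* q)) :=
            con 7 :* x :* ((P :* (P :* q)) :* (P :* (P :* q)))) refl (7 ^ T) p (Q T) ⟩
      7 ^ suc T * (Q (suc T) * Q (suc T)) ∎
      where
      open ≤-Reasoning
      open ℕ-Solver

  -- Selection of residues

  IsSign : ℤ → Set
  IsSign x = x ≡ 1ℤ ⊎ x ≡ -1ℤ

  i*i≡+∣i∣*∣i∣ : ∀ i → i ℤ.* i ≡ + (∣ i ∣ * ∣ i ∣)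
  i*i≡+∣i∣*∣i∣ (+ n)       = sym (ℤ.pos-* n n)
  i*i≡+∣i∣*∣i∣ ℤ.-[1+ n ] = refl

  pos-sum : ∀ n f → + sum n f ≡ sumℤ n (λ i → + f i)
  pos-sum zero    f = refl
  pos-sum (suc n) f = trans (ℤ.pos-+ (sum n f) (f n)) (cong (ℤ._+ + f n) (pos-sum n f))

  sumℤ-*ʳ : ∀ n f c → sumℤ n (λ i → f i ℤ.* c) ≡ sumℤ n f ℤ.* c
  sumℤ-*ʳ n f c = trans (sumℤ-cong n λ i _ → ℤ.*-comm (f i) c) (trans (sumℤ-*ˡ n c f) (ℤ.*-comm c (sumℤ n f)))

  some-below-average : ∀ n f C → sum n f < n * C → ∃[ i ] i < n × f i < C
  some-below-average (suc n) f C sum< with f n <? C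
  ... | yes fn<C = n , ≤-refl , fn<C
  ... | no  fn≮C with some-below-average n f C
                        (+-cancelʳ-< (f n) (sum n f) (n * C)
                          (<-≤-trans sum< (subst (_≤ n * C + f n) (+-comm (n * C) C) (+-monoʳ-≤ (n * C) (≮⇒≥ fn≮C)))))
  ...   | i , i<n , fi<C = i , m<n⇒m<1+n i<n , fi<C

  some-positive : ∀ n f → 0 < sum n f → ∃[ i ] i < n × 0 < f i
  some-positive (suc n) f 0<sum with f n in eq
  ... | suc _ = n , ≤-refl , subst (0 <_) (sym eq) z<s
  ... | zero with some-positive n f (subst (0 <_) (+-identityʳ (sum n f)) 0<sum)
  ...   | i , i<n , 0<fi = i , m<n⇒m<1+n i<n , 0<fi

  pair-correlation : ℕ → (ℕ → ℤ) → ℕ → ℕ → ℤ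
  pair-correlation N f h h′ = sumℤ N (λ r → f (r + h) ℤ.* f (r + h′))

  -- Over a full period the starting point is immaterial, so only `h′ - h` modulo `N` matters;
  -- `N ∸ h + h′` represents it without negative numbers.
  pair-correlation≡correlation : ∀ N f → Periodic N f → ∀ {h} h′ → h ≤ N →
    pair-correlation N f h h′ ≡ correlation N f (N ∸ h + h′)
  pair-correlation≡correlation N f periodic {h} h′ h≤N = begin
    sumℤ N (λ r → f (r + h) ℤ.* f (r + h′))
      ≡⟨ sumℤ-cong N (λ r _ → cong₂ ℤ._*_ (cong f (+-comm r h)) (trans (sym (periodic (r + h′))) (cong f (regroup r)))) ⟩
    sumℤ N (λ r → F (h + r))
      ≡⟨ sumℤ-shift N F F-periodic h ⟩
    sumℤ N F ∎
    where
    open ≡-Reasoning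
    open ℕ-Solver
    d = N ∸ h + h′
    F : ℕ → ℤ
    F r = f r ℤ.* f (r + d)
    F-periodic : ∀ r → F (N + r) ≡ F r
    F-periodic r = cong₂ ℤ._*_ (periodic r) (trans (cong f (+-assoc N r d)) (periodic (r + d)))
    regroup : ∀ r → N + (r + h′) ≡ h + r + d
    regroup r = trans (cong (_+ (r + h′)) (sym (m+[n∸m]≡n h≤N)))
      (solve 4 (λ h k r h′ → (h :+ k) :+ (r :+ h′) := h :+ r :+ (k :+ h′)) refl h (N ∸ h) r h′)

  -- The window is no longer than a period, so for fixed `h` the differences `h′ - h` are distinct
  -- modulo `N`, and one row of pair correlations is a part of the full sum `mass`.
  pair-mass : ∀ H N f → Periodic N f → H ≤ N → ∀ h → h < H →
    sum H (λ h′ → ∣ pair-correlation N f h h′ ∣) ≤ mass N f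
  pair-mass H N f periodic H≤N h h<H = begin
    sum H (λ h′ → ∣ pair-correlation N f h h′ ∣)
      ≤⟨ sum-prefix (λ h′ → ∣ pair-correlation N f h h′ ∣) H≤N ⟩
    sum N (λ h′ → ∣ pair-correlation N f h h′ ∣)
      ≡⟨ sum-cong N (λ h′ _ → cong ∣_∣ (pair-correlation≡correlation N f periodic h′ (≤-trans (<⇒≤ h<H) H≤N))) ⟩
    sum N (λ h′ → ∣ correlation N f (N ∸ h + h′) ∣)
      ≡⟨ sum-shift N (λ d → ∣ correlation N f d ∣) (λ d → cong ∣_∣ (correlation-periodic N f periodic d)) (N ∸ h) ⟩
    mass N f ∎
    where open ≤-Reasoning

  module Selection (H E : ℕ) where

    -- For `f` with values ±1 this is the weight of the shifts with sign 1 minus the weight of those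
    -- with sign -1: it measures how unevenly `r` splits the class `w`.
    response : (ℕ → ℤ) → (ℕ → ℕ) → ℕ → ℤ
    response f w r = sumℤ H (λ h → + w h ℤ.* f (r + h))

    sum-response² : ∀ N f w → + sum N (λ r → ∣ response f w r ∣ * ∣ response f w r ∣) ≡
      sumℤ H (λ h → sumℤ H (λ h′ → (+ w h ℤ.* + w h′) ℤ.* pair-correlation N f h h′))
    sum-response² N f w = begin
      + sum N (λ r → ∣ Y r ∣ * ∣ Y r ∣)
        ≡⟨ pos-sum N _ ⟩
      sumℤ N (λ r → + (∣ Y r ∣ * ∣ Y r ∣))
        ≡⟨ sumℤ-cong N (λ r _ → trans (sym (i*i≡+∣i∣*∣i∣ (Y r))) (product-sum r)) ⟩
      sumℤ N (λ r → sumℤ H (λ h → sumℤ H (λ h′ → a r h ℤ.* a r h′)))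
        ≡⟨ sumℤ-swap N H (λ r h → sumℤ H (λ h′ → a r h ℤ.* a r h′)) ⟩
      sumℤ H (λ h → sumℤ N (λ r → sumℤ H (λ h′ → a r h ℤ.* a r h′)))
        ≡⟨ sumℤ-cong H (λ h _ → sumℤ-swap N H (λ r h′ → a r h ℤ.* a r h′)) ⟩
      sumℤ H (λ h → sumℤ H (λ h′ → sumℤ N (λ r → a r h ℤ.* a r h′)))
        ≡⟨ sumℤ-cong H (λ h _ → sumℤ-cong H λ h′ _ →
             trans (sumℤ-cong N λ r _ → rearrange r h h′) (sumℤ-*ˡ N (+ w h ℤ.* + w h′) _)) ⟩
      sumℤ H (λ h → sumℤ H (λ h′ → (+ w h ℤ.* + w h′) ℤ.* G h h′)) ∎
      where
      open ≡-Reasoning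
      open ℤ-Solver
      Y = response f w
      G = pair-correlation N f
      a : ℕ → ℕ → ℤ
      a r h = + w h ℤ.* f (r + h)
      product-sum : ∀ r → Y r ℤ.* Y r ≡ sumℤ H (λ h → sumℤ H (λ h′ → a r h ℤ.* a r h′))
      product-sum r = trans (sym (sumℤ-*ʳ H (a r) (Y r))) (sumℤ-cong H λ h _ → sym (sumℤ-*ˡ H (a r h) (a r)))
      rearrange : ∀ r h h′ → a r h ℤ.* a r h′ ≡ (+ w h ℤ.* + w h′) ℤ.* (f (r + h) ℤ.* f (r + h′))
      rearrange r h h′ = solve 4 (λ w x v y → (w :* x) :* (v :* y)
        := (w :* v) :* (x :* y)) refl (+ w h) (f (r + h)) (+ w h′) (f (r + h′))

    -- Second moment over all residues: expanding the square and summing over `r` first leaves pair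
    -- correlations, and each of the `H` rows costs one `mass`.
    response-energy : ∀ N f → Periodic N f → H ≤ N → ∀ w B → (∀ h → w h ≤ B) →
      sum N (λ r → ∣ response f w r ∣ * ∣ response f w r ∣) ≤ B * B * (H * mass N f)
    response-energy N f periodic H≤N w B w≤B = begin
      sum N (λ r → ∣ Y r ∣ * ∣ Y r ∣)
        ≡⟨ cong ∣_∣ (sum-response² N f w) ⟩
      ∣ sumℤ H (λ h → sumℤ H (λ h′ → (+ w h ℤ.* + w h′) ℤ.* G h h′)) ∣
        ≤⟨ ≤-trans (∣sumℤ∣≤ H _) (sum-mono H λ h _ → ∣sumℤ∣≤ H _) ⟩
      sum H (λ h → sum H (λ h′ → ∣ (+ w h ℤ.* + w h′) ℤ.* G h h′ ∣))
        ≤⟨ sum-mono H (λ h _ → sum-mono H λ h′ _ → bound h h′) ⟩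
      sum H (λ h → sum H (λ h′ → B * B * ∣ G h h′ ∣))
        ≡⟨ sum-cong H (λ h _ → sum-*ˡ H (B * B) _) ⟩
      sum H (λ h → B * B * sum H (λ h′ → ∣ G h h′ ∣))
        ≤⟨ sum-mono H (λ h h<H → *-monoʳ-≤ (B * B) (pair-mass H N f periodic H≤N h h<H)) ⟩
      sum H (λ _ → B * B * mass N f)
        ≡⟨ sum-const H _ ⟩
      H * (B * B * mass N f)
        ≡⟨ solve 3 (λ h b m → h :* (b :* m) := b :* (h :* m)) refl H (B * B) (mass N f) ⟩
      B * B * (H * mass N f) ∎
      where
      open ≤-Reasoning
      open ℕ-Solver
      Y = response f w
      G = pair-correlation N f
      bound : ∀ h h′ → ∣ (+ w h ℤ.* + w h′) ℤ.* G h h′ ∣ ≤ B * B * ∣ G h h′ ∣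
      bound h h′ = begin
        ∣ (+ w h ℤ.* + w h′) ℤ.* G h h′ ∣ ≡⟨ ℤ.abs-* (+ w h ℤ.* + w h′) (G h h′) ⟩
        ∣ + w h ℤ.* + w h′ ∣ * ∣ G h h′ ∣ ≡⟨ cong (_* ∣ G h h′ ∣) (ℤ.abs-* (+ w h) (+ w h′)) ⟩
        w h * w h′ * ∣ G h h′ ∣           ≤⟨ *-monoˡ-≤ ∣ G h h′ ∣ (*-mono-≤ (w≤B h) (w≤B h′)) ⟩
        B * B * ∣ G h h′ ∣                ∎

    -- One residue has to split all classes evenly at the same time. Hence the sum over all weights:
    -- a value below `E * E` forces every single response to be at most `E`.
    energy : (ℕ → ℤ) → List (ℕ → ℕ) → ℕ → ℕ
    energy f []       r = 0
    energy f (w ∷ ws) r = ∣ response f w r ∣ * ∣ response f w r ∣ + energy f ws r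

    energy-sum : ∀ N f → Periodic N f → H ≤ N → ∀ B ws → All (λ w → ∀ h → w h ≤ B) ws →
      sum N (energy f ws) ≤ length ws * (B * B * (H * mass N f))
    energy-sum N f periodic H≤N B []       []           = ≤-reflexive (trans (sum-const N 0) (*-zeroʳ N))
    energy-sum N f periodic H≤N B (w ∷ ws) (w≤B ∷ ws≤B) = ≤-trans (≤-reflexive (sum-+ N _ (energy f ws)))
      (+-mono-≤ (response-energy N f periodic H≤N w B w≤B) (energy-sum N f periodic H≤N B ws ws≤B))

    small-responses : ∀ f r ws → energy f ws r < E * E → All (λ w → ∣ response f w r ∣ ≤ E) ws
    small-responses f r []       _       = []
    small-responses f r (w ∷ ws) energy< =
      ≮⇒≥ (λ E<Y → <⇒≱ (≤-<-trans (m≤m+n _ _) energy<) (*-mono-≤ (<⇒≤ E<Y) (<⇒≤ E<Y)))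
      ∷ small-responses f r ws (≤-<-trans (m≤n+m _ (∣ response f w r ∣ * ∣ response f w r ∣)) energy<)

    -- The factor is 0 or 2 for signs, rather than an indicator with values 0 and 1, so that a
    -- refined class keeps its total weight up to one response. The loss per prime is then additive.
    -- The absolute value only moves a nonnegative integer into ℕ.
    refine : (ℕ → ℤ) → ℕ → ℤ → (ℕ → ℕ) → ℕ → ℕ
    refine f r τ w h = w h * ∣ 1ℤ ℤ.+ τ ℤ.* f (r + h) ∣

    ∣1+στ∣ : ∀ {σ τ} → IsSign σ → IsSign τ → + ∣ 1ℤ ℤ.+ τ ℤ.* σ ∣ ≡ 1ℤ ℤ.+ τ ℤ.* σ
    ∣1+στ∣ (inj₁ refl) (inj₁ refl) = refl
    ∣1+στ∣ (inj₁ refl) (inj₂ refl) = refl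
    ∣1+στ∣ (inj₂ refl) (inj₁ refl) = refl
    ∣1+στ∣ (inj₂ refl) (inj₂ refl) = refl

    ∣1+στ∣≤2 : ∀ {σ τ} → IsSign σ → IsSign τ → ∣ 1ℤ ℤ.+ τ ℤ.* σ ∣ ≤ 2
    ∣1+στ∣≤2 (inj₁ refl) (inj₁ refl) = ≤-refl
    ∣1+στ∣≤2 (inj₁ refl) (inj₂ refl) = z≤n
    ∣1+στ∣≤2 (inj₂ refl) (inj₁ refl) = z≤n
    ∣1+στ∣≤2 (inj₂ refl) (inj₂ refl) = ≤-refl

    0<∣1+στ∣⇒σ≡τ : ∀ {σ τ} → IsSign σ → IsSign τ → 0 < ∣ 1ℤ ℤ.+ τ ℤ.* σ ∣ → σ ≡ τ
    0<∣1+στ∣⇒σ≡τ (inj₁ refl) (inj₁ refl) _ = refl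
    0<∣1+στ∣⇒σ≡τ (inj₂ refl) (inj₂ refl) _ = refl
    0<∣1+στ∣⇒σ≡τ (inj₁ refl) (inj₂ refl) ()
    0<∣1+στ∣⇒σ≡τ (inj₂ refl) (inj₁ refl) ()

    pos-sum-refine : ∀ f → (∀ n → IsSign (f n)) → ∀ r {τ} → IsSign τ → ∀ w →
      + sum H (refine f r τ w) ≡ + sum H w ℤ.+ τ ℤ.* response f w r
    pos-sum-refine f f-sign r {τ} τ-sign w = begin
      + sum H (refine f r τ w)
        ≡⟨ pos-sum H _ ⟩
      sumℤ H (λ h → + (w h * ∣ 1ℤ ℤ.+ τ ℤ.* f (r + h) ∣))
        ≡⟨ sumℤ-cong H (λ h _ → trans (ℤ.pos-* (w h) _) (trans
             (cong (+ w h ℤ.*_) (∣1+στ∣ (f-sign (r + h)) τ-sign))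
             (solve 3 (λ w τ f → w :* (con 1ℤ :+ τ :* f)
               := w :+ τ :* (w :* f)) refl (+ w h) τ (f (r + h))))) ⟩
      sumℤ H (λ h → + w h ℤ.+ τ ℤ.* (+ w h ℤ.* f (r + h)))
        ≡⟨ sumℤ-+ H _ _ ⟩
      sumℤ H (λ h → + w h) ℤ.+ sumℤ H (λ h → τ ℤ.* (+ w h ℤ.* f (r + h)))
        ≡⟨ cong₂ ℤ._+_ (sym (pos-sum H w)) (sumℤ-*ˡ H τ _) ⟩
      + sum H w ℤ.+ τ ℤ.* response f w r ∎
      where
      open ≡-Reasoning
      open ℤ-Solver

    sum-refine : ∀ f → (∀ n → IsSign (f n)) → ∀ r {τ} → IsSign τ → ∀ w → ∣ response f w r ∣ ≤ E →
      sum H w ≤ sum H (refine f r τ w) + E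
    sum-refine f f-sign r {τ} τ-sign w Y≤E = begin
      sum H w
        ≡⟨ cong ∣_∣ (trans
             (solve 2 (λ x y → x := (x :+ y) :- y) refl (+ sum H w) (τ ℤ.* Y))
             (cong (ℤ._- τ ℤ.* Y) (sym (pos-sum-refine f f-sign r τ-sign w)))) ⟩
      ∣ + sum H (refine f r τ w) ℤ.- τ ℤ.* Y ∣
        ≤⟨ ℤ.∣i-j∣≤∣i∣+∣j∣ (+ sum H (refine f r τ w)) (τ ℤ.* Y) ⟩
      sum H (refine f r τ w) + ∣ τ ℤ.* Y ∣
        ≡⟨ cong (λ x → sum H (refine f r τ w) + x)
             (trans (ℤ.abs-* τ Y) (trans (cong (_* ∣ Y ∣) (∣τ∣ τ-sign)) (*-identityˡ ∣ Y ∣))) ⟩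
      sum H (refine f r τ w) + ∣ Y ∣
        ≤⟨ +-monoʳ-≤ (sum H (refine f r τ w)) Y≤E ⟩
      sum H (refine f r τ w) + E ∎
      where
      open ≤-Reasoning
      open ℤ-Solver
      Y = response f w r
      ∣τ∣ : ∀ {τ} → IsSign τ → ∣ τ ∣ ≡ 1
      ∣τ∣ (inj₁ refl) = refl
      ∣τ∣ (inj₂ refl) = refl

    -- `G` is a budget for the number of weights times the square of their common bound. With that
    -- budget `spread` puts the mean of `energy` over a period below `E * E`.
    record Oscillating (G N : ℕ) (f : ℕ → ℤ) : Set where
      field
        periodic  : Periodic N f
        sign      : ∀ n → IsSign (f n)
        covers    : H ≤ N
        spread    : G * (H * mass N f) < N * (E * E)

    open Oscillating

    choose : ∀ G N f → Oscillating G N f → ∀ B ws → length ws * (B * B) ≤ G → All (λ w → ∀ h → w h ≤ B) ws →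
      ∃[ r ] r < N × All (λ w → ∣ response f w r ∣ ≤ E) ws
    choose G N f osc B ws fits ws≤B =
      let r , r<N , energy< = some-below-average N (energy f ws) (E * E) small-average
      in r , r<N , small-responses f r ws energy<
      where
      open ≤-Reasoning
      small-average : sum N (energy f ws) < N * (E * E)
      small-average = begin-strict
        sum N (energy f ws)                       ≤⟨ energy-sum N f (periodic osc) (covers osc) B ws ws≤B ⟩
        length ws * (B * B * (H * mass N f))      ≡⟨ *-assoc (length ws) (B * B) _ ⟨
        length ws * (B * B) * (H * mass N f)      ≤⟨ *-monoˡ-≤ (H * mass N f) fits ⟩
        G * (H * mass N f)                        <⟨ spread osc ⟩
        N * (E * E)                               ∎

    -- Each of the `k` functions still to be treated may cost `E` of the total weight. The
    -- inequality is strict so that something positive remains when `k` is 0.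
    Heavy : ℕ → ℕ → (ℕ → ℕ) → Set
    Heavy k B w = (∀ h → w h ≤ B) × k * E < sum H w

    refine-heavy : ∀ {f} → (∀ n → IsSign (f n)) → ∀ r {τ} → IsSign τ → ∀ k B {w} →
      Heavy (suc k) B w × ∣ response f w r ∣ ≤ E → Heavy k (2 * B) (refine f r τ w)
    refine-heavy {f} f-sign r τ-sign k B {w} ((w≤B , large) , Y≤E) =
      (λ h → ≤-trans (*-mono-≤ (w≤B h) (∣1+στ∣≤2 (f-sign (r + h)) τ-sign)) (≤-reflexive (*-comm B 2))) ,
      +-cancelˡ-< E (k * E) _ (<-≤-trans large
        (subst (sum H w ≤_) (+-comm _ E) (sum-refine f f-sign r τ-sign w Y≤E)))

    -- Demanding `0 < w h` keeps the shift inside the class of `w`, so the signs fixed by functions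
    -- treated earlier persist.
    AttainsAllSigns : ℕ → (ℕ → ℕ → ℤ) → (ℕ → ℕ) → (ℕ → ℕ) → Set
    AttainsAllSigns k f r w = ∀ (τ : ℕ → ℤ) → (∀ i → IsSign (τ i)) →
      ∃[ h ] h < H × 0 < w h × (∀ i → i < k → f i (r i + h) ≡ τ i)

    extend : ℕ → (ℕ → ℕ) → ℕ → ℕ
    extend r₀ r zero    = r₀
    extend r₀ r (suc i) = r i

    -- The sign wanted from `f 0` decides which refinement to use. Positivity of a refined weight
    -- gives both factors: `h` lies in the old class, and `f 0` has the sign that defines the
    -- refinement.
    extend-attains : ∀ k f → (∀ n → IsSign (f 0 n)) → ∀ r₀ r {w} →
      AttainsAllSigns k (λ i → f (suc i)) r (refine (f 0) r₀ 1ℤ w) ×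
      AttainsAllSigns k (λ i → f (suc i)) r (refine (f 0) r₀ -1ℤ w) →
      AttainsAllSigns (suc k) f (extend r₀ r) w
    extend-attains k f f₀-sign r₀ r {w} (attains⁺ , attains⁻) τ τ-sign = go (τ-sign 0)
      where
      from : ∀ {σ} → IsSign σ → AttainsAllSigns k (λ i → f (suc i)) r (refine (f 0) r₀ σ w) → τ 0 ≡ σ →
        ∃[ h ] h < H × 0 < w h × (∀ i → i < suc k → f i (extend r₀ r i + h) ≡ τ i)
      from {σ} σ-sign attains τ₀≡σ with attains (λ i → τ (suc i)) (λ i → τ-sign (suc i))
      ... | h , h<H , 0<w′ , eqs = h , h<H , 0<wh , λ where
          zero    _         → trans (0<∣1+στ∣⇒σ≡τ (f₀-sign (r₀ + h)) σ-sign 0<factor) (sym τ₀≡σ)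
          (suc i) (s<s i<k) → eqs i i<k
        where
        factor = ∣ 1ℤ ℤ.+ σ ℤ.* f 0 (r₀ + h) ∣
        0<wh : 0 < w h
        0<wh = >-nonZero⁻¹ (w h) {{m*n≢0⇒m≢0 (w h) {{>-nonZero 0<w′}}}}
        0<factor : 0 < factor
        0<factor = >-nonZero⁻¹ factor {{m*n≢0⇒n≢0 (w h) {{>-nonZero 0<w′}}}}
      go : IsSign (τ 0) → ∃[ h ] h < H × 0 < w h × (∀ i → i < suc k → f i (extend r₀ r i + h) ≡ τ i)
      go (inj₁ eq) = from (inj₁ refl) attains⁺ eq
      go (inj₂ eq) = from (inj₂ refl) attains⁻ eq

    -- The weights ws stand for the classes of shifts h carved out by the functions already treated:
    -- a shift compatible with the chosen signs gains a factor 2, any other gets weight 0.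
    select : ∀ G k (N : ℕ → ℕ) (f : ℕ → ℕ → ℤ) → (∀ i → i < k → Oscillating G (N i) (f i)) →
      ∀ B ws → length ws * (B * B) * 8 ^ k ≤ G → All (Heavy k B) ws →
      Σ[ r ∈ (ℕ → ℕ) ] (∀ i → i < k → r i < N i) × All (AttainsAllSigns k f r) ws
    select G zero    N f osc B ws fits heavy = (λ _ → 0) , (λ _ ()) ,
      All.map (λ { {w} (_ , 0<sum) τ _ → let h , h<H , 0<wh = some-positive H w 0<sum in h , h<H , 0<wh , λ _ () }) heavy
    select G (suc k) N f osc B ws fits heavy
      with choose G (N 0) (f 0) (osc 0 z<s) B ws
             (≤-trans (m≤m*n (length ws * (B * B)) (8 ^ suc k) {{m^n≢0 8 (suc k)}}) fits) (All.map proj₁ heavy)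
    ... | r₀ , r₀< , small
      with select G k (λ i → N (suc i)) (λ i → f (suc i)) (λ i i<k → osc (suc i) (s<s i<k)) (2 * B)
             (map (refine (f 0) r₀ 1ℤ) ws ++ map (refine (f 0) r₀ -1ℤ) ws)
             (subst (_≤ G) (doubling r₀) fits)
             (All.++⁺ (All.map⁺ (All.zipWith (refine-heavy (sign (osc 0 z<s)) r₀ (inj₁ refl) k B) (heavy , small)))
                      (All.map⁺ (All.zipWith (refine-heavy (sign (osc 0 z<s)) r₀ (inj₂ refl) k B) (heavy , small))))
      where
      open ℕ-Solver
      -- Twice as many weights with twice the bound: the count times the squared bound grows by 8,
      -- the source of `8 ^ k`.
      doubling : ∀ r₀ → length ws * (B * B) * 8 ^ suc k ≡
        length (map (refine (f 0) r₀ 1ℤ) ws ++ map (refine (f 0) r₀ -1ℤ) ws) * (2 * B * (2 * B)) * 8 ^ k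
      doubling r₀ = trans
        (solve 3 (λ l b x → l :* (b :* b) :* (con 8 :* x) := (l :+ l) :* (con 2 :* b :* (con 2 :* b)) :* x) refl
          (length ws) B (8 ^ k))
        (cong (λ x → x * (2 * B * (2 * B)) * 8 ^ k) (sym (trans (length-++ (map (refine (f 0) r₀ 1ℤ) ws))
          (cong₂ _+_ (length-map (refine (f 0) r₀ 1ℤ) ws) (length-map (refine (f 0) r₀ -1ℤ) ws)))))
    ...   | r , r< , attains = extend r₀ r , extend-< ,
      All.zipWith (extend-attains k f (sign (osc 0 z<s)) r₀ r)
        ( All.map⁻ (All.++⁻ˡ (map (refine (f 0) r₀ 1ℤ) ws) attains)
        , All.map⁻ (All.++⁻ʳ (map (refine (f 0) r₀ 1ℤ) ws) attains) )
      where
      extend-< : ∀ i → i < suc k → extend r₀ r i < N i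
      extend-< zero    _         = r₀<
      extend-< (suc i) (s<s i<k) = r< i i<k

  -- Legendre's formula

  multiplicity : ∀ p n → .{{NonZero n}} → ℕ
  multiplicity p n = length (filter (p ≟_) (factors (factorise n)))

  multiplicity-cong : ∀ p {m n} .{{_ : NonZero m}} .{{_ : NonZero n}} → m ≡ n → multiplicity p m ≡ multiplicity p n
  multiplicity-cong p refl = refl

  -- Unique factorisation: multiplicities may be read off from any factorisation, for instance a
  -- concatenation, and not only from the computed one.
  multiplicity-unique : ∀ p {n} .{{_ : NonZero n}} (F : PrimeFactorisation n) →
    multiplicity p n ≡ length (filter (p ≟_) (factors F))
  multiplicity-unique p F = ↭-length (filter-↭ (p ≟_) (factorisationUnique (factorise _) F))

  multiplicity-* : ∀ p m n .{{_ : NonZero m}} .{{_ : NonZero n}} .{{_ : NonZero (m * n)}} →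
    multiplicity p (m * n) ≡ multiplicity p m + multiplicity p n
  multiplicity-* p m n = trans
    (multiplicity-unique p (record
      { factors         = factors M ++ factors N
      ; isFactorisation = trans (cong₂ _*_ (isFactorisation M) (isFactorisation N)) (sym (product-++ (factors M) (factors N)))
      ; factorsPrime    = All.++⁺ (factorsPrime M) (factorsPrime N)
      }))
    (trans (cong length (filter-++ (p ≟_) (factors M) (factors N))) (length-++ (filter (p ≟_) (factors M))))
    where
    open PrimeFactorisation using (isFactorisation; factorsPrime)
    M = factorise m
    N = factorise n

  multiplicity-self : ∀ {p} .{{_ : NonZero p}} → Prime p → multiplicity p p ≡ 1
  multiplicity-self {p} p-prime = trans (multiplicity-unique p (primeFactorisation[p] p-prime))
    (cong length (filter-accept (p ≟_) {p} {[]} refl))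

  multiplicity-∤ : ∀ {p n} .{{_ : NonZero n}} → ¬ (p ∣ n) → multiplicity p n ≡ 0
  multiplicity-∤ {p} {n} p∤n = cong length (filter-none (p ≟_) {factors (factorise n)}
    (All.tabulate λ { x∈ refl → p∤n (subst (p ∣_) (sym (isFactorisation (factorise n))) (∈⇒∣product x∈)) }))
    where open PrimeFactorisation using (isFactorisation)

  e-suc : ∀ p n → e p (suc n) ≡ multiplicity p (suc n) + e p n
  e-suc p n = multiplicity-* p (suc n) (n !) {{_}} {{n !≢0}} {{suc n !≢0}}

  -- Recursive form, with `m` the integer part of `n / p`. Raising the last digit multiplies the
  -- factorial by a number prime to `p`; the step to `p * suc m` multiplies it by `p` and `suc m`,
  -- which adds one and the multiplicity of `suc m`.
  legendre : ∀ {p} → Prime p → ∀ m a → a < p → e p (a + p * m) ≡ m + e p m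
  legendre {p} p-prime zero zero _ = cong (e p) (*-zeroʳ p)
  legendre {p@(suc p′)} p-prime (suc m) zero _ = begin
    e p (p * suc m)
      ≡⟨ cong (e p) (*-suc p m) ⟩
    e p (suc (p′ + p * m))
      ≡⟨ e-suc p (p′ + p * m) ⟩
    multiplicity p (suc (p′ + p * m)) + e p (p′ + p * m)
      ≡⟨ cong₂ _+_ (multiplicity-cong p (sym (*-suc p m))) (legendre p-prime m p′ ≤-refl) ⟩
    multiplicity p (p * suc m) + (m + e p m)
      ≡⟨ cong (_+ (m + e p m)) (trans (multiplicity-* p p (suc m)) (cong (_+ multiplicity p (suc m)) (multiplicity-self p-prime))) ⟩
    suc (multiplicity p (suc m)) + (m + e p m)
      ≡⟨ solve 3 (λ x m y → con 1 :+ x :+ (m :+ y) := con 1 :+ m :+ (x :+ y)) refl (multiplicity p (suc m)) m (e p m) ⟩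
    suc m + (multiplicity p (suc m) + e p m)
      ≡⟨ cong (λ x → suc m + x) (e-suc p m) ⟨
    suc m + e p (suc m) ∎
    where
    open ≡-Reasoning
    open ℕ-Solver
  legendre {p} p-prime m (suc a) 1+a<p = trans (e-suc p (a + p * m))
    (cong₂ _+_ (multiplicity-∤ p∤) (legendre p-prime m a (<⇒≤ 1+a<p)))
    where
    p∤ : ¬ (p ∣ suc (a + p * m))
    p∤ p∣ = <⇒≱ 1+a<p (∣⇒≤ (∣m+n∣m⇒∣n (subst (p ∣_) (+-comm (suc a) (p * m)) p∣) (m∣m*n m)))

  module ExponentSign (t : ℕ) where

    open OddDigits t

    module _ (p-prime : Prime p) where

      ψ : ℕ → ℤ
      ψ n = sgn (e p n)

      -- Two rounds of Legendre give the exponent `b + p * m + m + e p m`. As `p` is odd,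
      -- `p * m + m` is even, so the digit `a` leaves no trace and `b` gives the sign.
      ψ-digits : ∀ {a b} m → a < p → b < p → ψ (a + p * (b + p * m)) ≡ sgn b ℤ.* ψ m
      ψ-digits {a} {b} m a<p b<p = begin
        ψ (a + p * (b + p * m))
          ≡⟨ cong sgn (trans (legendre p-prime (b + p * m) a a<p) (cong (λ x → b + p * m + x) (legendre p-prime m b b<p))) ⟩
        sgn (b + p * m + (m + e p m))
          ≡⟨ trans (sgn-+ (b + p * m) (m + e p m)) (cong₂ ℤ._*_ (sgn-+ b (p * m)) (sgn-+ m (e p m))) ⟩
        sgn b ℤ.* sgn (p * m) ℤ.* (sgn m ℤ.* ψ m)
          ≡⟨ cong (λ x → sgn b ℤ.* x ℤ.* (sgn m ℤ.* ψ m)) (sgn-odd-* m) ⟩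
        sgn b ℤ.* sgn m ℤ.* (sgn m ℤ.* ψ m)
          ≡⟨ solve 3 (λ b m y → b :* m :* (m :* y) := b :* ((m :* m) :* y)) refl (sgn b) (sgn m) (ψ m) ⟩
        sgn b ℤ.* (sgn m ℤ.* sgn m ℤ.* ψ m)
          ≡⟨ cong (sgn b ℤ.*_) (trans (cong (ℤ._* ψ m) (sgn-square m)) (ℤ.*-identityˡ (ψ m))) ⟩
        sgn b ℤ.* ψ m ∎
        where
        open ≡-Reasoning
        open ℤ-Solver

      ψ-χ : ∀ T s v → s < Q T → ψ (s + Q T * v) ≡ χ T s ℤ.* ψ v
      ψ-χ zero    zero v _ = trans (cong ψ (*-identityˡ v)) (sym (ℤ.*-identityˡ (ψ v)))
      ψ-χ zero    (suc s) v (s≤s ())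
      ψ-χ (suc T) s v s<Q = begin
        ψ (s + p * (p * Q T) * v)
          ≡⟨ cong ψ regroup ⟩
        ψ (a + p * (b + p * (s′ + Q T * v)))
          ≡⟨ ψ-digits (s′ + Q T * v) (m%n<n s p) (m%n<n (s / p) p) ⟩
        sgn b ℤ.* ψ (s′ + Q T * v)
          ≡⟨ cong (sgn b ℤ.*_) (ψ-χ T s′ v s′<Q) ⟩
        sgn b ℤ.* (χ T s′ ℤ.* ψ v)
          ≡⟨ ℤ.*-assoc (sgn b) (χ T s′) (ψ v) ⟨
        sgn b ℤ.* χ T s′ ℤ.* ψ v
          ≡⟨ cong (ℤ._* ψ v) (ℤ.*-identityˡ (sgn b ℤ.* χ T s′)) ⟨
        χ (suc T) s ℤ.* ψ v ∎
        where
        open ≡-Reasoning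
        open ℕ-Solver
        a = s % p
        b = s / p % p
        s′ = s / p / p
        s≡ : s ≡ a + p * (b + p * s′)
        s≡ = trans (digits s) (cong (λ x → a + p * x) (digits (s / p)))
        regroup : s + p * (p * Q T) * v ≡ a + p * (b + p * (s′ + Q T * v))
        regroup = trans (cong (_+ p * (p * Q T) * v) s≡)
          (solve 6 (λ a b s p q v → (a :+ p :* (b :+ p :* s)) :+ p :* (p :* q) :* v := a :+ p :* (b :+ p :* (s :+ q :* v)))
            refl a b s′ p (Q T) v)
        s′<Q : s′ < Q T
        s′<Q = *-cancelˡ-< p s′ (Q T) (*-cancelˡ-< p (p * s′) (p * Q T) (≤-<-trans
          (≤-trans (*-monoʳ-≤ p (m≤n+m (p * s′) b)) (≤-trans (m≤n+m _ a) (≤-reflexive (sym s≡)))) s<Q))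

      -- A carry out of the lowest 2T digits only changes the next digit, in even position 2T, from 0 to 1.
      ψ-shift : ∀ T r h u → r < Q T → h ≤ Q T → ψ (r + Q T * p * u + h) ≡ χ T (r + h) ℤ.* sgn (u + e p u)
      ψ-shift T r h u r<Q h≤Q with r + h <? Q T
      ... | yes r+h<Q = begin
        ψ (r + Q T * p * u + h)
          ≡⟨ cong ψ (solve 5 (λ r q p u h → r :+ q :* p :* u :+ h := (r :+ h) :+ q :* (con 0 :+ p :* u)) refl r (Q T) p u h) ⟩
        ψ (r + h + Q T * (0 + p * u))
          ≡⟨ ψ-χ T (r + h) (0 + p * u) r+h<Q ⟩
        χ T (r + h) ℤ.* ψ (0 + p * u)
          ≡⟨ cong (λ x → χ T (r + h) ℤ.* sgn x) (legendre p-prime u 0 z<s) ⟩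
        χ T (r + h) ℤ.* sgn (u + e p u) ∎
        where
        open ≡-Reasoning
        open ℕ-Solver
      ... | no  r+h≮Q = begin
        ψ (r + Q T * p * u + h)
          ≡⟨ cong ψ (trans
               (solve 5 (λ r q p u h → r :+ q :* p :* u :+ h := (r :+ h) :+ q :* p :* u) refl r (Q T) p u h)
               (trans (cong (_+ Q T * p * u) r+h≡)
                 (solve 4 (λ q s p u → (q :+ s) :+ q :* p :* u := s :+ q :* (con 1 :+ p :* u)) refl (Q T) s p u))) ⟩
        ψ (s + Q T * (1 + p * u))
          ≡⟨ ψ-χ T s (1 + p * u) s<Q ⟩
        χ T s ℤ.* ψ (1 + p * u)
          ≡⟨ cong₂ (λ x y → x ℤ.* sgn y) (trans (sym (χ-periodic T s)) (cong (χ T) (sym r+h≡))) (legendre p-prime u 1 (s<s z<s)) ⟩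
        χ T (r + h) ℤ.* sgn (u + e p u) ∎
        where
        open ≡-Reasoning
        open ℕ-Solver
        s = r + h ∸ Q T
        r+h≡ : r + h ≡ Q T + s
        r+h≡ = sym (m+[n∸m]≡n (≮⇒≥ r+h≮Q))
        -- From `r < Q T` and `h ≤ Q T` the sum stays below twice the period, so no more than one
        -- unit is carried.
        s<Q : s < Q T
        s<Q = +-cancelˡ-< (Q T) s (Q T) (subst (_< Q T + Q T) r+h≡ (+-mono-<-≤ r<Q h≤Q))

  -- Chinese remainders

  coprime-* : ∀ {a b c} → Coprime a c → Coprime b c → Coprime (a * b) c
  coprime-* {a} {b} coprime-a coprime-b {d} (d∣ab , d∣c) =
    coprime-b (coprime-divisor {d} {a} (λ (x∣d , x∣a) → coprime-a (x∣a , ∣-trans x∣d d∣c)) d∣ab , d∣c)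

  module _ {A B : ℕ} .{{_ : NonZero B}} (coprime : Coprime A B) where

    inverse-mod : ∃[ x ] ∃[ s ] ∃[ t ] A * x + s * B ≡ 1 + t * B
    inverse-mod with coprime-Bézout coprime
    ... | Bézout.+- x y eq = x , 0 , y , trans (+-identityʳ (A * x)) (trans (*-comm A x) (sym eq))
    -- In this case `z = x * A` is -1 modulo `B`, so its square, which is `A * (x * z)`, is 1.
    ... | Bézout.-+ x y eq = x * z , y , z * y , (begin
      A * (x * z) + y * B        ≡⟨ cong (_+ y * B) (solve 3 (λ A x z → A :* (x :* z) := (x :* A) :* z) refl A x z) ⟩
      z * z + y * B              ≡⟨ cong (λ v → z * z + v) (sym eq) ⟩
      z * z + (1 + z)            ≡⟨ solve 1 (λ z → z :* z :+ (con 1 :+ z) := con 1 :+ z :* (con 1 :+ z)) refl z ⟩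
      1 + z * (1 + z)            ≡⟨ cong (λ v → 1 + z * v) eq ⟩
      1 + z * (y * B)            ≡⟨ cong suc (*-assoc z y B) ⟨
      1 + z * y * B              ∎)
      where
      open ≡-Reasoning
      open ℕ-Solver
      z = x * A

    solve-mod : ∀ N {r} → r < B → ∃[ u ] u < B × ∃[ v ] N + A * u ≡ r + B * v
    solve-mod N {r} r<B with inverse-mod
    ... | x , s , t , eq = u , m%n<n (x * c) B , (N + A * u) / B , (begin
      N + A * u                                           ≡⟨ m≡m%n+[m/n]*n (N + A * u) B ⟩
      (N + A * u) % B + (N + A * u) / B * B               ≡⟨ cong₂ _+_ residue (*-comm ((N + A * u) / B) B) ⟩
      r + B * ((N + A * u) / B)                           ∎)
      where
      open ≡-Reasoning
      open ℕ-Solver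
      -- Congruent to `r - N` modulo `B`, without subtraction.
      c = r + N * (B ∸ 1)
      u = (x * c) % B
      q = (x * c) / B
      N+c≡ : N + c ≡ r + N * B
      N+c≡ = trans (solve 3 (λ N r b → N :+ (r :+ N :* b) := r :+ N :* (con 1 :+ b)) refl N r (B ∸ 1))
                   (cong (λ b → r + N * b) (m+[n∸m]≡n (>-nonZero⁻¹ B)))
      expand : N + A * u + (A * q + s * c) * B ≡ r + (N + t * c) * B
      expand = begin
        N + A * u + (A * q + s * c) * B
          ≡⟨ solve 7 (λ N A u q s c B → N :+ A :* u :+ (A :* q :+ s :* c) :* B := N :+ (A :* (u :+ q :* B) :+ s :* c :* B))
               refl N A u q s c B ⟩
        N + (A * (u + q * B) + s * c * B)
          ≡⟨ cong (λ y → N + (A * y + s * c * B)) (m≡m%n+[m/n]*n (x * c) B) ⟨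
        N + (A * (x * c) + s * c * B)
          ≡⟨ solve 6 (λ N A x c s B → N :+ (A :* (x :* c) :+ s :* c :* B) := N :+ (A :* x :+ s :* B) :* c) refl N A x c s B ⟩
        N + (A * x + s * B) * c
          ≡⟨ cong (λ y → N + y * c) eq ⟩
        N + (1 + t * B) * c
          ≡⟨ solve 4 (λ N t B c → N :+ (con 1 :+ t :* B) :* c := (N :+ c) :+ t :* c :* B) refl N t B c ⟩
        N + c + t * c * B
          ≡⟨ cong (_+ t * c * B) N+c≡ ⟩
        r + N * B + t * c * B
          ≡⟨ solve 4 (λ r N B y → r :+ N :* B :+ y :* B := r :+ (N :+ y) :* B) refl r N B (t * c) ⟩
        r + (N + t * c) * B ∎
      residue : (N + A * u) % B ≡ r
      residue = begin
        (N + A * u) % B                             ≡⟨ [m+kn]%n≡m%n (N + A * u) (A * q + s * c) B ⟨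
        (N + A * u + (A * q + s * c) * B) % B       ≡⟨ cong (_% B) expand ⟩
        (r + (N + t * c) * B) % B                   ≡⟨ [m+kn]%n≡m%n r (N + t * c) B ⟩
        r % B                                       ≡⟨ m<n⇒m%n≡m r<B ⟩
        r                                           ∎

  prod : ℕ → (ℕ → ℕ) → ℕ
  prod zero    f = 1
  prod (suc k) f = prod k f * f k

  ∣prod : ∀ k f i → i < k → f i ∣ prod k f
  ∣prod (suc k) f i i<1+k with m<1+n⇒m<n∨m≡n i<1+k
  ... | inj₁ i<k  = ∣-trans (∣prod k f i i<k) (m∣m*n (f k))
  ... | inj₂ refl = n∣m*n (prod k f)

  prod-coprime : ∀ k f {c} → (∀ i → i < k → Coprime (f i) c) → Coprime (prod k f) c
  prod-coprime zero    f coprime = 1-coprimeTo _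
  prod-coprime (suc k) f coprime = coprime-* {prod k f} {f k}
    (prod-coprime k f λ i i<k → coprime i (m<n⇒m<1+n i<k)) (coprime k ≤-refl)

  prod-≤-^ : ∀ k f {b} → (∀ i → i < k → f i ≤ b) → prod k f ≤ b ^ k
  prod-≤-^ zero    f f≤b = ≤-refl
  prod-≤-^ (suc k) f {b} f≤b = ≤-trans (*-mono-≤ (prod-≤-^ k f λ i i<k → f≤b i (m<n⇒m<1+n i<k)) (f≤b k ≤-refl))
    (≤-reflexive (*-comm (b ^ k) b))

  IsSolution : ℕ → (M r : ℕ → ℕ) → ℕ → Set
  IsSolution k M r N = ∀ i → i < k → ∃[ u ] N ≡ r i + M i * u

  extend-solution : ∀ k M r {N u v} → IsSolution k M r N → N + prod k M * u ≡ r k + M k * v →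
    IsSolution (suc k) M r (N + prod k M * u)
  extend-solution k M r {N} {u} {v} solution eq i i<1+k = go (m<1+n⇒m<n∨m≡n i<1+k)
    where
    open ≡-Reasoning
    open ℕ-Solver
    go : i < k ⊎ i ≡ k → ∃[ u′ ] N + prod k M * u ≡ r i + M i * u′
    go (inj₂ refl) = v , eq
    go (inj₁ i<k)  =
      let u′ , N≡ = solution i i<k
          divides q prod≡ = ∣prod k M i i<k
      in u′ + q * u , (begin
        N + prod k M * u               ≡⟨ cong₂ (λ x y → x + y * u) N≡ prod≡ ⟩
        r i + M i * u′ + q * M i * u
          ≡⟨ solve 5 (λ r m u′ q u → r :+ m :* u′ :+ q :* m :* u := r :+ m :* (u′ :+ q :* u)) refl (r i) (M i) u′ q u ⟩
        r i + M i * (u′ + q * u)       ∎)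

  chinese-remainder : ∀ k (M r : ℕ → ℕ) → (∀ i → i < k → r i < M i) →
    (∀ i j → i < j → j < k → Coprime (M i) (M j)) →
    ∃[ N ] 0 < N × N ≤ prod k M × IsSolution k M r N
  -- Starting from 1 rather than 0 makes the solution positive, since later steps only add; in
  -- exchange the upper bound is not strict.
  chinese-remainder zero    M r r<M coprime = 1 , z<s , ≤-refl , λ _ ()
  chinese-remainder (suc k) M r r<M coprime =
    let N , 0<N , N≤ , solution = chinese-remainder k M r (λ i i<k → r<M i (m<n⇒m<1+n i<k))
                                    (λ i j i<j j<k → coprime i j i<j (m<n⇒m<1+n j<k))
        u , u<M , v , eq = solve-mod {prod k M} {M k} {{>-nonZero (≤-<-trans z≤n (r<M k ≤-refl))}}
                             (prod-coprime k M λ i i<k → coprime i k i<k ≤-refl) N (r<M k ≤-refl)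
    in N + prod k M * u , ≤-trans 0<N (m≤m+n N _) ,
       ≤-trans (+-monoˡ-≤ (prod k M * u) N≤)
         (≤-trans (≤-reflexive (sym (*-suc (prod k M) u))) (*-monoʳ-≤ (prod k M) u<M)) ,
       extend-solution k M r solution eq

  -- Growth of the primes

  -- Candidates for the squarefree part of a number whose prime factors lie in the list. One entry
  -- per subset, so the length is a power of two even when values coincide.
  subsetProducts : List ℕ → List ℕ
  subsetProducts []       = 1 ∷ []
  subsetProducts (q ∷ qs) = subsetProducts qs ++ map (q *_) (subsetProducts qs)

  length-subsetProducts : ∀ qs → length (subsetProducts qs) ≡ 2 ^ length qs
  length-subsetProducts []       = refl
  length-subsetProducts (q ∷ qs) = begin
    length (subsetProducts qs ++ map (q *_) (subsetProducts qs))      ≡⟨ length-++ (subsetProducts qs) ⟩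
    length (subsetProducts qs) + length (map (q *_) (subsetProducts qs))
      ≡⟨ cong₂ _+_ (length-subsetProducts qs) (trans (length-map (q *_) (subsetProducts qs)) (length-subsetProducts qs)) ⟩
    2 ^ length qs + 2 ^ length qs                                     ≡⟨ cong (λ x → 2 ^ length qs + x) (+-identityʳ _) ⟨
    2 ^ suc (length qs)                                               ∎
    where open ≡-Reasoning

  1∈subsetProducts : ∀ qs → 1 ∈ subsetProducts qs
  1∈subsetProducts []       = here refl
  1∈subsetProducts (q ∷ qs) = ∈-++⁺ˡ (1∈subsetProducts qs)

  SquareTimes : List ℕ → ℕ → Set
  SquareTimes qs n = ∃[ m ] ∃[ s ] s ∈ subsetProducts qs × n ≡ m * m * s

  -- Multiplication by `q` acts on subsets as symmetric difference: a new `q` joins the product, and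
  -- a `q` already present combines with it into a square.
  toggle : ∀ {q} qs {s} → q ∈ qs → s ∈ subsetProducts qs → SquareTimes qs (q * s)
  toggle (q ∷ qs) {s} q∈ s∈ with ∈-++⁻ (subsetProducts qs) s∈
  toggle (q ∷ qs) {s} (here refl) s∈ | inj₁ s∈′ =
    1 , q * s , ∈-++⁺ʳ (subsetProducts qs) (∈-map⁺ (q *_) s∈′) , sym (*-identityˡ (q * s))
  toggle (q ∷ qs) {s} (here refl) s∈ | inj₂ s∈′ =
    let s′ , s′∈ , s≡ = ∈-map⁻ (q *_) s∈′
    in q , s′ , ∈-++⁺ˡ s′∈ , trans (cong (q *_) s≡) (sym (*-assoc q q s′))
  toggle (q ∷ qs) {s} (there q∈) s∈ | inj₁ s∈′ =
    let m , s′ , s′∈ , eq = toggle qs q∈ s∈′ in m , s′ , ∈-++⁺ˡ s′∈ , eq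
  toggle {q′} (q ∷ qs) {s} (there q∈) s∈ | inj₂ s∈′ =
    let s₀ , s₀∈ , s≡ = ∈-map⁻ (q *_) s∈′
        m , s′ , s′∈ , eq = toggle qs q∈ s₀∈
    in m , q * s′ , ∈-++⁺ʳ (subsetProducts qs) (∈-map⁺ (q *_) s′∈) , (begin
         q′ * s           ≡⟨ cong (q′ *_) s≡ ⟩
         q′ * (q * s₀)    ≡⟨ solve 3 (λ x y z → x :* (y :* z) := y :* (x :* z)) refl q′ q s₀ ⟩
         q * (q′ * s₀)    ≡⟨ cong (q *_) eq ⟩
         q * (m * m * s′) ≡⟨ solve 3 (λ x y z → x :* (y :* z) := y :* (x :* z)) refl q (m * m) s′ ⟩
         m * m * (q * s′) ∎)
    where
    open ≡-Reasoning
    open ℕ-Solver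

  product-squareTimes : ∀ {qs} fs → All (_∈ qs) fs → SquareTimes qs (product fs)
  product-squareTimes {qs} []       []       = 1 , 1 , 1∈subsetProducts qs , refl
  product-squareTimes {qs} (f ∷ fs) (f∈ ∷ fs∈) =
    let m , s , s∈ , eq = product-squareTimes fs fs∈
        m′ , s′ , s′∈ , eq′ = toggle qs f∈ s∈
    in m * m′ , s′ , s′∈ , (begin
         f * product fs            ≡⟨ cong (f *_) eq ⟩
         f * (m * m * s)           ≡⟨ solve 3 (λ x y z → x :* (y :* z) := y :* (x :* z)) refl f (m * m) s ⟩
         m * m * (f * s)           ≡⟨ cong (m * m *_) eq′ ⟩
         m * m * (m′ * m′ * s′)    ≡⟨ solve 3 (λ m n s → m :* m :* (n :* n :* s) := m :* n :* (m :* n) :* s) refl m m′ s′ ⟩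
         m * m′ * (m * m′) * s′    ∎)
    where
    open ≡-Reasoning
    open ℕ-Solver

  bounded-squareTimes : ∀ qs n → (∀ q → Prime q → q ≤ n → q ∈ qs) → SquareTimes qs n
  bounded-squareTimes qs zero      _      = 0 , 1 , 1∈subsetProducts qs , refl
  bounded-squareTimes qs n@(suc _) primes = subst (SquareTimes qs) (sym (isFactorisation F))
    (product-squareTimes (factors F) (All.tabulate λ {q} q∈ →
      primes q (All.lookup (factorsPrime F) q∈) (∣⇒≤ (subst (q ∣_) (sym (isFactorisation F)) (∈⇒∣product q∈)))))
    where
    open PrimeFactorisation using (isFactorisation; factorsPrime)
    F = factorise n

  -- For positive `n` the factor `s` is at least 1, so `m * m ≤ n`. Zero gets a representation of
  -- its own, because a given one may have `s = 0` and an arbitrarily large `m`.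
  small-root : ∀ qs {n N} → n < N * N → SquareTimes qs n →
    ∃[ m ] ∃[ s ] m < N × s ∈ subsetProducts qs × n ≡ m * m * s
  small-root qs {zero}  {suc N} _ _ = 0 , 1 , z<s , 1∈subsetProducts qs , refl
  small-root qs {suc n} {N} n<N² (m , zero , _ , eq) = contradiction (trans eq (*-zeroʳ (m * m))) λ ()
  small-root qs {suc n} {N} n<N² (m , s@(suc _) , s∈ , eq) = m , s , m<N , s∈ , eq
    where
    m<N : m < N
    m<N = ≰⇒> λ N≤m → <⇒≱ n<N² (≤-trans (*-mono-≤ N≤m N≤m) (≤-trans (m≤m*n (m * m) s) (≤-reflexive (sym eq))))

  -- Erdős' count: a number below `N * N` is determined by a root below `N` and a position in the
  -- list of subset products, an injection between finite sets.
  squareTimes-count : ∀ qs N → (∀ n → n < N * N → SquareTimes qs n) → N * N ≤ N * 2 ^ length qs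
  squareTimes-count qs N all =
    subst (λ l → N * N ≤ N * l) (length-subsetProducts qs) (injective⇒≤ {f = code} λ {i} {j} → code-injective i j)
    where
    decompose : ∀ (i : Fin (N * N)) → ∃[ m ] ∃[ s ] m < N × s ∈ subsetProducts qs × toℕ i ≡ m * m * s
    decompose i = small-root qs (toℕ<n i) (all (toℕ i) (toℕ<n i))
    code : Fin (N * N) → Fin (N * length (subsetProducts qs))
    code i = let m , s , m<N , s∈ , _ = decompose i in combine (fromℕ< m<N) (index s∈)
    code-injective : ∀ i j → code i ≡ code j → i ≡ j
    code-injective i j eq with decompose i | decompose j
    ... | m , s , m<N , s∈ , i≡ | m′ , s′ , m′<N , s′∈ , j≡
      with combine-injective (fromℕ< m<N) (index s∈) (fromℕ< m′<N) (index s′∈) eq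
    ...   | eq-m , eq-s = toℕ-injective (trans i≡ (trans (cong₂ (λ m s → m * m * s) m≡m′ s≡s′) (sym j≡)))
      where
      m≡m′ : m ≡ m′
      m≡m′ = trans (sym (toℕ-fromℕ< m<N)) (trans (cong toℕ eq-m) (toℕ-fromℕ< m′<N))
      s≡s′ : s ≡ s′
      s≡s′ = trans (lookup-index s∈) (trans (cong (lookup (subsetProducts qs)) eq-s) (sym (lookup-index s′∈)))

  module _ {p : ℕ → ℕ} (isOddPrimeSequence : IsOddPrimeSequence p) where

    open IsOddPrimeSequence isOddPrimeSequence

    sequence-≤ : ∀ {i j} → i ≤ j → p i ≤ p j
    sequence-≤ {i} i≤j = go (≤⇒≤′ i≤j)
      where
      go : ∀ {j} → i ≤′ j → p i ≤ p j
      go ≤′-refl            = ≤-refl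
      go (≤′-step {j} i≤′j) = ≤-trans (go i≤′j) (<⇒≤ (increasing j))

    sequence-< : ∀ {i j} → i < j → p i < p j
    sequence-< {i} i<j = <-≤-trans (increasing i) (sequence-≤ i<j)

    -- If `p k` were at least `N * N`, the primes below `N * N` would be among 2 and the first `k`
    -- odd primes. The count then gives `N ≤ 2 ^ (1 + k)`, against `N = 2 ^ (2 + k)`.
    sequence-bound : ∀ k → p k < 2 ^ (2 + k) * 2 ^ (2 + k)
    sequence-bound k = ≰⇒> λ N²≤pk → <⇒≱ (^-monoʳ-< 2 (s<s z<s) (n<1+n (1 + k)))
      (*-cancelˡ-≤ N {{m^n≢0 2 (2 + k)}} (subst (λ l → N * N ≤ N * 2 ^ suc l) (length-applyUpTo p k)
        (squareTimes-count qs N λ n n<N² → bounded-squareTimes qs n λ q q-prime q≤n → small q q-prime (≤-<-trans q≤n (<-≤-trans n<N² N²≤pk)))))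
      where
      N = 2 ^ (2 + k)
      qs = 2 ∷ applyUpTo p k
      small : ∀ q → Prime q → q < p k → q ∈ qs
      small q q-prime q<pk with 2 ∣? q
      small q q-prime q<pk | yes 2∣q with prime⇒irreducible q-prime 2∣q
      ... | inj₂ 2≡q = here (sym 2≡q)
      small q q-prime q<pk | no 2∤q with exhaustive q (q-prime , 2∤q)
      ... | i , refl = there (∈-applyUpTo⁺ p (≰⇒> λ k≤i → <⇒≱ q<pk (sequence-≤ k≤i)))

  -- Prescribed parities

  IsSign-sgn : ∀ n → IsSign (sgn n)
  IsSign-sgn zero    = inj₁ refl
  IsSign-sgn (suc n) with IsSign-sgn n
  ... | inj₁ eq = inj₂ (cong ℤ.-_ eq)
  ... | inj₂ eq = inj₁ (cong ℤ.-_ eq)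

  IsSign-* : ∀ {x y} → IsSign x → IsSign y → IsSign (x ℤ.* y)
  IsSign-* (inj₁ refl) (inj₁ refl) = inj₁ refl
  IsSign-* (inj₁ refl) (inj₂ refl) = inj₂ refl
  IsSign-* (inj₂ refl) (inj₁ refl) = inj₂ refl
  IsSign-* (inj₂ refl) (inj₂ refl) = inj₁ refl

  sgn-parity : ∀ n (ε : Fin 2) → sgn n ≡ sgn (toℕ ε) → n % 2 ≡ toℕ ε
  sgn-parity zero          Fin.zero             _  = refl
  sgn-parity zero          (Fin.suc Fin.zero)   ()
  sgn-parity (suc zero)    Fin.zero             ()
  sgn-parity (suc zero)    (Fin.suc Fin.zero)   _  = refl
  sgn-parity (suc (suc n)) ε                    eq = sgn-parity n ε (trans (sym (ℤ.neg-involutive (sgn n))) eq)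

  odd-form : ∀ {q} → OddPrime q → ∃[ t ] q ≡ OddDigits.p t
  odd-form {q} (q-prime , 2∤q) = go (halve q)
    where
    halve : ∀ n → ∃[ m ] (n ≡ m + m ⊎ n ≡ suc (m + m))
    halve zero = 0 , inj₁ refl
    halve (suc n) with halve n
    ... | m , inj₁ refl = m , inj₂ refl
    ... | m , inj₂ refl = suc m , inj₁ (cong suc (sym (+-suc m m)))
    go : ∃[ m ] (q ≡ m + m ⊎ q ≡ suc (m + m)) → ∃[ t ] q ≡ OddDigits.p t
    go (m     , inj₁ eq) = contradiction
      (divides m (trans eq (trans (cong (λ x → m + x) (sym (+-identityʳ m))) (*-comm 2 m)))) 2∤q
    go (zero  , inj₂ eq) = contradiction (subst Prime eq q-prime) ¬prime[1]
    go (suc t , inj₂ eq) = t , eq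

  coprime-sym : ∀ {a b} → Coprime a b → Coprime b a
  coprime-sym coprime (d∣b , d∣a) = coprime (d∣a , d∣b)

  module _ (t : ℕ) where
    open OddDigits t

    χ-sign : ∀ T n → IsSign (χ T n)
    χ-sign zero    n = inj₁ refl
    χ-sign (suc T) n = IsSign-* (inj₁ refl) (IsSign-* (IsSign-sgn (n / p % p)) (χ-sign T (n / p / p)))

    Q-coprime : ∀ {c} T → Coprime p c → Coprime (Q T) c
    Q-coprime zero    coprime = 1-coprimeTo _
    Q-coprime (suc T) coprime = coprime-* {p} {p * Q T} coprime (coprime-* {p} {Q T} coprime (Q-coprime T coprime))

    -- Successive periods differ by the factor `p²`. The lower bound makes the period cover the
    -- window, the upper bound keeps the modulus comparable to `H`.
    Q-approx : ∀ H → 0 < H → ∃[ T ] H ≤ Q T × Q T ≤ p * (p * H)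
    Q-approx (suc zero)    _ = 0 , ≤-refl , >-nonZero⁻¹ (p * (p * 1))
    Q-approx (suc (suc H)) _ with Q-approx (suc H) z<s
    ... | T , H≤Q , Q≤ with suc (suc H) ≤? Q T
    ...   | yes 1+H≤Q = T , 1+H≤Q , ≤-trans Q≤ (*-monoʳ-≤ p (*-monoʳ-≤ p (n≤1+n (suc H))))
    ...   | no  1+H≰Q = suc T , ≤-trans (s≤s H≤Q) 1+Q≤ , *-monoʳ-≤ p (*-monoʳ-≤ p (s≤s⁻¹ (≤-trans (≰⇒> 1+H≰Q) (n≤1+n _))))
      where
      0<Q : 0 < Q T
      0<Q = ≤-trans z<s H≤Q
      1+Q≤ : suc (Q T) ≤ p * (p * Q T)
      1+Q≤ = ≤-trans (+-monoˡ-≤ (Q T) 0<Q) (≤-trans (≤-reflexive (cong (λ x → Q T + x) (sym (+-identityʳ (Q T)))))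
        (≤-trans (*-monoˡ-≤ (Q T) {2} {p} (s≤s (s≤s z≤n))) (m≤n*m (p * Q T) p)))

    Q-≤-^ : ∀ {b} → p ≤ b → ∀ T → Q T ≤ (b * b) ^ T
    Q-≤-^ p≤b zero    = ≤-refl
    Q-≤-^ {b} p≤b (suc T) = ≤-trans (≤-reflexive (sym (*-assoc p p (Q T)))) (*-mono-≤ (*-mono-≤ p≤b p≤b) (Q-≤-^ p≤b T))

  module _ (t T : ℕ → ℕ) where

    q : ℕ → ℕ
    q i = OddDigits.p (t i)

    period : ℕ → ℕ
    period i = OddDigits.Q (t i) (T i)

    signs-attained : ∀ {H E} K → (∀ i → i < K → Prime (q i)) → (∀ i j → i < j → j < K → q i < q j) →
      (∀ i → i < K → Selection.Oscillating H E (8 ^ K) (period i) (OddDigits.χ (t i) (T i))) → K * E < H →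
      ∀ (τ : ℕ → ℤ) → (∀ i → IsSign (τ i)) →
      ∃[ n ] 0 < n × n ≤ prod K (λ i → period i * q i) + H × (∀ i → i < K → sgn (e (q i) n) ≡ τ i)
    signs-attained {H} {E} K q-prime q-< oscillating KE<H τ τ-sign
      -- At the start there is one class, the whole window with constant weight 1; its total `H`
      -- exceeds `K * E`.
      with Selection.select H E (8 ^ K) K period (λ i → OddDigits.χ (t i) (T i)) oscillating 1 ((λ _ → 1) ∷ [])
             (≤-reflexive (*-identityˡ (8 ^ K)))
             (((λ _ → ≤-refl) , subst (K * E <_) (sym (trans (sum-const H 1) (*-identityʳ H))) KE<H) ∷ [])
    ... | r , r< , attains ∷ []
      -- The extra factor `q i` makes the digit of the solution just above the period zero, so a
      -- carry is absorbed there and reaches no odd position.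
      with chinese-remainder K (λ i → period i * q i) r
             (λ i i<K → ≤-trans (r< i i<K) (m≤m*n (period i) (q i)))
             (λ i j i<j j<K → Q-q-coprime i j (q-coprime i j i<j j<K))
      where
      q-coprime : ∀ i j → i < j → j < K → Coprime (q i) (q j)
      q-coprime i j i<j j<K = coprime-sym {q j} {q i} (prime⇒coprime (q-prime j j<K) (q-< i j i<j j<K))
      Q-q-coprime : ∀ i j → Coprime (q i) (q j) → Coprime (period i * q i) (period j * q j)
      Q-q-coprime i j coprime = coprime-sym {period j * q j} (both j (coprime-sym {period i * q i} (both i coprime)))
        where
        both : ∀ i {c} → Coprime (q i) c → Coprime (period i * q i) c
        both i coprime = coprime-* {period i} {q i} (Q-coprime (t i) (T i) coprime) coprime
    ... | N , 0<N , N≤ , solution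
      -- The case of shift 0 reads `ψ = χ (r i) * κ`. Asking for the sign `ψ * χ (r i) * τ i`
      -- therefore makes `χ (r i + h) * κ` equal to `ψ * ψ * τ i`, which is `τ i`.
      with attains (λ i → sgn (e (q i) N) ℤ.* OddDigits.χ (t i) (T i) (r i) ℤ.* τ i)
             (λ i → IsSign-* (IsSign-* (IsSign-sgn (e (q i) N)) (χ-sign (t i) (T i) (r i))) (τ-sign i))
    ... | h , h<H , _ , attained = N + h , ≤-trans 0<N (m≤m+n N h) , +-mono-≤ N≤ (<⇒≤ h<H) , sign
      where
      open ≡-Reasoning
      open ℤ-Solver
      sign : ∀ i → i < K → sgn (e (q i) (N + h)) ≡ τ i
      sign i i<K = begin
        sgn (e (q i) (N + h))     ≡⟨ shifted h (≤-trans (<⇒≤ h<H) covers) ⟩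
        χ (r i + h) ℤ.* κ         ≡⟨ cong (ℤ._* κ) (attained i i<K) ⟩
        ψ ℤ.* χ (r i) ℤ.* τ i ℤ.* κ ≡⟨ solve 4 (λ p c t k → p :* c :* t :* k := p :* (c :* k) :* t) refl ψ (χ (r i)) (τ i) κ ⟩
        ψ ℤ.* (χ (r i) ℤ.* κ) ℤ.* τ i ≡⟨ cong (λ x → ψ ℤ.* x ℤ.* τ i) unshifted ⟨
        ψ ℤ.* ψ ℤ.* τ i           ≡⟨ cong (ℤ._* τ i) (sgn-square (e (q i) N)) ⟩
        1ℤ ℤ.* τ i                ≡⟨ ℤ.*-identityˡ (τ i) ⟩
        τ i                       ∎
        where
        open Selection.Oscillating (oscillating i i<K) using (covers)
        χ = OddDigits.χ (t i) (T i)
        u = proj₁ (solution i i<K)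
        κ = sgn (u + e (q i) u)
        ψ = sgn (e (q i) N)
        shifted : ∀ h → h ≤ period i → sgn (e (q i) (N + h)) ≡ χ (r i + h) ℤ.* κ
        shifted h h≤ = trans (cong (λ x → sgn (e (q i) (x + h))) (proj₂ (solution i i<K)))
          (ExponentSign.ψ-shift (t i) (q-prime i i<K) (T i) (r i) h u (r< i i<K) h≤)
        unshifted : ψ ≡ χ (r i) ℤ.* κ
        unshifted = trans (cong (λ x → sgn (e (q i) x)) (sym (+-identityʳ N)))
          (trans (shifted 0 z≤n) (cong (λ x → χ x ℤ.* κ) (+-identityʳ (r i))))

  -- Choice of the window and the error, and the size of the solution

  n<2^n : ∀ n → n < 2 ^ n
  n<2^n zero    = z<s
  n<2^n (suc n) = ≤-trans (+-mono-≤ (m^n>0 2 n) (n<2^n n)) (+-monoʳ-≤ (2 ^ n) (m≤m+n (2 ^ n) 0))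

  2^m*7^3m≤9^3m : ∀ m → 2 ^ m * 7 ^ (3 * m) ≤ 9 ^ (3 * m)
  2^m*7^3m≤9^3m zero    = ≤-refl
  2^m*7^3m≤9^3m (suc m) = begin
    2 ^ suc m * 7 ^ (3 * suc m)     ≡⟨ cong (λ x → 2 ^ suc m * 7 ^ x) (*-suc 3 m) ⟩
    2 ^ suc m * 7 ^ (3 + 3 * m)
      ≡⟨ solve 2 (λ x y → con 2 :* x :* (con 7 :* (con 7 :* (con 7 :* y))) := con 686 :* (x :* y)) refl (2 ^ m) (7 ^ (3 * m)) ⟩
    686 * (2 ^ m * 7 ^ (3 * m))     ≤⟨ *-mono-≤ {686} {729} (m≤m+n 686 43) (2^m*7^3m≤9^3m m) ⟩
    729 * 9 ^ (3 * m)
      ≡⟨ solve 1 (λ y → con 729 :* y := con 9 :* (con 9 :* (con 9 :* y))) refl (9 ^ (3 * m)) ⟩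
    9 ^ (3 + 3 * m)                 ≡⟨ cong (9 ^_) (*-suc 3 m) ⟨
    9 ^ (3 * suc m)                 ∎
    where
    open ≤-Reasoning
    open ℕ-Solver

  -- H = (X⁴)^(27κ) forces T ≥ 27κ for every prime below X² = 4^κ, and then (9/7)^T ≥ 2^(9κ) = X⁹ because 9³ ≥ 2 · 7³.
  module Quantities (K : ℕ) where

    open ≤-Reasoning
    open ℕ-Solver

    κ = suc K
    X = 2 ^ κ
    -- The exponent makes `H` equal to `2 ^ (108 * κ * κ)`, where `108 = 4 * 27`, while `H / E` is
    -- `X = 2 ^ κ`, which exceeds `K`.
    E = 2 ^ (κ * (108 * K + 107))
    H = X * E

    H-power : H ≡ ((X * X) * (X * X)) ^ (27 * κ)
    H-power = begin-equality
      2 ^ κ * 2 ^ (κ * (108 * K + 107))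
        ≡⟨ ^-distribˡ-+-* 2 κ _ ⟨
      2 ^ (κ + κ * (108 * K + 107))
        ≡⟨ cong (2 ^_) (solve 1 (λ k → let κ = con 1 :+ k in
             κ :+ κ :* (con 108 :* k :+ con 107) := (κ :+ κ :+ (κ :+ κ)) :* (con 27 :* κ)) refl K) ⟩
      2 ^ ((κ + κ + (κ + κ)) * (27 * κ))
        ≡⟨ ^-*-assoc 2 (κ + κ + (κ + κ)) (27 * κ) ⟨
      (2 ^ (κ + κ + (κ + κ))) ^ (27 * κ)
        ≡⟨ cong (_^ (27 * κ)) (trans (^-distribˡ-+-* 2 (κ + κ) (κ + κ)) (cong₂ _*_ (^-distribˡ-+-* 2 κ κ) (^-distribˡ-+-* 2 κ κ))) ⟩
      ((X * X) * (X * X)) ^ (27 * κ) ∎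

    1<X : 1 < X
    1<X = ≤-trans (s≤s (s≤s z≤n)) (n<2^n κ)

    0<X : 0 < X
    0<X = <⇒≤ 1<X

    0<E : 0 < E
    0<E = m^n>0 2 (κ * (108 * K + 107))

    0<H : 0 < H
    0<H = *-mono-≤ 0<X 0<E

    1<X⁴ : 1 < (X * X) * (X * X)
    1<X⁴ = *-mono-≤ {2} (≤-trans 1<X (m≤m*n X X {{>-nonZero 0<X}})) (*-mono-≤ 0<X 0<X)

    KE<H : K * E < H
    KE<H = *-monoˡ-< E {{>-nonZero 0<E}} (<-trans (n<1+n K) (n<2^n κ))

    8^K<X³ : 8 ^ K < X * X * X
    8^K<X³ = begin-strict
      8 ^ K            <⟨ ^-monoʳ-< 8 (s<s z<s) (n<1+n K) ⟩
      8 ^ κ            ≡⟨ ^-*-assoc 2 3 κ ⟩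
      2 ^ (3 * κ)      ≡⟨ cong (2 ^_) (*-comm 3 κ) ⟩
      2 ^ (κ * 3)      ≡⟨ ^-*-assoc 2 κ 3 ⟨
      X ^ 3            ≡⟨ solve 1 (λ x → x :^ 3 := x :* x :* x) refl X ⟩
      X * X * X        ∎

    X⁹7^T≤9^T : ∀ T → 27 * κ ≤ T → X ^ 9 * 7 ^ T ≤ 9 ^ T
    X⁹7^T≤9^T T 27κ≤T = begin
      X ^ 9 * 7 ^ T
        ≡⟨ cong₂ (λ x y → x * 7 ^ y) (trans (^-*-assoc 2 κ 9) (cong (2 ^_) (*-comm κ 9))) T≡ ⟩
      2 ^ (9 * κ) * 7 ^ (3 * (9 * κ) + T′)
        ≡⟨ trans (cong (2 ^ (9 * κ) *_) (^-distribˡ-+-* 7 (3 * (9 * κ)) T′)) (sym (*-assoc (2 ^ (9 * κ)) _ _)) ⟩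
      2 ^ (9 * κ) * 7 ^ (3 * (9 * κ)) * 7 ^ T′
        ≤⟨ *-mono-≤ (2^m*7^3m≤9^3m (9 * κ)) (^-monoˡ-≤ T′ (m≤m+n 7 2)) ⟩
      9 ^ (3 * (9 * κ)) * 9 ^ T′
        ≡⟨ trans (cong (9 ^_) T≡) (^-distribˡ-+-* 9 (3 * (9 * κ)) T′) ⟨
      9 ^ T ∎
      where
      T′ = T ∸ 27 * κ
      T≡ : T ≡ 3 * (9 * κ) + T′
      T≡ = trans (sym (m+[n∸m]≡n 27κ≤T)) (cong (_+ T′) (*-assoc 3 9 κ))

    module _ (t : ℕ) (p≤X² : OddDigits.p t ≤ X * X) where

      open OddDigits t

      T-lower : ∀ T → H ≤ Q T → 27 * κ ≤ T
      T-lower T H≤Q = ≮⇒≥ λ T< → <⇒≱ (^-monoʳ-< ((X * X) * (X * X)) 1<X⁴ T<)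
        (≤-trans (≤-reflexive (sym H-power)) (≤-trans H≤Q (Q-≤-^ t p≤X² T)))

      oscillating : ∀ T → H ≤ Q T → Q T ≤ p * (p * H) → Selection.Oscillating H E (8 ^ K) (Q T) (χ T)
      oscillating T H≤Q Q≤ = record
        { periodic = χ-periodic T
        ; sign     = χ-sign t T
        ; covers   = H≤Q
        -- Nine factors `X` have to be paid: three cover `8 ^ K`, four cover the `p²` by which the
        -- period may exceed `H`, and two come from `H * H = X * X * (E * E)`.
        ; spread   = *-cancelˡ-< (9 ^ T) _ _ (begin-strict
            9 ^ T * (8 ^ K * (H * mass (Q T) (χ T)))
              ≡⟨ solve 4 (λ n k h m → n :* (k :* (h :* m)) := k :* h :* (n :* m)) refl (9 ^ T) (8 ^ K) H (mass (Q T) (χ T)) ⟩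
            8 ^ K * H * (9 ^ T * mass (Q T) (χ T))
              ≤⟨ *-monoʳ-≤ (8 ^ K * H) (mass-χ T) ⟩
            8 ^ K * H * (7 ^ T * (Q T * Q T))
              ≤⟨ *-monoʳ-≤ (8 ^ K * H) (*-monoʳ-≤ (7 ^ T) (*-monoʳ-≤ (Q T)
                   (≤-trans Q≤ (*-mono-≤ p≤X² (*-monoˡ-≤ H p≤X²))))) ⟩
            8 ^ K * H * (7 ^ T * (Q T * ((X * X) * ((X * X) * H))))
              ≡⟨ solve 5 (λ k x e s q → k :* (x :* e) :* (s :* (q :* ((x :* x) :* ((x :* x) :* (x :* e)))))
                   := k :* (x :^ 6 :* (q :* (e :* e) :* s))) refl (8 ^ K) X E (7 ^ T) (Q T) ⟩
            8 ^ K * (X ^ 6 * (Q T * (E * E) * 7 ^ T))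
              <⟨ *-monoˡ-< (X ^ 6 * (Q T * (E * E) * 7 ^ T)) {{>-nonZero 0<rest}} 8^K<X³ ⟩
            X * X * X * (X ^ 6 * (Q T * (E * E) * 7 ^ T))
              ≡⟨ solve 3 (λ x y s → x :* x :* x :* (x :^ 6 :* (y :* s)) := y :* (x :^ 9 :* s)) refl X (Q T * (E * E)) (7 ^ T) ⟩
            Q T * (E * E) * (X ^ 9 * 7 ^ T)
              ≤⟨ *-monoʳ-≤ (Q T * (E * E)) (X⁹7^T≤9^T T (T-lower T H≤Q)) ⟩
            Q T * (E * E) * 9 ^ T
              ≡⟨ *-comm (Q T * (E * E)) (9 ^ T) ⟩
            9 ^ T * (Q T * (E * E)) ∎)
        }
        where
        0<rest : 0 < X ^ 6 * (Q T * (E * E) * 7 ^ T)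
        0<rest = *-mono-≤ {1} (m^n>0 X {{>-nonZero 0<X}} 6)
          (*-mono-≤ {1} (*-mono-≤ {1} (≤-trans 0<H H≤Q) (*-mono-≤ 0<E 0<E)) (m^n>0 7 T))

      modulus-bound : ∀ T → Q T ≤ p * (p * H) → Q T * p ≤ X ^ 6 * H
      modulus-bound T Q≤ = ≤-trans (*-mono-≤ (≤-trans Q≤ (*-mono-≤ p≤X² (*-monoˡ-≤ H p≤X²))) p≤X²)
        (≤-reflexive (solve 2 (λ x h → (x :* x) :* ((x :* x) :* h) :* (x :* x) := x :^ 6 :* h) refl X H))

    -- `X ^ 6 * H` bounds each modulus, by `p³ * H`. The window is absorbed by one more such factor,
    -- which turns the exponent `K` into `κ`; then `6 * κ + 108 * κ²` is at most `114 * κ²`.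
    total-bound : (X ^ 6 * H) ^ K + H ≤ 2 ^ (114 * (κ * κ * κ))
    total-bound = begin
      Z ^ K + H
        ≤⟨ +-monoʳ-≤ (Z ^ K) (m≤n*m H (Z ^ K) {{m^n≢0 Z K {{>-nonZero 0<Z}}}}) ⟩
      Z ^ K + Z ^ K * H
        ≡⟨ solve 2 (λ z h → z :+ z :* h := (con 1 :+ h) :* z) refl (Z ^ K) H ⟩
      (1 + H) * Z ^ K
        ≤⟨ *-monoˡ-≤ (Z ^ K) 1+H≤Z ⟩
      Z ^ κ
        ≡⟨ cong (_^ κ) Z-power ⟩
      (2 ^ (6 * κ + 108 * (κ * κ))) ^ κ
        ≡⟨ ^-*-assoc 2 (6 * κ + 108 * (κ * κ)) κ ⟩
      2 ^ ((6 * κ + 108 * (κ * κ)) * κ)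
        ≤⟨ ^-monoʳ-≤ 2 (*-monoˡ-≤ κ (+-monoˡ-≤ (108 * (κ * κ)) (*-monoʳ-≤ 6 (m≤m*n κ κ)))) ⟩
      2 ^ ((6 * (κ * κ) + 108 * (κ * κ)) * κ)
        ≡⟨ cong (2 ^_) (solve 1 (λ k → (con 6 :* (k :* k) :+ con 108 :* (k :* k)) :* k := con 114 :* (k :* k :* k)) refl κ) ⟩
      2 ^ (114 * (κ * κ * κ)) ∎
      where
      Z = X ^ 6 * H
      1<X⁶ : 1 < X ^ 6
      1<X⁶ = *-mono-≤ {2} 1<X (m^n>0 X {{>-nonZero 0<X}} 5)
      0<Z : 0 < Z
      0<Z = *-mono-≤ (<⇒≤ 1<X⁶) 0<H
      1+H≤Z : 1 + H ≤ Z
      1+H≤Z = ≤-trans (+-monoˡ-≤ H 0<H) (≤-trans (≤-reflexive (cong (λ x → H + x) (sym (+-identityʳ H)))) (*-monoˡ-≤ H 1<X⁶))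
      Z-power : Z ≡ 2 ^ (6 * κ + 108 * (κ * κ))
      Z-power = begin-equality
        X ^ 6 * (X * E)
          ≡⟨ cong₂ _*_ (trans (^-*-assoc 2 κ 6) (cong (2 ^_) (*-comm κ 6))) (sym (^-distribˡ-+-* 2 κ _)) ⟩
        2 ^ (6 * κ) * 2 ^ (κ + κ * (108 * K + 107))
          ≡⟨ ^-distribˡ-+-* 2 (6 * κ) _ ⟨
        2 ^ (6 * κ + (κ + κ * (108 * K + 107)))
          ≡⟨ cong (λ x → 2 ^ (6 * κ + x)) (solve 1 (λ k → let κ = con 1 :+ k in
               κ :+ κ :* (con 108 :* k :+ con 107) := con 108 :* (κ :* κ)) refl K) ⟩
        2 ^ (6 * κ + 108 * (κ * κ)) ∎

  module _ {p : ℕ → ℕ} (isOddPrimeSequence : IsOddPrimeSequence p) where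

    open IsOddPrimeSequence isOddPrimeSequence

    prescribed-parities : ∀ (ε : ℕ → Fin 2) K →
      ∃[ n ] 0 < n × n ≤ 2 ^ (114 * (suc K * suc K * suc K)) × (∀ i → i < K → e (p i) n % 2 ≡ toℕ (ε i))
    prescribed-parities ε K = go (λ i → proj₁ (odd-form (oddPrime i))) (λ i → proj₂ (odd-form (oddPrime i)))
      where
      open Quantities K
      go : ∀ (t : ℕ → ℕ) → (∀ i → p i ≡ OddDigits.p (t i)) →
        ∃[ n ] 0 < n × n ≤ 2 ^ (114 * (suc K * suc K * suc K)) × (∀ i → i < K → e (p i) n % 2 ≡ toℕ (ε i))
      go t p≡ = conclude (λ i → proj₁ (Q-approx (t i) H 0<H)) (λ i → proj₂ (Q-approx (t i) H 0<H))
        where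
        -- `sequence-bound` has the exponent `2 + i`, and `i < K` gives `2 + i ≤ κ`.
        p≤X² : ∀ i → i < K → OddDigits.p (t i) ≤ X * X
        p≤X² i i<K = ≤-trans (≤-reflexive (sym (p≡ i))) (≤-trans (<⇒≤ (sequence-bound isOddPrimeSequence i))
          (*-mono-≤ (^-monoʳ-≤ 2 (s≤s i<K)) (^-monoʳ-≤ 2 (s≤s i<K))))
        conclude : ∀ (T : ℕ → ℕ) →
          (∀ i → H ≤ OddDigits.Q (t i) (T i) × OddDigits.Q (t i) (T i) ≤ OddDigits.p (t i) * (OddDigits.p (t i) * H)) →
          ∃[ n ] 0 < n × n ≤ 2 ^ (114 * (suc K * suc K * suc K)) × (∀ i → i < K → e (p i) n % 2 ≡ toℕ (ε i))
        conclude T approx =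
          let n , 0<n , n≤ , signs = signs-attained t T K
                (λ i _ → subst Prime (p≡ i) (proj₁ (oddPrime i)))
                (λ i j i<j _ → subst₂ _<_ (p≡ i) (p≡ j) (sequence-< isOddPrimeSequence i<j))
                (λ i i<K → oscillating (t i) (p≤X² i i<K) (T i) (proj₁ (approx i)) (proj₂ (approx i)))
                KE<H (λ i → sgn (toℕ (ε i))) (λ i → IsSign-sgn (toℕ (ε i)))
          in n , 0<n ,
             ≤-trans n≤ (≤-trans (+-monoˡ-≤ H (prod-≤-^ K _ λ i i<K →
               modulus-bound (t i) (p≤X² i i<K) (T i) (proj₂ (approx i)))) total-bound) ,
             λ i i<K → sgn-parity (e (p i) n) (ε i) (trans (cong (λ q → sgn (e q n)) (p≡ i)) (signs i i<K))

  -- Comparison of the cubic exponent with the ninth power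

  915y³≤[4y]⁹ : ∀ y .{{_ : NonZero y}} → 915 * (y * y * y) ≤ (4 * y) ^ 9
  915y³≤[4y]⁹ y = begin
    -- `915 + 109 = 1024 = 4⁵`.
    915 * (y * y * y)      ≤⟨ *-mono-≤ (m≤m+n 915 109) (≤-reflexive (solve 1 (λ y → y :* y :* y := y :^ 3) refl y)) ⟩
    4 ^ 5 * y ^ 3          ≤⟨ *-mono-≤ (^-monoˡ-≤ 5 (m≤m*n 4 y)) (≤-trans (^-monoʳ-≤ y (n≤1+n 3)) (^-monoˡ-≤ 4 (m≤n*m y 4))) ⟩
    (4 * y) ^ 5 * (4 * y) ^ 4 ≡⟨ ^-distribˡ-+-* (4 * y) 5 4 ⟨
    (4 * y) ^ 9            ∎
    where
    open ≤-Reasoning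
    open ℕ-Solver

  -- `915 = 114 * 2³ + 3`, from `y + 1 ≤ 2y` and `1 ≤ y³`.
  cubic-bound : ∀ y .{{_ : NonZero y}} → 114 * (suc y * suc y * suc y) + 3 ≤ 915 * (y * y * y)
  cubic-bound y@(suc _) = begin
    114 * (suc y * suc y * suc y) + 3
      ≤⟨ +-mono-≤ (*-monoʳ-≤ 114 (*-mono-≤ (*-mono-≤ 1+y≤y+y 1+y≤y+y) 1+y≤y+y)) (*-monoʳ-≤ 3 (*-mono-≤ (*-mono-≤ 1≤y 1≤y) 1≤y)) ⟩
    114 * ((y + y) * (y + y) * (y + y)) + 3 * (y * y * y)
      ≡⟨ solve 1 (λ y → con 114 :* ((y :+ y) :* (y :+ y) :* (y :+ y)) :+ con 3 :* (y :* y :* y) := con 915 :* (y :* y :* y)) refl y ⟩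
    915 * (y * y * y) ∎
    where
    open ≤-Reasoning
    open ℕ-Solver
    1≤y : 1 ≤ y
    1≤y = s≤s z≤n
    1+y≤y+y : suc y ≤ y + y
    1+y≤y+y = +-monoˡ-≤ y 1≤y

  -- The first hypothesis says that `K + 1` indices no longer fit into the size `2 ^ m`. If `k`
  -- exceeded `K`, the ninth power would already dominate that cubic at `y = K + 1`.
  index-bound : ∀ K m k → m < 114 * (suc (suc K) * suc (suc K) * suc (suc K)) → (4 * k) ^ 9 ≤ m + 3 → k ≤ K
  index-bound K m k m< power≤ = ≮⇒≥ λ K<k → <⇒≱ (+-monoˡ-< 3 m<)
    (≤-trans (cubic-bound (suc K)) (≤-trans (915y³≤[4y]⁹ (suc K)) (≤-trans (^-monoˡ-≤ 9 (*-monoʳ-≤ 4 K<k)) power≤)))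

module Analysis where

  open Arithmetic using (prescribed-parities; n<2^n; index-bound)
  open import Data.Nat.Base using (zero; suc)
  import Data.Nat.Properties as ℕ
  open import Data.Product.Base using (proj₁; proj₂)
  open import Data.Rational.Base
  open import Data.Rational.Properties
  open import Data.Rational.Solver
  open import Data.Sum.Base using (_⊎_; inj₁; inj₂)
  open import Algebra.Definitions.RawSemiring +-*-rawSemiring using (_^_)
  open import Relation.Binary.PropositionalEquality
  open import Relation.Nullary using (¬_; yes; no; contradiction)
  open import Relation.Unary using (Decidable)

  open +-*-Solver using (solve; _:+_; _:*_; _:-_; con; _:=_)

  -- Elementary inequalities for rationals and finite sums

  ¼ : ℚ
  ¼ = ½ * ½

  *-monoˡ : ∀ {a b c} → 0ℚ ≤ c → a ≤ b → c * a ≤ c * b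
  *-monoˡ {c = c} 0≤c = *-monoˡ-≤-nonNeg c {{nonNegative 0≤c}}

  *-monoʳ : ∀ {a b c} → 0ℚ ≤ c → a ≤ b → a * c ≤ b * c
  *-monoʳ {c = c} 0≤c = *-monoʳ-≤-nonNeg c {{nonNegative 0≤c}}

  ≤-+-nonNeg : ∀ a {b} → 0ℚ ≤ b → a ≤ a + b
  ≤-+-nonNeg a {b} 0≤b = subst (_≤ a + b) (+-identityʳ a) (+-monoʳ-≤ a 0≤b)

  ι-cancel-≤ : ∀ {m n} → ι m ≤ ι n → m ℕ.≤ n
  ι-cancel-≤ {m} {n} ιm≤ιn = ℕ.≮⇒≥ λ n<m → <-irrefl refl
    (<-≤-trans (subst (_< 1ℚ + ι n) (+-identityˡ (ι n)) (+-monoˡ-< (ι n) (positive⁻¹ 1ℚ)))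
      (≤-trans (≤-reflexive (sym (ι-suc n))) (≤-trans (ι-mono n<m) ιm≤ιn)))

  ι-^ : ∀ m n → ι (m ℕ.^ n) ≡ ι m ^ n
  ι-^ m zero    = refl
  ι-^ m (suc n) = trans (ι-* m (m ℕ.^ n)) (cong (ι m *_) (ι-^ m n))

  recip-≤1 : ∀ {y} → 1ℚ ≤ y → recip y ≤ 1ℚ
  recip-≤1 {y} 1≤y = subst (recip y ≤_) (trans (sym (*-identityˡ (recip 1ℚ))) (*-recip (positive⁻¹ 1ℚ)))
    (recip-antitone (positive⁻¹ 1ℚ) 1≤y)

  ∑-tail-≤ : ∀ m n f {C} → (∀ j → j ℕ.< n → f (m ℕ.+ j) ≤ C) → ∑ (m ℕ.+ n) f ≤ ∑ m f + ι n * C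
  ∑-tail-≤ m zero    f {C} h = ≤-reflexive (trans (cong (λ k → ∑ k f) (ℕ.+-identityʳ m))
    (sym (trans (cong (∑ m f +_) (*-zeroˡ C)) (+-identityʳ (∑ m f)))))
  ∑-tail-≤ m (suc n) f {C} h = begin
    ∑ (m ℕ.+ suc n) f           ≡⟨ cong (λ k → ∑ k f) (ℕ.+-suc m n) ⟩
    ∑ (m ℕ.+ n) f + f (m ℕ.+ n) ≤⟨ +-mono-≤ (∑-tail-≤ m n f λ j j<n → h j (ℕ.m<n⇒m<1+n j<n)) (h n ℕ.≤-refl) ⟩
    ∑ m f + ι n * C + C         ≡⟨ solve 3 (λ s i c → s :+ i :* c :+ c := s :+ (con 1ℚ :+ i) :* c) refl (∑ m f) (ι n) C ⟩
    ∑ m f + (1ℚ + ι n) * C      ≡⟨ cong (λ z → ∑ m f + z * C) (ι-suc n) ⟨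
    ∑ m f + ι (suc n) * C       ∎
    where open ≤-Reasoning

  ∑-tail-≥ : ∀ m n f {C} → (∀ j → j ℕ.< n → C ≤ f (m ℕ.+ j)) → ∑ m f + ι n * C ≤ ∑ (m ℕ.+ n) f
  ∑-tail-≥ m zero    f {C} h = ≤-reflexive (trans (trans (cong (∑ m f +_) (*-zeroˡ C)) (+-identityʳ (∑ m f)))
    (cong (λ k → ∑ k f) (sym (ℕ.+-identityʳ m))))
  ∑-tail-≥ m (suc n) f {C} h = begin
    ∑ m f + ι (suc n) * C       ≡⟨ cong (λ z → ∑ m f + z * C) (ι-suc n) ⟩
    ∑ m f + (1ℚ + ι n) * C      ≡⟨ solve 3 (λ s i c → s :+ (con 1ℚ :+ i) :* c := s :+ i :* c :+ c) refl (∑ m f) (ι n) C ⟩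
    ∑ m f + ι n * C + C         ≤⟨ +-mono-≤ (∑-tail-≥ m n f λ j j<n → h j (ℕ.m<n⇒m<1+n j<n)) (h n ℕ.≤-refl) ⟩
    ∑ (m ℕ.+ n) f + f (m ℕ.+ n) ≡⟨ cong (λ k → ∑ k f) (ℕ.+-suc m n) ⟨
    ∑ (m ℕ.+ suc n) f           ∎
    where open ≤-Reasoning

  -- Dyadic bounds for Riemann sums of 1/t

  module _ {h : ℚ} (0≤h : 0ℚ ≤ h) where

    open ≤-Reasoning

    1≤node : ∀ j → 1ℚ ≤ 1ℚ + ι j * h
    1≤node j = ≤-+-nonNeg 1ℚ (0≤* (0≤ι j) 0≤h)

    0<node : ∀ j → 0ℚ < 1ℚ + ι j * h
    0<node j = <-≤-trans (positive⁻¹ 1ℚ) (1≤node j)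

    leftTerm-antitone : ∀ {i j} → i ℕ.≤ j → leftTerm h j ≤ leftTerm h i
    leftTerm-antitone {i} {j} i≤j = *-monoˡ 0≤h (recip-antitone (0<node i) (+-monoʳ-≤ 1ℚ (*-monoʳ 0≤h (ι-mono i≤j))))

    ∑-leftTerm-≤ : ∀ n → ∑ n (leftTerm h) ≤ ι n * h
    ∑-leftTerm-≤ n = subst (∑ n (leftTerm h) ≤_) (+-identityˡ (ι n * h)) (∑-tail-≤ 0 n (leftTerm h) λ j _ →
      ≤-trans (*-monoˡ 0≤h (recip-≤1 (1≤node j))) (≤-reflexive (*-identityʳ h)))

    -- Each of the `M` new terms is at most `h / (1 + M h)`, so together they add at most 1: a
    -- discrete form of log 2 ≤ 1.
    ∑-leftTerm-double-≤ : ∀ M → ∑ (M ℕ.+ M) (leftTerm h) ≤ ∑ M (leftTerm h) + 1ℚ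
    ∑-leftTerm-double-≤ M = ≤-trans (∑-tail-≤ M M (leftTerm h) λ j _ → leftTerm-antitone (ℕ.m≤m+n M j))
      (+-monoʳ-≤ (∑ M (leftTerm h)) (begin
        ι M * (h * R)       ≡⟨ *-assoc (ι M) h R ⟨
        ι M * h * R         ≤⟨ *-monoʳ (<⇒≤ (recip-pos (0<node M))) (subst (_≤ 1ℚ + ι M * h) (+-identityˡ (ι M * h)) (+-monoˡ-≤ (ι M * h) 0≤1)) ⟩
        (1ℚ + ι M * h) * R  ≡⟨ *-recip (0<node M) ⟩
        1ℚ                  ∎))
      where R = recip (1ℚ + ι M * h)

    -- Each of the `M` new terms is at least `h / (1 + 2 M h)`, and `1 + 2 M h ≤ 4 M h` once
    -- `M h ≥ 1`.
    ∑-leftTerm-double-≥ : ∀ M → 1ℚ ≤ ι M * h → ∑ M (leftTerm h) + ¼ ≤ ∑ (M ℕ.+ M) (leftTerm h)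
    ∑-leftTerm-double-≥ M 1≤y = ≤-trans
      (+-monoʳ-≤ (∑ M (leftTerm h)) (begin
        ¼                                   ≡⟨ *-identityʳ ¼ ⟨
        ¼ * 1ℚ                              ≡⟨ cong (¼ *_) (*-recip (0<node (M ℕ.+ M))) ⟨
        ¼ * ((1ℚ + ι (M ℕ.+ M) * h) * R)    ≡⟨ *-assoc ¼ (1ℚ + ι (M ℕ.+ M) * h) R ⟨
        ¼ * (1ℚ + ι (M ℕ.+ M) * h) * R      ≤⟨ *-monoʳ (<⇒≤ (recip-pos (0<node (M ℕ.+ M)))) quarter ⟩
        ι M * h * R                         ≡⟨ *-assoc (ι M) h R ⟩
        ι M * (h * R)                       ∎))
      (∑-tail-≥ M M (leftTerm h) λ j j<M → leftTerm-antitone (ℕ.+-monoʳ-≤ M (ℕ.<⇒≤ j<M)))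
      where
      R = recip (1ℚ + ι (M ℕ.+ M) * h)
      quarter : ¼ * (1ℚ + ι (M ℕ.+ M) * h) ≤ ι M * h
      quarter = begin
        ¼ * (1ℚ + ι (M ℕ.+ M) * h)            ≡⟨ cong (λ z → ¼ * (1ℚ + z * h)) (ι-+ M M) ⟩
        ¼ * (1ℚ + (ι M + ι M) * h)            ≤⟨ *-monoˡ {c = ¼} (≤ᵇ⇒≤ _) (+-monoˡ-≤ ((ι M + ι M) * h) (≤-trans 1≤y (≤-+-nonNeg (ι M * h) (0≤* (0≤ι M) 0≤h)))) ⟩
        ¼ * (ι M * h + ι M * h + (ι M + ι M) * h)
          ≡⟨ solve 2 (λ m h → con ¼ :* (m :* h :+ m :* h :+ (m :+ m) :* h) := m :* h) refl (ι M) h ⟩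
        ι M * h                               ∎

    ∑-leftTerm-2^-≤ : ∀ j k → ∑ (2 ℕ.^ (j ℕ.+ k)) (leftTerm h) ≤ ι j + ι (2 ℕ.^ k) * h
    ∑-leftTerm-2^-≤ zero    k = subst (∑ (2 ℕ.^ k) (leftTerm h) ≤_) (sym (+-identityˡ (ι (2 ℕ.^ k) * h))) (∑-leftTerm-≤ (2 ℕ.^ k))
    ∑-leftTerm-2^-≤ (suc j) k = begin
      ∑ (M ℕ.+ (M ℕ.+ 0)) (leftTerm h)  ≡⟨ cong (λ z → ∑ (M ℕ.+ z) (leftTerm h)) (ℕ.+-identityʳ M) ⟩
      ∑ (M ℕ.+ M) (leftTerm h)          ≤⟨ ∑-leftTerm-double-≤ M ⟩
      ∑ M (leftTerm h) + 1ℚ             ≤⟨ +-monoˡ-≤ 1ℚ (∑-leftTerm-2^-≤ j k) ⟩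
      ι j + y + 1ℚ                      ≡⟨ solve 2 (λ a b → a :+ b :+ con 1ℚ := (con 1ℚ :+ a) :+ b) refl (ι j) y ⟩
      1ℚ + ι j + y                      ≡⟨ cong (_+ y) (ι-suc j) ⟨
      ι (suc j) + y                     ∎
      where
      M = 2 ℕ.^ (j ℕ.+ k)
      y = ι (2 ℕ.^ k) * h

    ∑-leftTerm-2^-≥ : ∀ j k → 1ℚ ≤ ι (2 ℕ.^ k) * h → ι j * ¼ ≤ ∑ (2 ℕ.^ (j ℕ.+ k)) (leftTerm h)
    ∑-leftTerm-2^-≥ zero    k 1≤ = ≤-trans (≤-reflexive (*-zeroˡ ¼))
      (subst (_≤ ∑ (2 ℕ.^ k) (leftTerm h)) (trans (+-identityˡ _) (*-zeroʳ (ι (2 ℕ.^ k))))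
        (∑-tail-≥ 0 (2 ℕ.^ k) (leftTerm h) λ j _ → 0≤* 0≤h (<⇒≤ (recip-pos (0<node j)))))
    ∑-leftTerm-2^-≥ (suc j) k 1≤ = begin
      ι (suc j) * ¼                     ≡⟨ cong (_* ¼) (ι-suc j) ⟩
      (1ℚ + ι j) * ¼                    ≡⟨ solve 1 (λ i → (con 1ℚ :+ i) :* con ¼ := i :* con ¼ :+ con ¼) refl (ι j) ⟩
      ι j * ¼ + ¼                       ≤⟨ +-monoˡ-≤ ¼ (∑-leftTerm-2^-≥ j k 1≤) ⟩
      ∑ M (leftTerm h) + ¼              ≤⟨ ∑-leftTerm-double-≥ M (≤-trans 1≤ (*-monoʳ 0≤h (ι-mono (ℕ.^-monoʳ-≤ 2 (ℕ.m≤n+m k j))))) ⟩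
      ∑ (M ℕ.+ M) (leftTerm h)          ≡⟨ cong (λ z → ∑ (M ℕ.+ z) (leftTerm h)) (ℕ.+-identityʳ M) ⟨
      ∑ (M ℕ.+ (M ℕ.+ 0)) (leftTerm h)  ∎
      where M = 2 ℕ.^ (j ℕ.+ k)

  0≤a-1 : ∀ {a} → 1ℚ ≤ a → 0ℚ ≤ a - 1ℚ
  0≤a-1 {a} 1≤a = subst (_≤ a - 1ℚ) (+-inverseʳ 1ℚ) (+-monoˡ-≤ (- 1ℚ) 1≤a)

  ½^-split : ∀ j k → ι (2 ℕ.^ k) * ½ ^ (j ℕ.+ k) ≡ ½ ^ j
  ½^-split zero    k = ι2^*½^ k
  ½^-split (suc j) k = trans (solve 3 (λ a b c → a :* (b :* c) := b :* (a :* c)) refl (ι (2 ℕ.^ k)) ½ (½ ^ (j ℕ.+ k)))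
    (cong (½ *_) (½^-split j k))

  module _ {a : ℚ} (1≤a : 1ℚ ≤ a) (j : ℕ) where

    step-nonNeg : ∀ n → 0ℚ ≤ (a - 1ℚ) * ½ ^ n
    step-nonNeg n = 0≤* (0≤a-1 1≤a) (<⇒≤ (0<^ n 0<½))

    coarse-step : ∀ k → ι (2 ℕ.^ k) * ((a - 1ℚ) * ½ ^ (j ℕ.+ k)) ≡ (a - 1ℚ) * ½ ^ j
    coarse-step k = trans (solve 3 (λ x y z → x :* (y :* z) := y :* (x :* z)) refl (ι (2 ℕ.^ k)) (a - 1ℚ) (½ ^ (j ℕ.+ k)))
      (cong ((a - 1ℚ) *_) (½^-split j k))

    -- The first `2 ^ (n ∸ j)` subintervals cover a stretch of length `(a - 1) / 2 ^ j`, at most 1,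
    -- and contribute at most 1. The rest is reached by `j` doublings. The bound is uniform in
    -- `n ≥ j`, as the diagonal sequence in `log` requires.
    riemann-≤ : ∀ n → j ℕ.≤ n → a - 1ℚ ≤ ι (2 ℕ.^ j) → riemann n a ≤ ι (suc j)
    riemann-≤ n j≤n a-1≤ = subst (λ n → riemann n a ≤ ι (suc j)) (ℕ.m+[n∸m]≡n j≤n) (begin
      riemann (j ℕ.+ k) a                 ≤⟨ ∑-leftTerm-2^-≤ (step-nonNeg (j ℕ.+ k)) j k ⟩
      ι j + ι (2 ℕ.^ k) * ((a - 1ℚ) * ½ ^ (j ℕ.+ k)) ≡⟨ cong (ι j +_) (coarse-step k) ⟩
      ι j + (a - 1ℚ) * ½ ^ j              ≤⟨ +-monoʳ-≤ (ι j) (*-monoʳ (<⇒≤ (0<^ j 0<½)) a-1≤) ⟩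
      ι j + ι (2 ℕ.^ j) * ½ ^ j           ≡⟨ cong (ι j +_) (ι2^*½^ j) ⟩
      ι j + 1ℚ                            ≡⟨ trans (+-comm (ι j) 1ℚ) (sym (ι-suc j)) ⟩
      ι (suc j)                           ∎)
      where
      open ≤-Reasoning
      k = n ℕ.∸ j

    riemann-≥ : ∀ n → j ℕ.≤ n → ι (2 ℕ.^ j) ≤ a - 1ℚ → ι j * ¼ ≤ riemann n a
    riemann-≥ n j≤n ≤a-1 = subst (λ n → ι j * ¼ ≤ riemann n a) (ℕ.m+[n∸m]≡n j≤n)
      (∑-leftTerm-2^-≥ (step-nonNeg (j ℕ.+ k)) j k (begin
        1ℚ                              ≡⟨ ι2^*½^ j ⟨
        ι (2 ℕ.^ j) * ½ ^ j             ≤⟨ *-monoʳ (<⇒≤ (0<^ j 0<½)) ≤a-1 ⟩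
        (a - 1ℚ) * ½ ^ j                ≡⟨ coarse-step k ⟨
        ι (2 ℕ.^ k) * ((a - 1ℚ) * ½ ^ (j ℕ.+ k)) ∎))
      where
      open ≤-Reasoning
      k = n ℕ.∸ j

  -- Roots, dyadic scale of a real, and floors

  rootApprox-^-≤ : ∀ d n {a b} → a ≤ b → 0ℚ ≤ b → rootApprox (suc d) n a ^ suc d ≤ b
  rootApprox-^-≤ d n {a} {b} a≤b 0≤b = go (search-lower (suc d) (w n) a (suc n ℕ.* suc n))
    where
    s = search (suc d) (w n) a (suc n ℕ.* suc n)
    go : s ≡ 0 ⊎ (ι s * w n) ^ suc d ≤ a → (ι s * w n) ^ suc d ≤ b
    go (inj₂ ≤a) = ≤-trans ≤a a≤b
    -- The default value 0 of the search: its power is 0 because the exponent is positive, and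
    -- `0 ≤ b` takes over.
    go (inj₁ s≡0) = subst (_≤ b) (sym (trans (cong (_* (ι s * w n) ^ d) (trans (cong (λ s → ι s * w n) s≡0) (*-zeroˡ (w n))))
      (*-zeroˡ ((ι s * w n) ^ d)))) 0≤b

  last-holding : ∀ {P : ℕ → Set} → Decidable P → ∀ m d → P m → ¬ P (d ℕ.+ m) → ∃[ n ] m ℕ.≤ n × P n × ¬ P (suc n)
  last-holding P? m zero    pm ¬p = contradiction pm ¬p
  last-holding P? m (suc d) pm ¬p with P? (d ℕ.+ m)
  ... | yes p  = d ℕ.+ m , ℕ.m≤n+m m d , p , ¬p
  ... | no  ¬q = last-holding P? m d pm ¬q

  open ℝ

  ⅛ : ℚ
  ⅛ = ½ * ¼

  0<⅛ : 0ℝ <ℝ fromℚ ⅛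
  0<⅛ = ⅛ , positive⁻¹ ⅛ , 0 , λ _ _ → ≤-reflexive (+-identityˡ ⅛)

  -- m plays the role of log₂ x.
  scale : ∀ M x → fromℕ (2 ℕ.^ M ℕ.+ 3) ≤ℝ x →
    ∃[ m ] M ℕ.≤ m × ∃[ N ] ∀ n → N ℕ.≤ n → ι (2 ℕ.^ m) + 1ℚ ≤ seq x n × seq x n - 1ℚ ≤ ι (2 ℕ.^ (2 ℕ.+ m))
  scale M x X≤x =
    let N₁ , above = X≤x 1ℚ (positive⁻¹ 1ℚ)
        N₂ , close = cauchy x 1ℚ (positive⁻¹ 1ℚ)
    in go N₁ above N₂ close
    where
    open ≤-Reasoning
    go : ∀ N₁ → (∀ n → N₁ ℕ.≤ n → ι (2 ℕ.^ M ℕ.+ 3) ≤ seq x n + 1ℚ) →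
         ∀ N₂ → (∀ m n → N₂ ℕ.≤ m → N₂ ℕ.≤ n → ∣ seq x m - seq x n ∣ ≤ 1ℚ) →
         ∃[ m ] M ℕ.≤ m × ∃[ N ] ∀ n → N ℕ.≤ n → ι (2 ℕ.^ m) + 1ℚ ≤ seq x n × seq x n - 1ℚ ≤ ι (2 ℕ.^ (2 ℕ.+ m))
    go N₁ above N₂ close =
      let B , a≤B = archimedean a
          m , M≤m , below , not-above = last-holding fits? M B fitsM (λ fits → too-big B a≤B fits)
      in m , M≤m , N , λ n N≤n → lower-bound m below n N≤n , upper-bound m not-above n N≤n
      where
      N = N₁ ℕ.⊔ N₂
      a = seq x N
      -- Of the margin 2, one unit is lost to the oscillation of `seq x` beyond `N` and one remains
      -- in the conclusion. The threshold has 3 because the comparison with `x` loses another unit.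
      Fits : ℕ → Set
      Fits m = ι (2 ℕ.^ m) + ι 2 ≤ a
      fits? : Decidable Fits
      fits? m = ι (2 ℕ.^ m) + ι 2 ≤? a
      fitsM : Fits M
      fitsM = begin
        ι (2 ℕ.^ M) + ι 2                    ≡⟨ solve 1 (λ y → y :+ con (ι 2) := (y :+ con (ι 3)) :- con 1ℚ) refl (ι (2 ℕ.^ M)) ⟩
        ι (2 ℕ.^ M) + ι 3 - 1ℚ               ≡⟨ cong (_- 1ℚ) (ι-+ (2 ℕ.^ M) 3) ⟨
        ι (2 ℕ.^ M ℕ.+ 3) - 1ℚ               ≤⟨ +-monoˡ-≤ (- 1ℚ) (above N (ℕ.m≤m⊔n N₁ N₂)) ⟩
        a + 1ℚ - 1ℚ                          ≡⟨ solve 1 (λ a → a :+ con 1ℚ :- con 1ℚ := a) refl a ⟩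
        a                                    ∎
      too-big : ∀ B → a ≤ ι B → ¬ Fits (B ℕ.+ M)
      too-big B a≤B fits = <-irrefl refl (begin-strict
        a                                    ≤⟨ a≤B ⟩
        ι B                                  ≤⟨ ι-mono (ℕ.≤-trans (ℕ.m≤m+n B M) (ℕ.<⇒≤ (n<2^n (B ℕ.+ M)))) ⟩
        ι (2 ℕ.^ (B ℕ.+ M))                  ≡⟨ +-identityʳ (ι (2 ℕ.^ (B ℕ.+ M))) ⟨
        ι (2 ℕ.^ (B ℕ.+ M)) + 0ℚ             <⟨ +-monoʳ-< (ι (2 ℕ.^ (B ℕ.+ M))) (0<ιsuc 1) ⟩
        ι (2 ℕ.^ (B ℕ.+ M)) + ι 2            ≤⟨ fits ⟩
        a                                    ∎)
      lower-bound : ∀ m → Fits m → ∀ n → N ℕ.≤ n → ι (2 ℕ.^ m) + 1ℚ ≤ seq x n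
      lower-bound m fits n N≤n = begin
        ι (2 ℕ.^ m) + 1ℚ                     ≡⟨ solve 1 (λ y → y :+ con 1ℚ := (y :+ con (ι 2)) :- con 1ℚ) refl (ι (2 ℕ.^ m)) ⟩
        ι (2 ℕ.^ m) + ι 2 - 1ℚ               ≤⟨ +-monoˡ-≤ (- 1ℚ) (≤-trans fits (∣-∣≤⇒≤ {a} {seq x n} (close N n (ℕ.m≤n⊔m N₁ N₂) (max₂ {N₁} N≤n)))) ⟩
        seq x n + 1ℚ - 1ℚ                    ≡⟨ solve 1 (λ a → a :+ con 1ℚ :- con 1ℚ := a) refl (seq x n) ⟩
        seq x n                              ∎
      upper-bound : ∀ m → ¬ Fits (suc m) → ∀ n → N ℕ.≤ n → seq x n - 1ℚ ≤ ι (2 ℕ.^ (2 ℕ.+ m))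
      upper-bound m not-fits n N≤n = begin
        seq x n - 1ℚ                         ≤⟨ +-monoˡ-≤ (- 1ℚ) (∣-∣≤⇒≤ {seq x n} {a} (close n N (max₂ {N₁} N≤n) (ℕ.m≤n⊔m N₁ N₂))) ⟩
        a + 1ℚ - 1ℚ                          ≡⟨ solve 1 (λ a → a :+ con 1ℚ :- con 1ℚ := a) refl a ⟩
        a                                    ≤⟨ <⇒≤ (≰⇒> not-fits) ⟩
        ι (2 ℕ.^ suc m) + ι 2                ≡⟨ ι-+ (2 ℕ.^ suc m) 2 ⟨
        ι (2 ℕ.^ suc m ℕ.+ 2)                ≤⟨ ι-mono (ℕ.+-monoʳ-≤ (2 ℕ.^ suc m) (ℕ.≤-trans (ℕ.*-monoʳ-≤ 2 (ℕ.m^n>0 2 m)) (ℕ.m≤m+n (2 ℕ.^ suc m) 0))) ⟩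
        ι (2 ℕ.^ (2 ℕ.+ m))                  ∎

  1≤^ℝ : ∀ x n → 1ℚ ≤ seq x n → ∀ d → 1ℚ ≤ seq (x ^ℝ d) n
  1≤^ℝ x n 1≤x zero    = ≤-refl
  1≤^ℝ x n 1≤x (suc d) = *-mono 0≤1 1≤x 0≤1 (1≤^ℝ x n 1≤x d)

  -- Origin of the constant 1/8: for `k ≥ 1` one has `8 * (k - ½) ≥ 4 * k`, so the slack ½ left by
  -- the inequality between reals costs only a factor 2. For `k = 0` the power is 0.
  floor-power : ∀ d k B ρ → ι k ≤ ⅛ * ρ + ½ → ρ ^ suc d ≤ ι B → (4 ℕ.* k) ℕ.^ suc d ℕ.≤ B
  floor-power d zero    B ρ k≤ ρ^≤ = ℕ.z≤n
  floor-power d k@(suc _) B ρ k≤ ρ^≤ = ι-cancel-≤ (begin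
    ι ((4 ℕ.* k) ℕ.^ suc d)   ≡⟨ ι-^ (4 ℕ.* k) (suc d) ⟩
    ι (4 ℕ.* k) ^ suc d       ≤⟨ ^-mono (suc d) (0≤ι (4 ℕ.* k)) 4k≤ρ ⟩
    ρ ^ suc d                 ≤⟨ ρ^≤ ⟩
    ι B                       ∎)
    where
    open ≤-Reasoning
    4k≤ρ : ι (4 ℕ.* k) ≤ ρ
    4k≤ρ = begin
      ι (4 ℕ.* k)                         ≡⟨ ι-* 4 k ⟩
      ι 4 * ι k                           ≡⟨ solve 1 (λ y → con (ι 4) :* y := con (ι 8) :* (y :- con ½) :- con (ι 4) :* (y :- con 1ℚ)) refl (ι k) ⟩
      ι 8 * (ι k - ½) - ι 4 * (ι k - 1ℚ)  ≤⟨ +-monoʳ-≤ (ι 8 * (ι k - ½)) (neg-antimono-≤ (0≤* {ι 4} (0≤ι 4) (0≤a-1 (ι-mono {1} {k} (ℕ.s≤s ℕ.z≤n))))) ⟩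
      ι 8 * (ι k - ½) + 0ℚ                ≡⟨ +-identityʳ (ι 8 * (ι k - ½)) ⟩
      ι 8 * (ι k - ½)                     ≤⟨ *-monoˡ {c = ι 8} (0≤ι 8) (+-monoˡ-≤ (- ½) k≤) ⟩
      ι 8 * (⅛ * ρ + ½ - ½)               ≡⟨ solve 1 (λ r → con (ι 8) :* (con ⅛ :* r :+ con ½ :- con ½) := r) refl ρ ⟩
      ρ                                   ∎

  quotient-≤ : ∀ {L D B} → 0ℚ ≤ L → L ≤ B → 1ℚ ≤ D → L * recip D ≤ B
  quotient-≤ {L} {D} {B} 0≤L L≤B 1≤D = begin
    L * recip D  ≤⟨ *-monoˡ 0≤L (recip-≤1 1≤D) ⟩
    L * 1ℚ       ≡⟨ *-identityʳ L ⟩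
    L            ≤⟨ L≤B ⟩
    B            ∎
    where open ≤-Reasoning

  floor-root : ∀ d y k B N → (∀ n → N ℕ.≤ n → seq y n ≤ ι B) → fromℕ k ≤ℝ fromℚ ⅛ *ℝ root (suc d) y →
    (4 ℕ.* k) ℕ.^ suc d ℕ.≤ B
  floor-root d y k B N y≤B k≤ =
    let N₁ , k≤root = k≤ ½ 0<½
        n = N ℕ.⊔ N₁
    in floor-power d k B (rootApprox (suc d) n (seq y n)) (k≤root n (ℕ.m≤n⊔m N N₁))
         (rootApprox-^-≤ d n (y≤B n (ℕ.m≤m⊔n N N₁)) (0≤ι B))

  -- Assembly for real x

  module _ {p : ℕ → ℕ} (isOddPrimeSequence : IsOddPrimeSequence p) (ε : ℕ → Fin 2) where

    -- `K` is the largest index count whose solution fits below `2 ^ m`, and `114 ≤ m` makes room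
    -- for `K = 0`. The same `n` serves every admissible `k`, since the floor is only given
    -- afterwards, as a relation.
    parities-below : ∀ m → 114 ℕ.≤ m →
      ∃[ n ] 0 ℕ.< n × n ℕ.≤ 2 ℕ.^ m × (∀ k → (4 ℕ.* k) ℕ.^ 9 ℕ.≤ m ℕ.+ 3 → ∀ i → i ℕ.< k → e (p i) n % 2 ≡ toℕ (ε i))
    parities-below m 114≤m =
      let K , _ , room , no-more = last-holding {Room} (λ K → _ ℕ.≤? m) 0 m 114≤m no-room
          n , 0<n , n≤ , parities = prescribed-parities isOddPrimeSequence ε K
      in n , 0<n , ℕ.≤-trans n≤ (ℕ.^-monoʳ-≤ 2 room) , λ k power≤ i i<k →
         parities i (ℕ.≤-trans i<k (index-bound K m k (ℕ.≰⇒> no-more) power≤))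
      where
      Room : ℕ → Set
      Room K = 114 ℕ.* (suc K ℕ.* suc K ℕ.* suc K) ℕ.≤ m
      no-room : ¬ Room (m ℕ.+ 0)
      no-room room = ℕ.<⇒≱ (ℕ.n<1+n m) (ℕ.≤-trans (ℕ.≤-trans (ℕ.≤-reflexive (cong suc (sym (ℕ.+-identityʳ m))))
        (ℕ.≤-trans (ℕ.m≤n*m y (y ℕ.* y)) (ℕ.m≤n*m (y ℕ.* y ℕ.* y) 114))) room)
        where y = suc (m ℕ.+ 0)

    Attained : ℝ → Set
    Attained x =
      Σ[ 0<x ∈ 0ℝ <ℝ x ]
      (let logx = log x 0<x in Σ[ 0<logx ∈ 0ℝ <ℝ logx ]
      (let loglogx = log logx 0<logx in Σ[ 0<loglogx ∈ 0ℝ <ℝ loglogx ]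
      (let r = fromℚ ⅛ *ℝ root 9 (divide logx (loglogx ^ℝ 6) (^ℝ-pos {loglogx} 6 0<loglogx)) in
      ∃[ n ] (0 ℕ.< n) × (fromℕ n <ℝ x) ×
      ((k : ℕ) → IsFloor r k →
      (i : ℕ) → i ℕ.< k → e (p i) n % 2 ≡ toℕ (ε i)))))

    module _ (x : ℝ) (m : ℕ) (114≤m : 114 ℕ.≤ m) (N₀ : ℕ)
      (near : ∀ n → N₀ ℕ.≤ n → ι (2 ℕ.^ m) + 1ℚ ≤ seq x n × seq x n - 1ℚ ≤ ι (2 ℕ.^ (2 ℕ.+ m))) where

      open ≤-Reasoning

      N : ℕ
      N = N₀ ℕ.⊔ (2 ℕ.+ m)

      module _ {i : ℕ} (N≤i : N ℕ.≤ i) where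

        2+m≤i : 2 ℕ.+ m ℕ.≤ i
        2+m≤i = max₂ {N₀} N≤i

        2^m+1≤x : ι (2 ℕ.^ m) + 1ℚ ≤ seq x i
        2^m+1≤x = proj₁ (near i (max₁ {N₀} N≤i))

        1≤x : 1ℚ ≤ seq x i
        1≤x = ≤-trans (subst (_≤ ι (2 ℕ.^ m) + 1ℚ) (+-identityˡ 1ℚ) (+-monoˡ-≤ 1ℚ (0≤ι (2 ℕ.^ m)))) 2^m+1≤x

        -- `17 = 2⁴ + 1` is what makes the iterated logarithm at least `4 * ¼ = 1`, and
        -- `17 = 68 * ¼` with `68 ≤ 114 ≤ m`.
        17≤log : ι 17 ≤ riemann i (seq x i)
        17≤log = begin
          ι 68 * ¼             ≤⟨ *-monoʳ {c = ¼} (≤ᵇ⇒≤ _) (ι-mono (ℕ.≤-trans (ℕ.m≤m+n 68 46) 114≤m)) ⟩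
          ι m * ¼              ≤⟨ riemann-≥ 1≤x m i (ℕ.≤-trans (ℕ.m≤n+m m 2) 2+m≤i)
                                    (subst (_≤ seq x i - 1ℚ) (solve 1 (λ y → y :+ con 1ℚ :- con 1ℚ := y) refl (ι (2 ℕ.^ m)))
                                      (+-monoˡ-≤ (- 1ℚ) 2^m+1≤x)) ⟩
          riemann i (seq x i)  ∎

        1≤log : 1ℚ ≤ riemann i (seq x i)
        1≤log = ≤-trans (ι-mono {1} {17} (ℕ.s≤s ℕ.z≤n)) 17≤log

        -- `scale` bounds `x - 1` by `2 ^ (2 + m)`, and the initial stretch of the Riemann sum adds
        -- one: this is the 3 in `index-bound`.
        log≤ : riemann i (seq x i) ≤ ι (m ℕ.+ 3)
        log≤ = ≤-trans (riemann-≤ 1≤x (2 ℕ.+ m) i 2+m≤i (proj₂ (near i (max₁ {N₀} N≤i))))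
          (≤-reflexive (cong ι (ℕ.+-comm 3 m)))

        1≤loglog : 1ℚ ≤ riemann i (riemann i (seq x i))
        1≤loglog = riemann-≥ 1≤log 4 i (ℕ.≤-trans (ℕ.+-monoʳ-≤ 2 (ℕ.≤-trans (ℕ.m≤m+n 2 112) 114≤m)) 2+m≤i)
          (+-monoˡ-≤ (- 1ℚ) 17≤log)

      attained : Attained x
      attained =
        let n , 0<n , n≤ , parities = parities-below m 114≤m
        in 0<x , 0<logx , 0<loglogx , n , 0<n ,
           (1ℚ , positive⁻¹ 1ℚ , N , λ i N≤i → ≤-trans (+-monoˡ-≤ 1ℚ (ι-mono n≤)) (2^m+1≤x N≤i)) ,
           λ k (k≤r , _) → parities k (floor-root 8 y k (m ℕ.+ 3) N y≤ k≤r)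
        where
        0<x : 0ℝ <ℝ x
        0<x = 1ℚ , positive⁻¹ 1ℚ , N , λ i N≤i → 1≤x N≤i
        logx = log x 0<x
        0<logx : 0ℝ <ℝ logx
        0<logx = 1ℚ , positive⁻¹ 1ℚ , N , λ i N≤i → 1≤log N≤i
        loglogx = log logx 0<logx
        0<loglogx : 0ℝ <ℝ loglogx
        0<loglogx = 1ℚ , positive⁻¹ 1ℚ , N , λ i N≤i → 1≤loglog N≤i
        y = divide logx (loglogx ^ℝ 6) (^ℝ-pos {loglogx} 6 0<loglogx)
        -- A divisor at least 1 can only lower the quotient, so the bound for the logarithm carries
        -- over.
        y≤ : ∀ i → N ℕ.≤ i → seq y i ≤ ι (m ℕ.+ 3)
        y≤ i N≤i = quotient-≤ (≤-trans 0≤1 (1≤log N≤i)) (log≤ N≤i) (1≤^ℝ loglogx i (1≤loglog N≤i) 6)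

    -- The exponent 114 is the cost `114 * 1³` of `K = 0`; it also exceeds the 68 needed for the
    -- iterated logarithm.
    attained-eventually : ∀ x → fromℕ (2 ℕ.^ 114 ℕ.+ 3) ≤ℝ x → Attained x
    attained-eventually x X≤x = let m , 114≤m , N , near = scale 114 x X≤x in attained x m 114≤m N near

theorem2 : Σ[ c₁ ∈ ℝ ] (0ℝ <ℝ c₁) ×
    ((p : ℕ → ℕ) → IsOddPrimeSequence p → (ε : ℕ → Fin 2) →
    Σ[ X ∈ ℝ ] ((x : ℝ) → X ≤ℝ x →
    Σ[ 0<x ∈ 0ℝ <ℝ x ]
    (let logx = log x 0<x in Σ[ 0<logx ∈ 0ℝ <ℝ logx ]
    (let loglogx = log logx 0<logx in Σ[ 0<loglogx ∈ 0ℝ <ℝ loglogx ]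
    (let r = c₁ *ℝ root 9 (divide logx (loglogx ^ℝ 6) (^ℝ-pos {loglogx} 6 0<loglogx)) in
    ∃[ n ] (0 ℕ.< n) × (fromℕ n <ℝ x) ×
    ((k : ℕ) → IsFloor r k →
    (i : ℕ) → i ℕ.< k → e (p i) n % 2 ≡ toℕ (ε i)))))))
theorem2 = fromℚ Analysis.⅛ , Analysis.0<⅛ , λ p isOddPrimeSequence ε →
  fromℕ (2 ℕ.^ 114 ℕ.+ 3) , Analysis.attained-eventually isOddPrimeSequence ε
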